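{- For every $\Delta^0_2$-computable real number $\alpha \in [0,1]$ there is a $\Delta^0_2$ sequence $S \in \mathbf{C}$ such that $\dim(S) = \alpha$.
   Context: Strings are elements of $\{0,1\}^*$; $\mathbf{C}$ (Cantor space) is the set of all infinite binary sequences $S = S[0]S[1]S[2]\ldots$; $S[0..n-1]$ is the string of the first $n$ bits of $S$. A function $f : D \to \mathbb{R}$ on a discrete domain $D$ (such as $\mathbb{N}$ or $\{0,1\}^*$) is lower semicomputable if there is a computable $\hat f : D \times \mathbb{N} \to \mathbb{Q}$ with $\hat f(x,t) \le \hat f(x,t+1) < f(x)$ for all $x,t$ and $\lim_{t\to\infty} \hat f(x,t) = f(x)$ for all $x$. For $s \in [0,\infty)$, an $s$-supergale is a function $d : \{0,1\}^* \to [0,\infty)$ such that $d(w) \ge 2^{ -s}[d(w0)+d(w1)]$ for all $w \in \{0,1\}^*$. It is constructive if it is lower semicomputable. It succeeds on $S \in \mathbf{C}$ if $\limsup_{n\to\infty} d(S[0..n-1]) = \infty$; $S^\infty[d]$ is the set of all $S \in \mathbf{C}$ on which $d$ succeeds. For $X \subseteq \mathbf{C}$, the constructive dimension $\mathrm{cdim}(X)$ is the infimum of all $s \in [0,\infty)$ for which there is a constructive $s$-supergale $d$ with $X \subseteq S^\infty[d]$. The dimension of $S \in \mathbf{C}$ is $\dim(S) = \mathrm{cdim}(\{S\})$. A real number $\alpha$ is $\Delta^0_2$-computable if there is a function $g : \mathbb{N} \to \mathbb{Q}$, computable relative to the halting oracle, with $|g(r) - \alpha| \le 2^{ -r}$ for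 all $r \in \mathbb{N}$. A sequence $S$ is $\Delta^0_2$ if $\{n \in \mathbb{N} : S[n] = 1\}$ is decidable relative to the halting oracle. -}

module Defs where

import Algebra.Definitions.RawSemiring as RawSemiring
open import Data.Bool.Base using (Bool; true; false)
open import Data.Fin.Base using (Fin; toℕ)
open import Data.Integer.Base as ℤ using (ℤ; +_; -[1+_])
import Data.Integer.Properties as ℤ
open import Data.List.Base using (List; []; _∷_; _∷ʳ_; applyUpTo)
open import Data.Nat.Base as ℕ using (ℕ; zero; suc)
import Data.Nat.Properties as ℕ
open import Data.Product.Base using (Σ; ∃-syntax; _×_; _,_; proj₁; proj₂)
open import Data.Rational.Base as ℚ using (ℚ; 0ℚ; 1ℚ; ½; ↥_; ↧_; ↧ₙ_)
import Data.Rational.Properties as ℚ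
open import Data.Sum.Base using (_⊎_; inj₁; inj₂)
open import Data.Vec.Base using (Vec; []; _∷_; lookup)
open import Data.Vec.Relation.Binary.Pointwise.Inductive using (Pointwise)
open import Level using (0ℓ) renaming (suc to lsuc)
open import Relation.Binary.Definitions using (tri<; tri≈; tri>)
open import Relation.Binary.PropositionalEquality
  using (_≡_; _≗_; refl; sym; trans; cong; subst)
open import Relation.Nullary using (¬_; contradiction)
open import Relation.Unary using (Pred; ∅; _∈_; _∉_; _⊆_)

open RawSemiring ℚ.+-*-rawSemiring using () renaming (_^_ to _^ℚ_) public

2ℚ : ℚ
2ℚ = 1ℚ ℚ.+ 1ℚ

2^ℤ_ : ℤ → ℚ
2^ℤ (+ n)    = 2ℚ ^ℚ n
2^ℤ -[1+ n ] = ½ ^ℚ suc n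

module ℚ-Lemmas where
  <⇒≱ : ∀ {p q} → p ℚ.< q → ¬ (q ℚ.≤ p)
  <⇒≱ p<q q≤p = ℚ.<-irrefl refl (ℚ.<-≤-trans p<q q≤p)

  *-mono-nonNeg : ∀ {a b c d} → 0ℚ ℚ.≤ a → 0ℚ ℚ.≤ d → a ℚ.≤ b → c ℚ.≤ d →
                  a ℚ.* c ℚ.≤ b ℚ.* d
  *-mono-nonNeg {a} {b} {c} {d} 0≤a 0≤d a≤b c≤d = ℚ.≤-trans
    (ℚ.*-monoˡ-≤-nonNeg a {{ℚ.nonNegative 0≤a}} c≤d)
    (ℚ.*-monoʳ-≤-nonNeg d {{ℚ.nonNegative 0≤d}} a≤b)

  0≤* : ∀ {a b} → 0ℚ ℚ.≤ a → 0ℚ ℚ.≤ b → 0ℚ ℚ.≤ a ℚ.* b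
  0≤* {a} {b} 0≤a 0≤b = subst (ℚ._≤ a ℚ.* b) (ℚ.*-zeroʳ a)
    (ℚ.*-monoˡ-≤-nonNeg a {{ℚ.nonNegative 0≤a}} 0≤b)

  0≤1 : 0ℚ ℚ.≤ 1ℚ
  0≤1 = ℚ.*≤* (ℤ.+≤+ ℕ.z≤n)

  0≤½ : 0ℚ ℚ.≤ ½
  0≤½ = ℚ.*≤* (ℤ.+≤+ ℕ.z≤n)

  ½≤1 : ½ ℚ.≤ 1ℚ
  ½≤1 = ℚ.*≤* (ℤ.+≤+ (ℕ.s≤s ℕ.z≤n))

  1≤2 : 1ℚ ℚ.≤ 2ℚ
  1≤2 = ℚ.*≤* (ℤ.+≤+ (ℕ.s≤s ℕ.z≤n))

  0≤2 : 0ℚ ℚ.≤ 2ℚ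
  0≤2 = ℚ.≤-trans 0≤1 1≤2

  0≤^ : ∀ {a} n → 0ℚ ℚ.≤ a → 0ℚ ℚ.≤ a ^ℚ n
  0≤^ zero    0≤a = 0≤1
  0≤^ (suc n) 0≤a = 0≤* 0≤a (0≤^ n 0≤a)

  1≤2^ : ∀ n → 1ℚ ℚ.≤ 2ℚ ^ℚ n
  1≤2^ zero    = ℚ.≤-refl
  1≤2^ (suc n) = *-mono-nonNeg 0≤1 (0≤^ n 0≤2) 1≤2 (1≤2^ n)

  ½^≤1 : ∀ n → ½ ^ℚ n ℚ.≤ 1ℚ
  ½^≤1 zero    = ℚ.≤-refl
  ½^≤1 (suc n) = *-mono-nonNeg 0≤½ 0≤1 ½≤1 (½^≤1 n)

  2^-mono : ∀ {m n} → m ℕ.≤ n → 2ℚ ^ℚ m ℚ.≤ 2ℚ ^ℚ n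
  2^-mono {n = n} ℕ.z≤n       = 1≤2^ n
  2^-mono {n = suc n} (ℕ.s≤s m≤n) =
    *-mono-nonNeg 0≤2 (0≤^ n 0≤2) ℚ.≤-refl (2^-mono m≤n)

  2^ℤ-bound : ∀ {a n} → a ℤ.≤ + n → 2^ℤ a ℚ.≤ 2ℚ ^ℚ n
  2^ℤ-bound {+ m}      {n} (ℤ.+≤+ m≤n) = 2^-mono m≤n
  2^ℤ-bound { -[1+ m ]} {n} _           = ℚ.≤-trans (½^≤1 (suc m)) (1≤2^ n)

  ^-distrib-+ : ∀ a m n → a ^ℚ (m ℕ.+ n) ≡ a ^ℚ m ℚ.* a ^ℚ n
  ^-distrib-+ a zero    n = sym (ℚ.*-identityˡ (a ^ℚ n))
  ^-distrib-+ a (suc m) n = trans (cong (a ℚ.*_) (^-distrib-+ a m n))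
                                  (sym (ℚ.*-assoc a (a ^ℚ m) (a ^ℚ n)))

  ^-assoc : ∀ a m n → a ^ℚ (n ℕ.* m) ≡ (a ^ℚ m) ^ℚ n
  ^-assoc a m zero    = refl
  ^-assoc a m (suc n) = trans (^-distrib-+ a m (n ℕ.* m))
                              (cong (a ^ℚ m ℚ.*_) (^-assoc a m n))

  ^-mono : ∀ {a b} n → 0ℚ ℚ.≤ a → a ℚ.≤ b → a ^ℚ n ℚ.≤ b ^ℚ n
  ^-mono zero    0≤a a≤b = ℚ.≤-refl
  ^-mono (suc n) 0≤a a≤b =
    *-mono-nonNeg 0≤a (0≤^ n (ℚ.≤-trans 0≤a a≤b)) a≤b (^-mono n 0≤a a≤b)

  1≤⇒0< : ∀ {a} → 1ℚ ℚ.≤ a → 0ℚ ℚ.< a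
  1≤⇒0< = ℚ.<-≤-trans (ℚ.*<* (ℤ.+<+ (ℕ.s≤s ℕ.z≤n)))

  ^-mono-< : ∀ {a b} n → 1ℚ ℚ.≤ a → a ℚ.< b → a ^ℚ suc n ℚ.< b ^ℚ suc n
  ^-mono-< {a} {b} n 1≤a a<b = ℚ.≤-<-trans
    (ℚ.*-monoˡ-≤-nonNeg a {{ℚ.nonNegative 0≤a}} (^-mono n 0≤a (ℚ.<⇒≤ a<b)))
    (ℚ.*-monoˡ-<-pos (b ^ℚ n) {{ℚ.positive 0<bⁿ}} a<b)
    where
    0≤a : 0ℚ ℚ.≤ a
    0≤a = ℚ.≤-trans 0≤1 1≤a
    1≤^ : ∀ {c} n → 1ℚ ℚ.≤ c → 1ℚ ℚ.≤ c ^ℚ n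
    1≤^ zero    1≤c = ℚ.≤-refl
    1≤^ (suc n) 1≤c =
      *-mono-nonNeg 0≤1 (ℚ.≤-trans 0≤1 (1≤^ n 1≤c)) 1≤c (1≤^ n 1≤c)
    0<bⁿ : 0ℚ ℚ.< b ^ℚ n
    0<bⁿ = 1≤⇒0< (1≤^ n (ℚ.≤-trans 1≤a (ℚ.<⇒≤ a<b)))

  ↥≤∣↥∣*↧ : ∀ {p b} → p ℚ.< b → ↥ p ℤ.≤ + (↧ₙ p ℕ.* ℤ.∣ ↥ b ∣)
  ↥≤∣↥∣*↧ {p} {b} (ℚ.*<* lt) with ↥ p
  ... | -[1+ _ ] = ℤ.-≤+
  ... | + n = ℤ.≤-trans step₁ (ℤ.≤-trans (ℤ.<⇒≤ lt) step₂)
    where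
    step₁ : + n ℤ.≤ + n ℤ.* ↧ b
    step₁ = subst (+ n ℤ.≤_) (ℤ.pos-* n (↧ₙ b))
              (ℤ.+≤+ (ℕ.m≤m*n n (↧ₙ b)))
    ≤∣∣ : ∀ i → i ℤ.≤ + ℤ.∣ i ∣
    ≤∣∣ (+ _)    = ℤ.≤-refl
    ≤∣∣ -[1+ _ ] = ℤ.-≤+
    step₂ : ↥ b ℤ.* ↧ p ℤ.≤ + (↧ₙ p ℕ.* ℤ.∣ ↥ b ∣)
    step₂ = subst (↥ b ℤ.* ↧ p ℤ.≤_)
      (trans (ℤ.*-comm (+ ℤ.∣ ↥ b ∣) (↧ p)) (sym (ℤ.pos-* (↧ₙ p) ℤ.∣ ↥ b ∣)))
      (ℤ.*-monoʳ-≤-nonNeg (↧ p) (≤∣∣ (↥ b)))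

  ½q+½q : ∀ q → ½ ℚ.* q ℚ.+ ½ ℚ.* q ≡ q
  ½q+½q q = trans (sym (ℚ.*-distribʳ-+ q ½ ½)) (ℚ.*-identityˡ q)

  -1<0 : ℚ.- 1ℚ ℚ.< 0ℚ
  -1<0 = ℚ.*<* ℤ.-<+

  q-1<q : ∀ q → q ℚ.- 1ℚ ℚ.< q
  q-1<q q = subst (q ℚ.- 1ℚ ℚ.<_) (ℚ.+-identityʳ q) (ℚ.+-monoʳ-< q -1<0)

  q<q+1 : ∀ q → q ℚ.< q ℚ.+ 1ℚ
  q<q+1 q = subst (ℚ._< q ℚ.+ 1ℚ) (ℚ.+-identityʳ q)
              (ℚ.+-monoʳ-< q (ℚ.*<* (ℤ.+<+ (ℕ.s≤s ℕ.z≤n))))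

  ^-cancel-≤ : ∀ {a b} n → 1ℚ ℚ.≤ b → a ^ℚ suc n ℚ.≤ b ^ℚ suc n → a ℚ.≤ b
  ^-cancel-≤ n 1≤b aⁿ≤bⁿ =
    ℚ.≮⇒≥ λ b<a → <⇒≱ (^-mono-< n 1≤b b<a) aⁿ≤bⁿ

open ℚ-Lemmas

-- Real numbers: Dedekind cuts in the classical, one-sided form, a real
-- being the set of the rationals strictly below it.

record ℝ : Set₁ where
  field
    cut       : Pred ℚ 0ℓ
    nonempty  : ∃[ q ] q ∈ cut
    bounded   : ∃[ q ] q ∉ cut
    downward  : ∀ {p q} → p ℚ.< q → q ∈ cut → p ∈ cut
    noMaximum : ∀ {q} → q ∈ cut → ∃[ r ] q ℚ.< r × r ∈ cut

open ℝ public

infix 4 _≤_ _<_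

_≤_ : ℝ → ℝ → Set
x ≤ y = cut x ⊆ cut y

_<_ : ℝ → ℝ → Set
x < y = ∃[ q ] q ∉ cut x × q ∈ cut y

below : ∀ x {p q} → p ∈ cut x → q ∉ cut x → p ℚ.< q
below x {p} {q} p∈x q∉x with ℚ.<-cmp p q
... | tri< p<q _ _   = p<q
... | tri≈ _ p≡q _   = contradiction (subst (_∈ cut x) p≡q p∈x) q∉x
... | tri> _ _ q<p   = contradiction (downward x q<p p∈x) q∉x

fromℚ : ℚ → ℝ
fromℚ a = record
  { cut       = ℚ._< a
  ; nonempty  = a ℚ.- 1ℚ , q-1<q a
  ; bounded   = a , ℚ.<-irrefl refl
  ; downward  = ℚ.<-trans
  ; noMaximum = ℚ.<-dense
  }

0ℝ 1ℝ : ℝ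
0ℝ = fromℚ 0ℚ
1ℝ = fromℚ 1ℚ

infixl 6 _+_ _-_
infix  8 -_

_+_ : ℝ → ℝ → ℝ
x + y = record
  { cut       = λ q → ∃[ a ] ∃[ b ] a ∈ cut x × b ∈ cut y × q ≡ a ℚ.+ b
  ; nonempty  = let (a , a∈x) = nonempty x ; (b , b∈y) = nonempty y in
                a ℚ.+ b , a , b , a∈x , b∈y , refl
  ; bounded   = let (a , a∉x) = bounded x ; (b , b∉y) = bounded y in
                a ℚ.+ b , λ (a′ , b′ , a′∈x , b′∈y , eq) →
                ℚ.<-irrefl (sym eq)
                  (ℚ.+-mono-< (below x a′∈x a∉x) (below y b′∈y b∉y))
  ; downward  = λ { {p} {q} p<q (a , b , a∈x , b∈y , refl) →
                p ℚ.- b , b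
                , downward x (subst (p ℚ.- b ℚ.<_) (cancel a b)
                                    (ℚ.+-monoˡ-< (ℚ.- b) p<q)) a∈x
                , b∈y , sym (cancel′ p b) }
  ; noMaximum = λ { (a , b , a∈x , b∈y , refl) →
                let (a′ , a<a′ , a′∈x) = noMaximum x a∈x in
                a′ ℚ.+ b , ℚ.+-monoˡ-< b a<a′ , a′ , b , a′∈x , b∈y , refl }
  }
  where
  cancel : ∀ a b → a ℚ.+ b ℚ.- b ≡ a
  cancel a b = trans (ℚ.+-assoc a b (ℚ.- b))
    (trans (cong (a ℚ.+_) (ℚ.+-inverseʳ b)) (ℚ.+-identityʳ a))
  cancel′ : ∀ a b → a ℚ.- b ℚ.+ b ≡ a
  cancel′ a b = trans (ℚ.+-assoc a (ℚ.- b) b)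
    (trans (cong (a ℚ.+_) (ℚ.+-inverseˡ b)) (ℚ.+-identityʳ a))

-_ : ℝ → ℝ
- x = record
  { cut       = λ q → ∃[ b ] b ∉ cut x × q ℚ.< ℚ.- b
  ; nonempty  = let (b , b∉x) = bounded x in
                ℚ.- b ℚ.- 1ℚ , b , b∉x , q-1<q (ℚ.- b)
  ; bounded   = let (a , a∈x) = nonempty x in
                ℚ.- a , λ (b , b∉x , -a<-b) →
                ℚ.<-asym -a<-b (ℚ.neg-antimono-< (below x a∈x b∉x))
  ; downward  = λ p<q (b , b∉x , q<-b) → b , b∉x , ℚ.<-trans p<q q<-b
  ; noMaximum = λ (b , b∉x , q<-b) →
                let (r , q<r , r<-b) = ℚ.<-dense q<-b in
                r , q<r , b , b∉x , r<-b
  }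

_-_ : ℝ → ℝ → ℝ
x - y = x + (- y)

_⊔_ : ℝ → ℝ → ℝ
x ⊔ y = record
  { cut       = λ q → q ∈ cut x ⊎ q ∈ cut y
  ; nonempty  = let (a , a∈x) = nonempty x in a , inj₁ a∈x
  ; bounded   = let (a , a∉x) = bounded x ; (b , b∉y) = bounded y in
                a ℚ.⊔ b , λ
                { (inj₁ m∈x) → <⇒≱ (below x m∈x a∉x) (ℚ.p≤p⊔q a b)
                ; (inj₂ m∈y) → <⇒≱ (below y m∈y b∉y) (ℚ.p≤q⊔p a b) }
  ; downward  = λ { p<q (inj₁ q∈x) → inj₁ (downward x p<q q∈x)
                  ; p<q (inj₂ q∈y) → inj₂ (downward y p<q q∈y) }
  ; noMaximum = λ { (inj₁ q∈x) → let (r , q<r , r∈x) = noMaximum x q∈x in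
                                 r , q<r , inj₁ r∈x
                  ; (inj₂ q∈y) → let (r , q<r , r∈y) = noMaximum y q∈y in
                                 r , q<r , inj₂ r∈y }
  }

∣_∣ : ℝ → ℝ
∣ x ∣ = x ⊔ (- x)

ℝ≥0 : Set₁
ℝ≥0 = Σ ℝ (0ℝ ≤_)

infixl 6 _⊕_
infixl 7 _⊗_

_⊕_ : ℝ≥0 → ℝ≥0 → ℝ≥0
(x , 0≤x) ⊕ (y , 0≤y) = x + y , λ {q} q<0 →
  ½ ℚ.* q , ½ ℚ.* q , 0≤x (half<0 q<0) , 0≤y (half<0 q<0) , sym (½q+½q q)
  where
  half<0 : ∀ {q} → q ℚ.< 0ℚ → ½ ℚ.* q ℚ.< 0ℚ
  half<0 {q} q<0 = subst (½ ℚ.* q ℚ.<_) (ℚ.*-zeroʳ ½)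
    (ℚ.*-monoʳ-<-pos ½ q<0)

_⊗_ : ℝ≥0 → ℝ≥0 → ℝ≥0
(x , 0≤x) ⊗ (y , 0≤y) = record
  { cut       = Product
  ; nonempty  = ℚ.- 1ℚ , inj₁ -1<0
  ; bounded   = let (a , a∉x) = bounded x ; (b , b∉y) = bounded y in
                a ℚ.* b , λ
    { (inj₁ ab<0) → <⇒≱ ab<0 (0≤* (0≤bound x 0≤x a∉x) (0≤bound y 0≤y b∉y))
    ; (inj₂ (a′ , b′ , 0≤a′ , 0≤b′ , a′∈x , b′∈y , ab<a′b′)) →
        <⇒≱ ab<a′b′ (*-mono-nonNeg 0≤a′ (0≤bound y 0≤y b∉y)
          (ℚ.<⇒≤ (below x a′∈x a∉x)) (ℚ.<⇒≤ (below y b′∈y b∉y))) }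
  ; downward  = λ
    { p<q (inj₁ q<0) → inj₁ (ℚ.<-trans p<q q<0)
    ; p<q (inj₂ (a , b , 0≤a , 0≤b , a∈x , b∈y , q<ab)) →
        inj₂ (a , b , 0≤a , 0≤b , a∈x , b∈y , ℚ.<-trans p<q q<ab) }
  ; noMaximum = λ
    { (inj₁ q<0) → let (r , q<r , r<0) = ℚ.<-dense q<0 in r , q<r , inj₁ r<0
    ; (inj₂ (a , b , 0≤a , 0≤b , a∈x , b∈y , q<ab)) →
        let (r , q<r , r<ab) = ℚ.<-dense q<ab in
        r , q<r , inj₂ (a , b , 0≤a , 0≤b , a∈x , b∈y , r<ab) }
  } , inj₁
  where
  Product : Pred ℚ 0ℓ
  Product q = q ℚ.< 0ℚ ⊎
    ∃[ a ] ∃[ b ] 0ℚ ℚ.≤ a × 0ℚ ℚ.≤ b × a ∈ cut x × b ∈ cut y × q ℚ.< a ℚ.* b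
  0≤bound : ∀ z → 0ℝ ≤ z → ∀ {a} → a ∉ cut z → 0ℚ ℚ.≤ a
  0≤bound z 0≤z a∉z = ℚ.≮⇒≥ λ a<0 → a∉z (0≤z a<0)

-- 2^x is the supremum of the rationals r ≥ 0 with r ≤ 2^(m/n), that is
-- rⁿ ≤ 2ᵐ, for some rational m/n < x (taken in lowest terms).

infixr 8 2^_

2^_ : ℝ → ℝ≥0
2^ x = record
  { cut       = Power
  ; nonempty  = ℚ.- 1ℚ , negative -1<0
  ; bounded   = bound
  ; downward  = λ p<q (r , p , q<r , rest) → r , p , ℚ.<-trans p<q q<r , rest
  ; noMaximum = λ (r , p , q<r , rest) →
                let (q′ , q<q′ , q′<r) = ℚ.<-dense q<r in
                q′ , q<q′ , r , p , q′<r , rest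
  } , negative
  where
  Power : Pred ℚ 0ℓ
  Power q = ∃[ r ] ∃[ p ] q ℚ.< r × 0ℚ ℚ.≤ r × p ∈ cut x
                        × r ^ℚ (↧ₙ p) ℚ.≤ 2^ℤ (↥ p)
  0≤2^ℤ : ∀ i → 0ℚ ℚ.≤ 2^ℤ i
  0≤2^ℤ (+ n)    = 0≤^ n 0≤2
  0≤2^ℤ -[1+ n ] = 0≤^ (suc n) 0≤½
  negative : ∀ {q} → q ℚ.< 0ℚ → Power q
  negative q<0 = let (p , p∈x) = nonempty x in
    0ℚ , p , q<0 , ℚ.≤-refl , p∈x ,
    subst (ℚ._≤ 2^ℤ (↥ p)) (sym (ℚ.*-zeroˡ (0ℚ ^ℚ ℕ.pred (↧ₙ p)))) (0≤2^ℤ (↥ p))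
  bound : ∃[ q ] q ∉ Power
  bound = let (b , b∉x) = bounded x in
    2ℚ ^ℚ ℤ.∣ ↥ b ∣ , λ (r , p , q<r , 0≤r , p∈x , rⁿ≤2ᵐ) →
    <⇒≱ q<r (^-cancel-≤ (ℕ.pred (↧ₙ p)) (1≤2^ ℤ.∣ ↥ b ∣)
      (ℚ.≤-trans rⁿ≤2ᵐ
        (subst (2^ℤ (↥ p) ℚ.≤_) (^-assoc 2ℚ ℤ.∣ ↥ b ∣ (↧ₙ p))
          (2^ℤ-bound {↥ p} (↥≤∣↥∣*↧ (below x p∈x b∉x))))))

infix 4 _⟶_

_⟶_ : (ℕ → ℚ) → ℝ → Set
u ⟶ x = ∀ ε → 0ℚ ℚ.< ε → ∃[ N ] ∀ n → N ℕ.≤ n → ∣ fromℚ (u n) - x ∣ < fromℚ ε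

Limsup≡∞ : (ℕ → ℝ) → Set
Limsup≡∞ u = ∀ (B : ℚ) N → ∃[ n ] N ℕ.≤ n × fromℚ B < u n

record IsInfimum (X : Pred ℝ (lsuc 0ℓ)) (m : ℝ) : Set₁ where
  field
    lowerBound : ∀ x → x ∈ X → m ≤ x
    greatest   : ∀ l → (∀ x → x ∈ X → l ≤ x) → l ≤ m

data Code : ℕ → Set where
  zero   : ∀ {n} → Code n
  suc    : Code 1
  proj   : ∀ {n} → Fin n → Code n
  oracle : Code 1
  comp   : ∀ {m n} → Code m → Vec (Code n) m → Code n
  rec    : ∀ {n} → Code n → Code (2 ℕ.+ n) → Code (1 ℕ.+ n)
  min    : ∀ {n} → Code (1 ℕ.+ n) → Code n

infix 4 _⊢_[_]⇓_

data _⊢_[_]⇓_ (A : Pred ℕ 0ℓ) : ∀ {n} → Code n → Vec ℕ n → ℕ → Set where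
  zero⇓ : ∀ {n} {xs : Vec ℕ n} → A ⊢ zero [ xs ]⇓ 0
  suc⇓  : ∀ {x} → A ⊢ suc [ x ∷ [] ]⇓ suc x
  proj⇓ : ∀ {n} {i : Fin n} {xs} → A ⊢ proj i [ xs ]⇓ lookup xs i
  yes⇓  : ∀ {x} → x ∈ A → A ⊢ oracle [ x ∷ [] ]⇓ 1
  no⇓   : ∀ {x} → x ∉ A → A ⊢ oracle [ x ∷ [] ]⇓ 0
  comp⇓ : ∀ {m n} {f : Code m} {gs : Vec (Code n) m} {xs ys z} →
          Pointwise (λ g y → A ⊢ g [ xs ]⇓ y) gs ys →
          A ⊢ f [ ys ]⇓ z → A ⊢ comp f gs [ xs ]⇓ z
  rec⇓₀ : ∀ {n} {f : Code n} {g xs y} →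
          A ⊢ f [ xs ]⇓ y → A ⊢ rec f g [ 0 ∷ xs ]⇓ y
  rec⇓₊ : ∀ {n} {f : Code n} {g xs k y z} →
          A ⊢ rec f g [ k ∷ xs ]⇓ y → A ⊢ g [ k ∷ y ∷ xs ]⇓ z →
          A ⊢ rec f g [ suc k ∷ xs ]⇓ z
  min⇓  : ∀ {n} {f : Code (1 ℕ.+ n)} {xs y} →
          (∀ i → i ℕ.< y → ∃[ k ] A ⊢ f [ i ∷ xs ]⇓ suc k) →
          A ⊢ f [ y ∷ xs ]⇓ 0 → A ⊢ min f [ xs ]⇓ y

-- The Cantor pairing function, a bijection

triangle : ℕ → ℕ
triangle zero    = 0
triangle (suc n) = suc n ℕ.+ triangle n

pair : ℕ → ℕ → ℕ
pair x y = triangle (x ℕ.+ y) ℕ.+ y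

-- Gödel numbers, injective on the codes of each fixed arity

mutual
  ⌜_⌝ : ∀ {n} → Code n → ℕ
  ⌜ zero ⌝            = pair 0 0
  ⌜ suc ⌝             = pair 1 0
  ⌜ proj i ⌝          = pair 2 (toℕ i)
  ⌜ oracle ⌝          = pair 3 0
  ⌜ comp {m} f gs ⌝   = pair 4 (pair m (pair ⌜ f ⌝ ⌜ gs ⌝*))
  ⌜ rec f g ⌝         = pair 5 (pair ⌜ f ⌝ ⌜ g ⌝)
  ⌜ min f ⌝           = pair 6 ⌜ f ⌝

  ⌜_⌝* : ∀ {m n} → Vec (Code n) m → ℕ
  ⌜ [] ⌝*     = 0
  ⌜ g ∷ gs ⌝* = pair ⌜ g ⌝ ⌜ gs ⌝*

-- The halting set { ⟨e,x⟩ : φₑ(x)↓ }; e is run with the empty oracle.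

Halting : Pred ℕ 0ℓ
Halting n = Σ (Code 1) λ e → ∃[ x ] n ≡ pair ⌜ e ⌝ x × ∃[ y ] ∅ ⊢ e [ x ∷ [] ]⇓ y

Str : Set
Str = List Bool

encodeBool : Bool → ℕ
encodeBool false = 0
encodeBool true  = 1

-- A bijection: in binary, 1 + encodeStr w is a leading 1 followed by the
-- reversal of w.

encodeStr : Str → ℕ
encodeStr []      = 0
encodeStr (b ∷ w) = 1 ℕ.+ encodeBool b ℕ.+ 2 ℕ.* encodeStr w

encodeℤ : ℤ → ℕ
encodeℤ (+ n)    = 2 ℕ.* n
encodeℤ -[1+ n ] = 1 ℕ.+ 2 ℕ.* n

encodeℚ : ℚ → ℕ
encodeℚ q = pair (encodeℤ (↥ q)) (↧ₙ q)

LowerSemicomputable : (Str → ℝ) → Set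
LowerSemicomputable f = Σ (Str → ℕ → ℚ) λ f̂ →
    (Σ (Code 2) λ c → ∀ w t →
       ∅ ⊢ c [ encodeStr w ∷ t ∷ [] ]⇓ encodeℚ (f̂ w t))
  × (∀ w t → f̂ w t ℚ.≤ f̂ w (suc t) × fromℚ (f̂ w (suc t)) < f w)
  × (∀ w → f̂ w ⟶ f w)

Δ⁰₂-Computable : ℝ → Set
Δ⁰₂-Computable α = Σ (ℕ → ℚ) λ g →
    (Σ (Code 1) λ c → ∀ r → Halting ⊢ c [ r ∷ [] ]⇓ encodeℚ (g r))
  × (∀ r → ∣ fromℚ (g r) - α ∣ ≤ fromℚ (½ ^ℚ r))

Cantor : Set
Cantor = ℕ → Bool

Δ⁰₂-Sequence : Cantor → Set
Δ⁰₂-Sequence S = Σ (Code 1) λ c → ∀ n → Halting ⊢ c [ n ∷ [] ]⇓ encodeBool (S n)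

IsSupergale : ℝ → (Str → ℝ≥0) → Set
IsSupergale s d =
  ∀ w → proj₁ (2^ (- s) ⊗ (d (w ∷ʳ false) ⊕ d (w ∷ʳ true))) ≤ proj₁ (d w)

IsConstructive : (Str → ℝ≥0) → Set
IsConstructive d = LowerSemicomputable λ w → proj₁ (d w)

-- applyUpTo S n is the string S[0..n-1].

S^∞[_] : (Str → ℝ≥0) → Pred Cantor 0ℓ
S^∞[ d ] S = Limsup≡∞ λ n → proj₁ (d (applyUpTo S n))

-- The values are relations: IsCdim X α says that cdim(X) = α, and
-- IsDim S α says that dim(S) = α.

IsCdim : Pred Cantor 0ℓ → ℝ → Set₁
IsCdim X = IsInfimum λ s → 0ℝ ≤ s
  × Σ (Str → ℝ≥0) λ d → IsSupergale s d × IsConstructive d × X ⊆ S^∞[ d ]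

-- The singleton {S} is taken up to pointwise equality, the equality of
-- sequences in the absence of function extensionality.

IsDim : Cantor → ℝ → Set₁
IsDim S = IsCdim (S ≗_)

{-# OPTIONS --safe #-}
module Submission where

-- The sequence is built in blocks: block k has length k + 1, and only its first
-- p_k bits are free, the others being 0, where p_k/(k + 1) → α.  Every pair (n, j)
-- with n, j ≤ k names a test in block k, decided by one question to the halting
-- set: does the n-th candidate approximation show that the candidate prefix has
-- capital above a threshold that halves with each block?  The free bits avoid all
-- the tests met by less than a fraction 1/(k + 1)² of the 2^(p_k) candidates, which
-- the union bound allows.  If d is a constructive s-supergale with s < α, a Kraft
-- inequality makes its own tests that rare from some block on, so the bound on its
-- capital is halved by each block; inside block k the capital grows at most by the
-- factor 2^k, hence it stays bounded.  No universal gale is needed, and an index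
-- that is not the code of a supergale does no harm.
--
-- If s > β > α, then for almost all k the free positions of block k lie below
-- β (k + 1), so the computable gale that bets on 0 from position β (k + 1) of each
-- block on succeeds, although p is not computable.

open import Axiom.ExcludedMiddle using (ExcludedMiddle)
open import Data.Bool.Base using (Bool; true; false)
open import Data.Fin.Base using (Fin; zero; suc; toℕ; _↑ʳ_)
open import Data.Fin.Properties using (toℕ-injective)
open import Data.Fin.Patterns using (0F; 1F; 2F; 3F; 4F)
open import Data.Integer.Base as ℤ using (ℤ; -[1+_])
import Data.Integer.Properties as ℤ
open import Data.List.Base using ([]; _∷_; _∷ʳ_; _++_; length; applyUpTo)
open import Data.List.Properties using (++-assoc; ++-identityʳ; length-++; length-applyUpTo)
open import Data.Nat.Base as ℕ using (ℕ; zero; suc; _+_; _*_; _∸_; _^_; z≤n; s≤s)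
open import Data.Nat.Coprimality using (1-coprimeTo; coprime-divisor; recompute)
  renaming (sym to coprime-sym)
open import Data.Nat.DivMod using (_/_; /-monoˡ-≤; m*n/n≡m; m/n*n≤m; m≡m%n+[m/n]*n; m%n<n)
open import Data.Nat.Divisibility using (_∣_; divides; ∣⇒≤)
import Data.Nat.Properties as ℕ
open import Data.Nat.Tactic.RingSolver using (solve-∀)
open import Data.Product.Base using (Σ; ∃-syntax; _×_; _,_; proj₁; proj₂)
open import Data.Rational.Base as ℚ using (ℚ; 0ℚ; 1ℚ; ½; ↥_; ↧_; ↧ₙ_)
import Data.Rational.Properties as ℚ
import Data.Rational.Unnormalised.Base as ℚᵘ
open import Data.Sum.Base using (_⊎_; inj₁; inj₂)
open import Data.Vec.Base using (Vec; []; _∷_; lookup; tabulate; drop)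
open import Data.Vec.Properties using (tabulate∘lookup)
open import Data.Vec.Relation.Binary.Pointwise.Inductive using (Pointwise; []; _∷_; tabulate⁺)
open import Level using (Lift; lift; 0ℓ) renaming (suc to lsuc)
open import Relation.Binary.Definitions using (tri<; tri≈; tri>)
open import Relation.Binary.PropositionalEquality hiding ([_])
open import Relation.Nullary using (¬_; Dec; yes; no; contradiction)
open import Relation.Nullary.Decidable.Core using (dec⇒maybe)
open import Relation.Unary using (Pred; ∅; _∈_; _∉_; _⊆_)
open import Tactic.RingSolver using () renaming (solve-∀ to ring-solve-∀)
open import Tactic.RingSolver.Core.AlmostCommutativeRing
  using (AlmostCommutativeRing; fromCommutativeRing)
open import Defs hiding (_+_; _-_; -_; ∣_∣; _⊔_)
open ℚ-Lemmas

-- Computable functions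

-- The tests do not mention s: a test knows only an index and a threshold, and s enters when the
-- blocks meeting it are counted. A lower semicomputable capital can be recognised as large but
-- never as small, so "capital above a rational" is a halting question, and the number of the
-- machine to ask about is computed from n alone, code or not. Whatever the oracle answers for a
-- stray index, its test is either rare or ignored, so the choice of a block never fails.
--
-- Kraft pays for the halving: if the capital before block k is at most the threshold, at most 2 ·
-- 2^(s(k+1)) of its extensions exceed half of it, up to a rational approximation of 2^s. Against
-- about 2^(α(k+1)) candidates, the gap between s and α leaves an exponential factor that beats
-- (k+1)². Both bounds on the dimension use two steps of size 1/(1+b) between rational exponents:
-- one for a rational approximation of a power of two, one for beating a polynomial or constant
-- factor.

⇓-resp-≡ : ∀ {A n} {c : Code n} {xs y z} → y ≡ z → A ⊢ c [ xs ]⇓ y → A ⊢ c [ xs ]⇓ z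
⇓-resp-≡ refl c⇓ = c⇓

record Computable (A : Pred ℕ 0ℓ) {n} (f : Vec ℕ n → ℕ) : Set where
  constructor computable
  field
    code : Code n
    run  : ∀ xs → A ⊢ code [ xs ]⇓ f xs

open Computable

record Computable* (A : Pred ℕ 0ℓ) {m n} (F : Vec ℕ n → Vec ℕ m) : Set where
  constructor computable*
  field
    codes : Vec (Code n) m
    runs  : ∀ xs → Pointwise (λ g y → A ⊢ g [ xs ]⇓ y) codes (F xs)

open Computable*

module _ {A : Pred ℕ 0ℓ} where

  []ᶜ : ∀ {n} → Computable* A {n = n} (λ _ → [])
  []ᶜ = computable* [] λ _ → []

  infixr 5 _∷ᶜ_
  _∷ᶜ_ : ∀ {m n} {g : Vec ℕ n → ℕ} {G : Vec ℕ n → Vec ℕ m} →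
         Computable A g → Computable* A G → Computable* A (λ xs → g xs ∷ G xs)
  g ∷ᶜ G = computable* (code g ∷ codes G) λ xs → run g xs ∷ runs G xs

  infixr 9 _∘ᶜ_
  _∘ᶜ_ : ∀ {m n} {f : Vec ℕ m → ℕ} {G : Vec ℕ n → Vec ℕ m} →
         Computable A f → Computable* A G → Computable A (λ xs → f (G xs))
  f ∘ᶜ G = computable (comp (code f) (codes G))
    λ xs → comp⇓ (runs G xs) (run f _)

  projᶜ : ∀ {n} (i : Fin n) → Computable A (λ xs → lookup xs i)
  projᶜ i = computable (proj i) λ _ → proj⇓

  sucᶜ : ∀ {n} {f : Vec ℕ n → ℕ} → Computable A f → Computable A (λ xs → suc (f xs))
  sucᶜ {f = f} F = _∘ᶜ_ {f = λ xs → suc (lookup xs 0F)}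
    (computable suc λ { (x ∷ []) → suc⇓ }) (F ∷ᶜ []ᶜ)

  constᶜ : ∀ {n} k → Computable A {n} (λ _ → k)
  constᶜ zero    = computable zero λ _ → zero⇓
  constᶜ (suc k) = sucᶜ (constᶜ k)

  tabulateᶜ : ∀ {m n} (ι : Fin m → Fin n) →
              Computable* A (λ xs → tabulate λ i → lookup xs (ι i))
  tabulateᶜ ι = computable* (tabulate λ i → proj (ι i)) λ xs → tabulate⁺ λ i → proj⇓

  dropᶜ : ∀ k {n} → Computable* A {n} {k + n} (drop k)
  dropᶜ k {n} = computable* (codes (tabulateᶜ (k ↑ʳ_))) λ xs →
    subst (Pointwise _ _) (eq k xs) (runs (tabulateᶜ (k ↑ʳ_)) xs)
    where
    eq : ∀ k {n} (xs : Vec ℕ (k + n)) → tabulate (λ i → lookup xs (k ↑ʳ i)) ≡ drop k xs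
    eq zero    xs       = tabulate∘lookup xs
    eq (suc k) (x ∷ xs) = eq k xs

  extᶜ : ∀ {n} {f g : Vec ℕ n → ℕ} → (∀ xs → f xs ≡ g xs) → Computable A f → Computable A g
  extᶜ f≗g F = computable (code F) λ xs → ⇓-resp-≡ (f≗g xs) (run F xs)

  -- The intended function `h` is given separately, so that the coded recursion only has to agree
  -- with it at the base and at each step.
  recᶜ : ∀ {n} {b : Vec ℕ n → ℕ} {s : Vec ℕ (2 + n) → ℕ} {k : Vec ℕ n → ℕ}
         (h : ℕ → Vec ℕ n → ℕ) →
         (∀ xs → b xs ≡ h 0 xs) → (∀ k xs → s (k ∷ h k xs ∷ xs) ≡ h (suc k) xs) →
         Computable A b → Computable A s → Computable A k →
         Computable A (λ xs → h (k xs) xs)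
  recᶜ {n} {b} {s} {k} h base step B S K =
    computable (comp r (code K ∷ codes (dropᶜ 0))) λ xs → comp⇓ (run K xs ∷ runs (dropᶜ 0) xs)
        (rec⇓ (k xs) xs)
    where
    r = rec (code B) (code S)
    rec⇓ : ∀ k xs → A ⊢ r [ k ∷ xs ]⇓ h k xs
    rec⇓ zero    xs = rec⇓₀ (⇓-resp-≡ (base xs) (run B xs))
    rec⇓ (suc k) xs = rec⇓₊ (rec⇓ k xs) (⇓-resp-≡ (step k xs) (run S _))

  module _ {n} {f g : Vec ℕ n → ℕ} (F : Computable A f) (G : Computable A g) where

    infixl 6 _+ᶜ_ _∸ᶜ_

    _+ᶜ_ : Computable A (λ xs → f xs + g xs)
    _+ᶜ_ = recᶜ {n = 2} {k = λ xs → lookup xs 0F} (λ k xs → k + lookup xs 1F)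
      (λ _ → refl) (λ _ _ → refl) (projᶜ 1F) (sucᶜ (projᶜ 1F)) (projᶜ 0F)
      ∘ᶜ (F ∷ᶜ G ∷ᶜ []ᶜ)

    _∸ᶜ_ : Computable A (λ xs → f xs ∸ g xs)
    _∸ᶜ_ = recᶜ {n = 2} {k = λ xs → lookup xs 1F} (λ k xs → lookup xs 0F ∸ k)
      (λ _ → refl) (λ k xs → ℕ.pred[m∸n]≡m∸[1+n] (lookup xs 0F) k)
      (projᶜ 0F) predᶜ (projᶜ 1F)
      ∘ᶜ (F ∷ᶜ G ∷ᶜ []ᶜ)
      where
      predᶜ : Computable A {4} (λ xs → ℕ.pred (lookup xs 1F))
      predᶜ = recᶜ {n = 4} {b = λ _ → 0} {s = λ xs → lookup xs 0F} {k = λ xs → lookup xs 1F}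
        (λ k _ → ℕ.pred k) (λ _ → refl) (λ _ _ → refl)
        (constᶜ 0) (projᶜ 0F) (projᶜ 1F)

  module _ {n} {f g : Vec ℕ n → ℕ} (F : Computable A f) (G : Computable A g) where

    infixl 7 _*ᶜ_

    _*ᶜ_ : Computable A (λ xs → f xs * g xs)
    _*ᶜ_ = recᶜ {n = 2} {k = λ xs → lookup xs 0F} (λ k xs → k * lookup xs 1F)
      (λ _ → refl) (λ _ _ → refl) (constᶜ 0) (projᶜ 3F +ᶜ projᶜ 1F) (projᶜ 0F)
      ∘ᶜ (F ∷ᶜ G ∷ᶜ []ᶜ)

  module _ {n} {f g : Vec ℕ n → ℕ} (F : Computable A f) (G : Computable A g) where

    infixr 8 _^ᶜ_

    _^ᶜ_ : Computable A (λ xs → f xs ^ g xs)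
    _^ᶜ_ = recᶜ {n = 2} {k = λ xs → lookup xs 1F} (λ k xs → lookup xs 0F ^ k)
      (λ _ → refl) (λ _ _ → refl) (constᶜ 1) (projᶜ 2F *ᶜ projᶜ 1F) (projᶜ 1F)
      ∘ᶜ (F ∷ᶜ G ∷ᶜ []ᶜ)

-- Bounded operations and the inverses of the pairing function

∑ : ℕ → (ℕ → ℕ) → ℕ
∑ zero    f = 0
∑ (suc n) f = ∑ n f + f n

∏ : ℕ → (ℕ → ℕ) → ℕ
∏ zero    f = 1
∏ (suc n) f = ∏ n f * f n

if0 : ℕ → ℕ → ℕ → ℕ
if0 zero    x y = x
if0 (suc _) x y = y

-- Bounded minimisation by primitive recursion. If there is no zero below the bound, the value is
-- the bound itself; for `free` this default is the full length of the block.
search : ℕ → (ℕ → ℕ) → ℕ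
search zero    f = 0
search (suc n) f = if0 (f (search n f)) (search n f) (suc n)

search-≤ : ∀ n f → search n f ℕ.≤ n
search-≤ zero    f = z≤n
search-≤ (suc n) f with f (search n f)
... | zero  = ℕ.m≤n⇒m≤1+n (search-≤ n f)
... | suc _ = ℕ.≤-refl

search-zero : ∀ n (f : ℕ → ℕ) {x} → x ℕ.≤ n → f x ≡ 0 → f (search n f) ≡ 0
search-zero zero    f z≤n fx≡0 = fx≡0
search-zero (suc n) f {x} x≤n fx≡0 with f (search n f) in eq
... | zero  = eq
... | suc _ with ℕ.m≤n⇒m<n∨m≡n x≤n
...   | inj₂ refl = fx≡0
...   | inj₁ (s≤s x≤n) = contradiction (trans (sym eq) (search-zero n f x≤n fx≡0)) λ ()

search-least : ∀ n (f : ℕ → ℕ) {x} → x ℕ.< search n f → f x ≢ 0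
search-least (suc n) f {x} x< fx≡0 with f (search n f) in eq
... | zero  = search-least n f x< fx≡0
... | suc _ = ℕ.1+n≢0 (trans (sym eq) (search-zero n f (ℕ.≤-pred x<) fx≡0))

-- The largest m with `triangle m` ≤ n, which grows by at most one when n does. It inverts the
-- pairing, and it also locates positions of the sequence: as block k starts at `triangle k`,
-- position n lies in block `diagonal n` at offset `π₂ n`.
diagonal : ℕ → ℕ
diagonal zero    = 0
diagonal (suc n) = if0 (triangle (suc (diagonal n)) ∸ suc n) (suc (diagonal n)) (diagonal n)

π₁ π₂ : ℕ → ℕ
π₂ n = n ∸ triangle (diagonal n)
π₁ n = diagonal n ∸ π₂ n

triangle-mono : ∀ {m n} → m ℕ.≤ n → triangle m ℕ.≤ triangle n
triangle-mono z≤n       = z≤n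
triangle-mono (s≤s m≤n) = ℕ.+-mono-≤ (s≤s m≤n) (triangle-mono m≤n)

diagonal-lower : ∀ n → triangle (diagonal n) ℕ.≤ n
diagonal-lower zero    = z≤n
diagonal-lower (suc n) with triangle (suc (diagonal n)) ∸ suc n in eq
... | zero  = ℕ.m∸n≡0⇒m≤n eq
... | suc _ = ℕ.m≤n⇒m≤1+n (diagonal-lower n)

diagonal-upper : ∀ n → n ℕ.< triangle (suc (diagonal n))
diagonal-upper zero    = s≤s z≤n
diagonal-upper (suc n) with triangle (suc (diagonal n)) ∸ suc n in eq
... | zero  = ℕ.≤-<-trans (diagonal-upper n)
                (ℕ.m<n+m (triangle (suc (diagonal n))) {suc (suc (diagonal n))} (s≤s z≤n))
... | suc k = ℕ.m∸n≢0⇒n<m λ eq′ → ℕ.1+n≢0 (trans (sym eq) eq′)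

triangle-< : ∀ {m n x} → triangle m ℕ.≤ x → x ℕ.< triangle (suc n) → m ℕ.≤ n
triangle-< {m} {n} m≤x x<n = ℕ.≮⇒≥ λ n<m →
  ℕ.<⇒≱ x<n (ℕ.≤-trans (triangle-mono n<m) m≤x)

diagonal-triangle : ∀ {n x} → triangle n ℕ.≤ x → x ℕ.< triangle (suc n) → diagonal x ≡ n
diagonal-triangle {n} {x} lo up = ℕ.≤-antisym
  (triangle-< {diagonal x} (diagonal-lower x) up) (triangle-< {n} lo (diagonal-upper x))

diagonal-+ : ∀ n {j} → j ℕ.≤ n → diagonal (triangle n + j) ≡ n
diagonal-+ n {j} j≤n = diagonal-triangle (ℕ.m≤m+n (triangle n) j)
  (ℕ.≤-trans (s≤s (ℕ.+-monoʳ-≤ (triangle n) j≤n))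
    (ℕ.≤-reflexive (cong suc (ℕ.+-comm (triangle n) n))))

π₂-+ : ∀ n {j} → j ℕ.≤ n → π₂ (triangle n + j) ≡ j
π₂-+ n {j} j≤n rewrite diagonal-+ n j≤n = ℕ.m+n∸m≡n (triangle n) j

π₂≤diagonal : ∀ n → π₂ n ℕ.≤ diagonal n
π₂≤diagonal n = ℕ.+-cancelˡ-≤ t (π₂ n) (diagonal n) (subst₂ ℕ._≤_
  (sym (ℕ.m+[n∸m]≡n (diagonal-lower n))) (ℕ.+-comm (diagonal n) t) (ℕ.≤-pred (diagonal-upper n)))
  where
  t : ℕ
  t = triangle (diagonal n)

π₂-pair : ∀ x y → π₂ (pair x y) ≡ y
π₂-pair x y = π₂-+ (x + y) (ℕ.m≤n+m y x)

π₁-pair : ∀ x y → π₁ (pair x y) ≡ x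
π₁-pair x y rewrite π₂-pair x y | diagonal-+ (x + y) (ℕ.m≤n+m y x) = ℕ.m+n∸n≡m x y

pair-injective : ∀ {a b c d} → pair a b ≡ pair c d → a ≡ c × b ≡ d
pair-injective {a} {b} {c} {d} eq =
  trans (sym (π₁-pair a b)) (trans (cong π₁ eq) (π₁-pair c d)) ,
  trans (sym (π₂-pair a b)) (trans (cong π₂ eq) (π₂-pair c d))

parity half : ℕ → ℕ
parity zero    = 0
parity (suc n) = 1 ∸ parity n
half zero    = 0
half (suc n) = half n + parity n

shift : ℕ → ℕ → ℕ
shift v zero    = v
shift v (suc i) = half (shift v i)

-- exceeds (encodeℚ q) a b is positive iff q > a/b; a negative q has numerator⁺ 0.

numerator⁺ : ℕ → ℕ
numerator⁺ z = if0 (parity (π₁ z)) (half (π₁ z)) 0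

exceeds : ℕ → ℕ → ℕ → ℕ
exceeds z a b = numerator⁺ z * b ∸ a * π₂ z

module _ {A : Pred ℕ 0ℓ} where

  ∑ᶜ : ∀ {n} {f : Vec ℕ (suc n) → ℕ} {k : Vec ℕ n → ℕ} →
       Computable A f → Computable A k → Computable A (λ xs → ∑ (k xs) λ i → f (i ∷ xs))
  ∑ᶜ {f = f} F K = recᶜ (λ k xs → ∑ k λ i → f (i ∷ xs)) (λ _ → refl) (λ _ _ → refl)
    (constᶜ 0) (projᶜ 1F +ᶜ F ∘ᶜ (projᶜ 0F ∷ᶜ dropᶜ 2)) K

  ∏ᶜ : ∀ {n} {f : Vec ℕ (suc n) → ℕ} {k : Vec ℕ n → ℕ} →
       Computable A f → Computable A k → Computable A (λ xs → ∏ (k xs) λ i → f (i ∷ xs))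
  ∏ᶜ {f = f} F K = recᶜ (λ k xs → ∏ k λ i → f (i ∷ xs)) (λ _ → refl) (λ _ _ → refl)
    (constᶜ 1) (projᶜ 1F *ᶜ F ∘ᶜ (projᶜ 0F ∷ᶜ dropᶜ 2)) K

  if0ᶜ : ∀ {n} {f g h : Vec ℕ n → ℕ} → Computable A f → Computable A g → Computable A h →
         Computable A (λ xs → if0 (f xs) (g xs) (h xs))
  if0ᶜ F G H = recᶜ {n = 3} {k = λ xs → lookup xs 0F}
    (λ k xs → if0 k (lookup xs 1F) (lookup xs 2F)) (λ _ → refl) (λ _ _ → refl)
    (projᶜ 1F) (projᶜ 4F) (projᶜ 0F) ∘ᶜ (F ∷ᶜ G ∷ᶜ H ∷ᶜ []ᶜ)

  searchᶜ : ∀ {n} {f : Vec ℕ (suc n) → ℕ} {k : Vec ℕ n → ℕ} →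
       Computable A f → Computable A k → Computable A (λ xs → search (k xs) λ i → f (i ∷ xs))
  searchᶜ {f = f} F K = recᶜ (λ k xs → search k λ i → f (i ∷ xs)) (λ _ → refl) (λ _ _ → refl)
    (constᶜ 0) (if0ᶜ (F ∘ᶜ (projᶜ 1F ∷ᶜ dropᶜ 2)) (projᶜ 1F) (sucᶜ (projᶜ 0F))) K

  module _ {n} {f : Vec ℕ n → ℕ} (F : Computable A f) where

    triangleᶜ : Computable A (λ xs → triangle (f xs))
    triangleᶜ = recᶜ (λ k _ → triangle k) (λ _ → refl) (λ _ _ → refl)
      (constᶜ 0) (sucᶜ (projᶜ 0F) +ᶜ projᶜ 1F) F

    parityᶜ : Computable A (λ xs → parity (f xs))
    parityᶜ = recᶜ (λ k _ → parity k) (λ _ → refl) (λ _ _ → refl)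
      (constᶜ 0) (constᶜ 1 ∸ᶜ projᶜ 1F) F

  module _ {n} {f : Vec ℕ n → ℕ} (F : Computable A f) where

    diagonalᶜ : Computable A (λ xs → diagonal (f xs))
    diagonalᶜ = recᶜ (λ k _ → diagonal k) (λ _ → refl) (λ _ _ → refl) (constᶜ 0)
      (if0ᶜ (triangleᶜ (sucᶜ (projᶜ 1F)) ∸ᶜ sucᶜ (projᶜ 0F)) (sucᶜ (projᶜ 1F)) (projᶜ 1F)) F

    halfᶜ : Computable A (λ xs → half (f xs))
    halfᶜ = recᶜ (λ k _ → half k) (λ _ → refl) (λ _ _ → refl)
      (constᶜ 0) (projᶜ 1F +ᶜ parityᶜ (projᶜ 0F)) F

  module _ {n} {f : Vec ℕ n → ℕ} (F : Computable A f) where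

    π₂ᶜ : Computable A (λ xs → π₂ (f xs))
    π₂ᶜ = F ∸ᶜ triangleᶜ (diagonalᶜ F)

    π₁ᶜ : Computable A (λ xs → π₁ (f xs))
    π₁ᶜ = diagonalᶜ F ∸ᶜ π₂ᶜ

  module _ {n} {f g : Vec ℕ n → ℕ} (F : Computable A f) (G : Computable A g) where

    pairᶜ : Computable A (λ xs → pair (f xs) (g xs))
    pairᶜ = triangleᶜ (F +ᶜ G) +ᶜ G

    shiftᶜ : Computable A (λ xs → shift (f xs) (g xs))
    shiftᶜ = recᶜ {n = 2} {k = λ xs → lookup xs 1F} (λ k xs → shift (lookup xs 0F) k)
      (λ _ → refl) (λ _ _ → refl) (projᶜ 0F) (halfᶜ (projᶜ 1F)) (projᶜ 1F)
      ∘ᶜ (F ∷ᶜ G ∷ᶜ []ᶜ)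

  exceedsᶜ : ∀ {n} {f g h : Vec ℕ n → ℕ} → Computable A f → Computable A g → Computable A h →
             Computable A (λ xs → exceeds (f xs) (g xs) (h xs))
  exceedsᶜ F G H =
    if0ᶜ (parityᶜ (π₁ᶜ F)) (halfᶜ (π₁ᶜ F)) (constᶜ 0) *ᶜ H ∸ᶜ G *ᶜ π₂ᶜ F

-- Gödel numbers and the halting set

mutual
  deterministic : ∀ {A n} {c : Code n} {xs y z} → A ⊢ c [ xs ]⇓ y → A ⊢ c [ xs ]⇓ z → y ≡ z
  deterministic zero⇓        zero⇓        = refl
  deterministic suc⇓         suc⇓         = refl
  deterministic proj⇓        proj⇓        = refl
  deterministic (yes⇓ _)     (yes⇓ _)     = refl
  deterministic (yes⇓ x∈A)   (no⇓ x∉A)    = contradiction x∈A x∉A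
  deterministic (no⇓ x∉A)    (yes⇓ x∈A)   = contradiction x∈A x∉A
  deterministic (no⇓ _)      (no⇓ _)      = refl
  deterministic (comp⇓ p q)  (comp⇓ p′ q′) with refl ← deterministic* p p′ = deterministic q q′
  deterministic (rec⇓₀ p)    (rec⇓₀ p′)    = deterministic p p′
  deterministic (rec⇓₊ p q)  (rec⇓₊ p′ q′) with refl ← deterministic p p′ = deterministic q q′
  deterministic (min⇓ {y = y} p q) (min⇓ {y = y′} p′ q′) with ℕ.<-cmp y y′
  ... | tri< y<y′ _ _ = contradiction (deterministic (proj₂ (p′ y y<y′)) q) λ ()
  ... | tri≈ _ y≡y′ _ = y≡y′
  ... | tri> _ _ y′<y = contradiction (deterministic (proj₂ (p y′ y′<y)) q′) λ ()

  deterministic* : ∀ {A m n} {gs : Vec (Code n) m} {xs ys zs} →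
                   Pointwise (λ g y → A ⊢ g [ xs ]⇓ y) gs ys →
                   Pointwise (λ g y → A ⊢ g [ xs ]⇓ y) gs zs → ys ≡ zs
  deterministic* []       []         = refl
  deterministic* (p ∷ ps) (p′ ∷ ps′) = cong₂ _∷_ (deterministic p p′) (deterministic* ps ps′)

tag body : ∀ {n} → Code n → ℕ
tag zero       = 0
tag suc        = 1
tag (proj _)   = 2
tag oracle     = 3
tag (comp _ _) = 4
tag (rec _ _)  = 5
tag (min _)    = 6
body zero            = 0
body suc             = 0
body (proj i)        = toℕ i
body oracle          = 0
body (comp {m} f gs) = pair m (pair ⌜ f ⌝ ⌜ gs ⌝*)
body (rec f g)       = pair ⌜ f ⌝ ⌜ g ⌝
body (min f)         = ⌜ f ⌝

⌜⌝-pair : ∀ {n} (c : Code n) → ⌜ c ⌝ ≡ pair (tag c) (body c)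
⌜⌝-pair zero       = refl
⌜⌝-pair suc        = refl
⌜⌝-pair (proj _)   = refl
⌜⌝-pair oracle     = refl
⌜⌝-pair (comp _ _) = refl
⌜⌝-pair (rec _ _)  = refl
⌜⌝-pair (min _)    = refl

mutual
  -- Membership in `Halting` yields some machine with the queried number; injectivity identifies it
  -- with the machine that the query was made for.
  ⌜⌝-injective : ∀ {n} {c d : Code n} → ⌜ c ⌝ ≡ ⌜ d ⌝ → c ≡ d
  ⌜⌝-injective {c = c} {d} eq =
    let (t , b) = pair-injective (trans (sym (⌜⌝-pair c)) (trans eq (⌜⌝-pair d)))
    in tag-body-injective c d t b

  tag-body-injective : ∀ {n} (c d : Code n) → tag c ≡ tag d → body c ≡ body d → c ≡ d
  tag-body-injective zero        zero          _ _ = refl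
  tag-body-injective suc         suc           _ _ = refl
  tag-body-injective (proj i)    (proj j)      _ b = cong proj (toℕ-injective b)
  tag-body-injective oracle      oracle        _ _ = refl
  tag-body-injective (comp {m} f gs) (comp {m′} f′ gs′) _ b
    with refl , b′ ← pair-injective {m} {c = m′} b
    with f≡ , gs≡ ← pair-injective {⌜ f ⌝} {c = ⌜ f′ ⌝} b′ =
    cong₂ comp (⌜⌝-injective f≡) (⌜⌝*-injective gs gs′ gs≡)
  tag-body-injective (rec f g)   (rec f′ g′)   _ b =
    let (f≡ , g≡) = pair-injective b in cong₂ rec (⌜⌝-injective f≡) (⌜⌝-injective g≡)
  tag-body-injective (min f)     (min g)       _ b = cong min (⌜⌝-injective b)

  ⌜⌝*-injective : ∀ {m n} (gs hs : Vec (Code n) m) → ⌜ gs ⌝* ≡ ⌜ hs ⌝* → gs ≡ hs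
  ⌜⌝*-injective []       []       _ = refl
  ⌜⌝*-injective (g ∷ gs) (h ∷ hs) b =
    let (g≡ , gs≡) = pair-injective b in cong₂ _∷_ (⌜⌝-injective g≡) (⌜⌝*-injective gs hs gs≡)

-- Abstract, so that their Gödel numbers are never evaluated.

abstract
  testᶜ : Computable ∅ {3} (λ xs → 1 ∸ exceeds (lookup xs 0F) (lookup xs 1F) (lookup xs 2F))
  testᶜ = constᶜ 1 ∸ᶜ exceedsᶜ (projᶜ 0F) (projᶜ 1F) (projᶜ 2F)

  wordᶜ : Computable ∅ {2} (λ xs → π₁ (lookup xs 1F))
  wordᶜ = π₁ᶜ (projᶜ 1F)

  dividendᶜ : Computable ∅ {2} (λ xs → π₁ (π₂ (lookup xs 1F)))
  dividendᶜ = π₁ᶜ (π₂ᶜ (projᶜ 1F))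

  divisorᶜ : Computable ∅ {2} (λ xs → π₂ (π₂ (lookup xs 1F)))
  divisorᶜ = π₂ᶜ (π₂ᶜ (projᶜ 1F))

-- On t and the packed triple (w, a, b) the result is 0 exactly if the t-th approximation at w
-- exceeds a/b. Minimising over t therefore halts exactly if some approximation does.
searcherBody : Code 2 → Code 2
searcherBody c = comp (code testᶜ)
  (comp c (code wordᶜ ∷ proj 0F ∷ []) ∷ code dividendᶜ ∷ code divisorᶜ ∷ [])

searcher : Code 2 → Code 1
searcher c = min (searcherBody c)

-- Abstract copies, since pair unfolds on literals into huge unary terms.

abstract
  ⟪_,_⟫ : ℕ → ℕ → ℕ
  ⟪ x , y ⟫ = pair x y

  gödel : ∀ {n} → Code n → ℕ
  gödel c = ⌜ c ⌝

  gödel* : ∀ {m n} → Vec (Code n) m → ℕ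
  gödel* cs = ⌜ cs ⌝*

  gödel≡⌜⌝ : ∀ {n} (c : Code n) → gödel c ≡ ⌜ c ⌝
  gödel≡⌜⌝ c = refl

  ⟪⟫ᶜ : ∀ {A n} {f g : Vec ℕ n → ℕ} → Computable A f → Computable A g →
        Computable A (λ xs → ⟪ f xs , g xs ⟫)
  ⟪⟫ᶜ = pairᶜ

  gödel-min : ∀ {n} (f : Code (suc n)) → ⟪ 6 , gödel f ⟫ ≡ gödel (Code.min f)
  gödel-min f = refl

  gödel-comp : ∀ {m n} (f : Code m) (gs : Vec (Code n) m) →
               ⟪ 4 , ⟪ m , ⟪ gödel f , gödel* gs ⟫ ⟫ ⟫ ≡ gödel (comp f gs)
  gödel-comp f gs = refl

  gödel*-∷ : ∀ {m n} (g : Code n) (gs : Vec (Code n) m) → ⟪ gödel g , gödel* gs ⟫ ≡ gödel* (g ∷ gs)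
  gödel*-∷ g gs = refl

-- An instance of the s-m-n theorem: the passage from `c` to `searcher c`, carried out on numbers.
-- It is defined on every number, so indices need not be checked to be codes.
searcherBodyIndex searcherIndex : ℕ → ℕ
searcherBodyIndex e = ⟪ 4 , ⟪ 3 , ⟪ gödel (code testᶜ) ,
  ⟪ ⟪ 4 , ⟪ 2 , ⟪ e , gödel* (code wordᶜ ∷ proj 0F ∷ []) ⟫ ⟫ ⟫ ,
    gödel* (code dividendᶜ ∷ code divisorᶜ ∷ []) ⟫ ⟫ ⟫ ⟫
searcherIndex e = ⟪ 6 , searcherBodyIndex e ⟫

searcherBodyIndex-gödel : ∀ c → searcherBodyIndex (gödel c) ≡ gödel (searcherBody c)
searcherBodyIndex-gödel c = trans
  (cong (λ z → ⟪ 4 , ⟪ 3 , ⟪ gödel (code testᶜ) , z ⟫ ⟫ ⟫)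
    (trans (cong (λ z → ⟪ z , gödel* (code dividendᶜ ∷ code divisorᶜ ∷ []) ⟫)
              (gödel-comp c (code wordᶜ ∷ proj 0F ∷ [])))
           (gödel*-∷ (comp c (code wordᶜ ∷ proj 0F ∷ []))
                     (code dividendᶜ ∷ code divisorᶜ ∷ []))))
  (gödel-comp (code testᶜ) _)

searcherIndex-⌜⌝ : ∀ c → searcherIndex ⌜ c ⌝ ≡ ⌜ searcher c ⌝
searcherIndex-⌜⌝ c = trans (cong searcherIndex (sym (gödel≡⌜⌝ c)))
  (trans (cong (λ z → ⟪ 6 , z ⟫) (searcherBodyIndex-gödel c))
         (trans (gödel-min (searcherBody c)) (gödel≡⌜⌝ (searcher c))))

searcherIndexᶜ : ∀ {A n} {e : Vec ℕ n → ℕ} →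
                 Computable A e → Computable A (λ xs → searcherIndex (e xs))
searcherIndexᶜ E = ⟪⟫ᶜ (constᶜ 6) (⟪⟫ᶜ (constᶜ 4) (⟪⟫ᶜ (constᶜ 3)
  (⟪⟫ᶜ (constᶜ (gödel (code testᶜ)))
    (⟪⟫ᶜ (⟪⟫ᶜ (constᶜ 4) (⟪⟫ᶜ (constᶜ 2)
             (⟪⟫ᶜ E (constᶜ (gödel* (code wordᶜ ∷ proj 0F ∷ []))))))
           (constᶜ (gödel* (code dividendᶜ ∷ code divisorᶜ ∷ [])))))))

query : ℕ → ℕ → ℕ → ℕ → ℕ
query e w a b = pair (searcherIndex e) (pair w (pair a b))

queryᶜ : ∀ {A n} {e w a b : Vec ℕ n → ℕ} →
         Computable A e → Computable A w → Computable A a → Computable A b →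
         Computable A (λ xs → query (e xs) (w xs) (a xs) (b xs))
queryᶜ E W P Q = pairᶜ (searcherIndexᶜ E) (pairᶜ W (pairᶜ P Q))

module _ (c : Code 2) (w : ℕ) (f : ℕ → ℕ) (run-c : ∀ t → ∅ ⊢ c [ w ∷ t ∷ [] ]⇓ f t)
         (a b : ℕ) where

  private
    x : ℕ
    x = pair w (pair a b)

  searcherBody-run : ∀ t → ∅ ⊢ searcherBody c [ t ∷ x ∷ [] ]⇓ (1 ∸ exceeds (f t) a b)
  searcherBody-run t = comp⇓
    (comp⇓ (word ∷ proj⇓ ∷ []) (run-c t) ∷ dividend ∷ divisor ∷ []) (run testᶜ (f t ∷ a ∷ b ∷ []))
    where
    word : ∅ ⊢ code wordᶜ [ t ∷ x ∷ [] ]⇓ w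
    word = ⇓-resp-≡ (π₁-pair w (pair a b)) (run wordᶜ (t ∷ x ∷ []))
    dividend : ∅ ⊢ code dividendᶜ [ t ∷ x ∷ [] ]⇓ a
    dividend = ⇓-resp-≡
      (trans (cong π₁ (π₂-pair w (pair a b))) (π₁-pair a b)) (run dividendᶜ (t ∷ x ∷ []))
    divisor : ∅ ⊢ code divisorᶜ [ t ∷ x ∷ [] ]⇓ b
    divisor = ⇓-resp-≡
      (trans (cong π₂ (π₂-pair w (pair a b))) (π₂-pair a b)) (run divisorᶜ (t ∷ x ∷ []))

  halting-query⁻ : query ⌜ c ⌝ w a b ∈ Halting → ∃[ t ] exceeds (f t) a b ≢ 0
  halting-query⁻ (e , y , eq , z , run-e) =
    let (i≡ , x≡y) = pair-injective {searcherIndex ⌜ c ⌝} {x} {⌜ e ⌝} {y} eq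
    in found (⌜⌝-injective {c = searcher c} (trans (sym (searcherIndex-⌜⌝ c)) i≡)) x≡y run-e
    where
    found : ∀ {e y z} → searcher c ≡ e → x ≡ y → ∅ ⊢ e [ y ∷ [] ]⇓ z → ∃[ t ] exceeds (f t) a b ≢ 0
    found refl refl (min⇓ {y = t} _ run-t) = t , λ eq → ℕ.1+n≢0
      (trans (cong (1 ∸_) (sym eq)) (deterministic (searcherBody-run t) run-t))

  halting-query⁺ : ∀ t → exceeds (f t) a b ≢ 0 → query ⌜ c ⌝ w a b ∈ Halting
  halting-query⁺ t exc =
    searcher c , x , cong (λ i → pair i x) (searcherIndex-⌜⌝ c) , s ,
    min⇓ before (⇓-resp-≡ found (searcherBody-run s))
    where
    g : ℕ → ℕ
    g t = 1 ∸ exceeds (f t) a b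
    s : ℕ
    s = search t g
    vanish : ∀ n → n ≢ 0 → 1 ∸ n ≡ 0
    vanish zero    n≢0 = contradiction refl n≢0
    vanish (suc n) _   = ℕ.0∸n≡0 n
    found : g s ≡ 0
    found = search-zero t g ℕ.≤-refl (vanish _ exc)
    positive : ∀ n → n ≢ 0 → ∃[ k ] n ≡ suc k
    positive zero    n≢0 = contradiction refl n≢0
    positive (suc n) _   = n , refl
    before : ∀ i → i ℕ.< s → ∃[ k ] ∅ ⊢ searcherBody c [ i ∷ x ∷ [] ]⇓ suc k
    before i i<s with positive (g i) (search-least t g i<s)
    ... | k , eq = k , ⇓-resp-≡ eq (searcherBody-run i)

-- Binary expansions

toBool : ℕ → Bool
toBool zero    = false
toBool (suc _) = true

bits : ℕ → ℕ → Str
bits zero    v = []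
bits (suc l) v = toBool (parity v) ∷ bits l (half v)

parity≤1 : ∀ n → parity n ℕ.≤ 1
parity≤1 zero    = z≤n
parity≤1 (suc n) = ℕ.m∸n≤m 1 (parity n)

encodeBool-parity : ∀ n → encodeBool (toBool (parity n)) ≡ parity n
encodeBool-parity n with parity n | parity≤1 n
... | 0 | _ = refl
... | 1 | _ = refl
... | suc (suc _) | s≤s ()

parity-2+ : ∀ n → parity (2 + n) ≡ parity n
parity-2+ n = ℕ.m∸[m∸n]≡n (parity≤1 n)

half-2+ : ∀ n → half (2 + n) ≡ suc (half n)
half-2+ n = trans (ℕ.+-assoc (half n) (parity n) (1 ∸ parity n))
  (trans (cong (half n +_) (ℕ.m+[n∸m]≡n (parity≤1 n))) (ℕ.+-comm (half n) 1))

2*suc : ∀ a x → a + 2 * suc x ≡ 2 + (a + 2 * x)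
2*suc = solve-∀

parity-+2* : ∀ a x → parity (a + 2 * x) ≡ parity a
parity-+2* a zero    = cong parity (ℕ.+-identityʳ a)
parity-+2* a (suc x) = trans (cong parity (2*suc a x))
  (trans (parity-2+ (a + 2 * x)) (parity-+2* a x))

half-+2* : ∀ a x → half (a + 2 * x) ≡ half a + x
half-+2* a zero    = trans (cong half (ℕ.+-identityʳ a)) (sym (ℕ.+-identityʳ (half a)))
half-+2* a (suc x) = trans (cong half (2*suc a x)) (trans (half-2+ (a + 2 * x))
  (trans (cong suc (half-+2* a x)) (sym (ℕ.+-suc (half a) x))))

parity+2*half : ∀ n → parity n + 2 * half n ≡ n
parity+2*half zero          = refl
parity+2*half (suc zero)    = refl
parity+2*half (suc (suc n)) =
  trans (cong₂ (λ p h → p + 2 * h) (parity-2+ n) (half-2+ n))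
    (trans (2*suc (parity n) (half n)) (cong (2 +_) (parity+2*half n)))

half-< : ∀ {l v} → v ℕ.< 2 ^ suc l → half v ℕ.< 2 ^ l
half-< {l} {v} v< = ℕ.*-cancelˡ-< 2 (half v) (2 ^ l) (ℕ.≤-<-trans
  (ℕ.≤-trans (ℕ.m≤n+m (2 * half v) (parity v)) (ℕ.≤-reflexive (parity+2*half v))) v<)

suc-encodeStr-bits : ∀ l {v} → v ℕ.< 2 ^ l → suc (encodeStr (bits l v)) ≡ 2 ^ l + v
suc-encodeStr-bits zero    {zero} _ = refl
suc-encodeStr-bits zero    {suc _} (s≤s ())
suc-encodeStr-bits (suc l) {v} v< = begin
  2 + encodeBool (toBool (parity v)) + 2 * encodeStr (bits l (half v))
    ≡⟨ cong (λ p → 2 + p + 2 * encodeStr (bits l (half v))) (encodeBool-parity v) ⟩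
  2 + parity v + 2 * encodeStr (bits l (half v))
    ≡⟨ rearrange₁ (parity v) (encodeStr (bits l (half v))) ⟩
  parity v + 2 * suc (encodeStr (bits l (half v)))
    ≡⟨ cong (λ e → parity v + 2 * e) (suc-encodeStr-bits l (half-< {l} v<)) ⟩
  parity v + 2 * (2 ^ l + half v)
    ≡⟨ rearrange₂ (parity v) (2 ^ l) (half v) ⟩
  2 ^ suc l + (parity v + 2 * half v)
    ≡⟨ cong (2 ^ suc l +_) (parity+2*half v) ⟩
  2 ^ suc l + v ∎
  where
  open ≡-Reasoning
  rearrange₁ : ∀ p e → 2 + p + 2 * e ≡ p + 2 * suc e
  rearrange₁ = solve-∀
  rearrange₂ : ∀ p x h → p + 2 * (x + h) ≡ 2 * x + (p + 2 * h)
  rearrange₂ = solve-∀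

shift-half : ∀ v i → shift v (suc i) ≡ shift (half v) i
shift-half v zero    = refl
shift-half v (suc i) = cong half (shift-half v i)

2^suc-* : ∀ m b → 2 ^ suc m * b ≡ 2 * (2 ^ m * b)
2^suc-* m b = ℕ.*-assoc 2 (2 ^ m) b

parity-prefix : ∀ m a b → parity (a + 2 ^ suc m * b) ≡ parity a
parity-prefix m a b = trans (cong (λ x → parity (a + x)) (2^suc-* m b)) (parity-+2* a (2 ^ m * b))

half-prefix : ∀ m a b → half (a + 2 ^ suc m * b) ≡ half a + 2 ^ m * b
half-prefix m a b = trans (cong (λ x → half (a + x)) (2^suc-* m b)) (half-+2* a (2 ^ m * b))

shift-prefix : ∀ {m i} a b → i ℕ.< m → parity (shift (a + 2 ^ m * b) i) ≡ parity (shift a i)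
shift-prefix {suc m} {zero}  a b _         = parity-prefix m a b
shift-prefix {suc m} {suc i} a b (s≤s i<m) = begin
  parity (shift (a + 2 ^ suc m * b) (suc i))  ≡⟨ cong parity (shift-half _ i) ⟩
  parity (shift (half (a + 2 ^ suc m * b)) i) ≡⟨ cong (λ x → parity (shift x i)) (half-prefix m a b) ⟩
  parity (shift (half a + 2 ^ m * b) i)       ≡⟨ shift-prefix (half a) b i<m ⟩
  parity (shift (half a) i)                   ≡⟨ cong parity (shift-half a i) ⟨
  parity (shift a (suc i))                    ∎
  where open ≡-Reasoning

shift-+ : ∀ m {a} b j → a ℕ.< 2 ^ m → shift (a + 2 ^ m * b) (m + j) ≡ shift b j
shift-+ zero    {zero} b j _ = cong (λ x → shift x j) (ℕ.*-identityˡ b)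
shift-+ zero    {suc _} b j (s≤s ())
shift-+ (suc m) {a} b j a< = trans (shift-half _ (m + j))
  (trans (cong (λ x → shift x (m + j)) (half-prefix m a b))
         (shift-+ m b j (half-< {m} a<)))

shift-zero : ∀ {v} j → v ℕ.< 2 ^ j → shift v j ≡ 0
shift-zero {zero}  zero    _ = refl
shift-zero {suc _} zero    (s≤s ())
shift-zero {v}     (suc j) v< = trans (shift-half v j) (shift-zero j (half-< {j} v<))

bits-++ : ∀ m l {a} b → a ℕ.< 2 ^ m → bits (m + l) (a + 2 ^ m * b) ≡ bits m a ++ bits l b
bits-++ zero    l {zero}  b _ = cong (bits l) (ℕ.*-identityˡ b)
bits-++ zero    l {suc _} b (s≤s ())
bits-++ (suc m) l {a} b a< = cong₂ _∷_ (cong toBool (parity-prefix m a b))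
  (trans (cong (bits (m + l)) (half-prefix m a b)) (bits-++ m l b (half-< {m} a<)))

applyUpTo-cong : ∀ {f g : ℕ → Bool} n → (∀ i → i ℕ.< n → f i ≡ g i) → applyUpTo f n ≡ applyUpTo g n
applyUpTo-cong zero    f≗g = refl
applyUpTo-cong (suc n) f≗g = cong₂ _∷_ (f≗g 0 (s≤s z≤n))
    (applyUpTo-cong n λ i i<n → f≗g (suc i) (s≤s i<n))

applyUpTo-shift : ∀ l v → applyUpTo (λ i → toBool (parity (shift v i))) l ≡ bits l v
applyUpTo-shift zero    v = refl
applyUpTo-shift (suc l) v = cong (toBool (parity v) ∷_)
  (trans (applyUpTo-cong l λ i _ → cong (λ x → toBool (parity x)) (shift-half v i))
         (applyUpTo-shift l (half v)))

-- Finite sums, averaging and the pigeonhole principle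

∑-cong : ∀ {f g} n → (∀ i → i ℕ.< n → f i ≡ g i) → ∑ n f ≡ ∑ n g
∑-cong zero    f≗g = refl
∑-cong (suc n) f≗g = cong₂ _+_ (∑-cong n λ i i<n → f≗g i (ℕ.m<n⇒m<1+n i<n)) (f≗g n ℕ.≤-refl)

∑-≤ : ∀ {f c} n → (∀ i → i ℕ.< n → f i ℕ.≤ c) → ∑ n f ℕ.≤ n * c
∑-≤ {f} {c} zero    f≤c = z≤n
∑-≤ {f} {c} (suc n) f≤c = ℕ.≤-trans
  (ℕ.+-mono-≤ (∑-≤ n λ i i<n → f≤c i (ℕ.m<n⇒m<1+n i<n)) (f≤c n ℕ.≤-refl))
  (ℕ.≤-reflexive (ℕ.+-comm (n * c) c))

∑-+ : ∀ n f g → ∑ n (λ i → f i + g i) ≡ ∑ n f + ∑ n g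
∑-+ zero    f g = refl
∑-+ (suc n) f g rewrite ∑-+ n f g = swap (∑ n f) (∑ n g) (f n) (g n)
  where
  swap : ∀ a b c d → a + b + (c + d) ≡ a + c + (b + d)
  swap = solve-∀

∑-* : ∀ n c f → ∑ n (λ i → c * f i) ≡ c * ∑ n f
∑-* zero    c f = sym (ℕ.*-zeroʳ c)
∑-* (suc n) c f rewrite ∑-* n c f = sym (ℕ.*-distribˡ-+ c (∑ n f) (f n))

∑-zero : ∀ n → ∑ n (λ _ → 0) ≡ 0
∑-zero zero    = refl
∑-zero (suc n) = trans (ℕ.+-identityʳ _) (∑-zero n)

∑-swap : ∀ m n (f : ℕ → ℕ → ℕ) → ∑ m (λ i → ∑ n λ j → f i j) ≡ ∑ n (λ j → ∑ m λ i → f i j)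
∑-swap zero    n f = sym (∑-zero n)
∑-swap (suc m) n f rewrite ∑-swap m n f = sym (∑-+ n (λ j → ∑ m λ i → f i j) (f m))

∑≡0⇒≡0 : ∀ {f} n → ∑ n f ≡ 0 → ∀ {i} → i ℕ.< n → f i ≡ 0
∑≡0⇒≡0 {f} (suc n) ∑≡0 i<1+n with ℕ.m≤n⇒m<n∨m≡n (ℕ.≤-pred i<1+n)
... | inj₁ i<n  = ∑≡0⇒≡0 n (ℕ.m+n≡0⇒m≡0 (∑ n f) ∑≡0) i<n
... | inj₂ refl = ℕ.m+n≡0⇒n≡0 (∑ n f) ∑≡0

-- Strictness survives the summation because each summand may be raised by one. Applied twice with m
-- = k, this is the union bound over (k + 1)² tests.
∑-average : ∀ m {f P} → (∀ i → i ℕ.< suc m → suc m * f i ℕ.< P) → ∑ (suc m) f ℕ.< P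
∑-average m {f} {P} small = ℕ.*-cancelˡ-≤ (suc m) (begin
  suc m * suc (∑ (suc m) f)              ≡⟨ ℕ.*-suc (suc m) (∑ (suc m) f) ⟩
  suc m + suc m * ∑ (suc m) f
    ≡⟨ cong₂ _+_ (sym (ones (suc m))) (sym (∑-* (suc m) (suc m) f)) ⟩
  ∑ (suc m) (λ _ → 1) + ∑ (suc m) (λ i → suc m * f i) ≡⟨ ∑-+ (suc m) (λ _ → 1) (λ i → suc m * f i) ⟨
  ∑ (suc m) (λ i → suc (suc m * f i))    ≤⟨ ∑-≤ (suc m) small ⟩
  suc m * P                              ∎)
  where
  open ℕ.≤-Reasoning
  ones : ∀ n → ∑ n (λ _ → 1) ≡ n
  ones zero    = refl
  ones (suc n) = trans (cong (_+ 1) (ones n)) (ℕ.+-comm n 1)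

∑<⇒∃≡0 : ∀ n {f} → ∑ n f ℕ.< n → ∃[ i ] i ℕ.< n × f i ≡ 0
∑<⇒∃≡0 (suc n) {f} ∑< with f n in eq
... | zero  = n , ℕ.≤-refl , eq
... | suc k = let (i , i<n , fi≡0) = ∑<⇒∃≡0 n (ℕ.≤-<-trans (ℕ.m≤m+n (∑ n f) k)
                    (ℕ.≤-pred (subst (ℕ._< suc n) (ℕ.+-suc (∑ n f) k) ∑<)))
              in i , ℕ.m<n⇒m<1+n i<n , fi≡0

n≤triangle : ∀ n → n ℕ.≤ triangle n
n≤triangle zero    = z≤n
n≤triangle (suc n) = ℕ.m≤m+n (suc n) (triangle n)

extend-< : ∀ k {V v} → V ℕ.< 2 ^ triangle k → v ℕ.< 2 ^ suc k →
           V + 2 ^ triangle k * v ℕ.< 2 ^ triangle (suc k)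
extend-< k {V} {v} V< v< = begin-strict
  V + 2 ^ triangle k * v                <⟨ ℕ.+-monoˡ-< _ V< ⟩
  2 ^ triangle k + 2 ^ triangle k * v   ≡⟨ ℕ.*-suc (2 ^ triangle k) v ⟨
  2 ^ triangle k * suc v                ≤⟨ ℕ.*-monoʳ-≤ (2 ^ triangle k) v< ⟩
  2 ^ triangle k * 2 ^ suc k            ≡⟨ ℕ.^-distribˡ-+-* 2 (triangle k) (suc k) ⟨
  2 ^ (triangle k + suc k)              ≡⟨ cong (2 ^_) (ℕ.+-comm (triangle k) (suc k)) ⟩
  2 ^ triangle (suc k)                  ∎
  where open ℕ.≤-Reasoning

-- Block k starts at position triangle k.  The prefix before it is represented by
-- the number prefix k, whose i-th binary digit is the i-th bit; bad k V n j v is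
-- positive if the test (n, j) is met by the block v after the prefix V, and v
-- avoids the tests with sparse k V n j = 1.

module Construction (free : ℕ → ℕ) (bad : ℕ → ℕ → ℕ → ℕ → ℕ → ℕ) where

  -- The nested truncated subtractions make `sparse` the characteristic function of (k + 1)² ·
  -- `count` < 2^(`free k`).
  count sparse : ℕ → ℕ → ℕ → ℕ → ℕ
  count k V n j = ∑ (2 ^ free k) λ v → bad k V n j v
  sparse k V n j = 1 ∸ (suc (suc k * (suc k * count k V n j)) ∸ 2 ^ free k)

  penalty : ℕ → ℕ → ℕ → ℕ
  penalty k V v = ∑ (suc k) λ n → ∑ (suc k) λ j → sparse k V n j * bad k V n j v

  choice : ℕ → ℕ → ℕ
  choice k V = search (2 ^ free k) (penalty k V)

  prefix : ℕ → ℕ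
  prefix zero    = 0
  prefix (suc k) = prefix k + 2 ^ triangle k * choice k (prefix k)

  -- Reading bit i from `prefix (suc i)` avoids locating its block; that prefix is long enough since
  -- suc i ≤ `triangle (suc i)`.
  sequence : Cantor
  sequence i = toBool (parity (shift (prefix (suc i)) i))

  sparse-count : ∀ k V n j → suc k * (suc k * (sparse k V n j * count k V n j)) ℕ.< 2 ^ free k
  sparse-count k V n j with suc (suc k * (suc k * count k V n j)) ∸ 2 ^ free k in eq
  ... | zero rewrite ℕ.*-identityˡ (count k V n j) = ℕ.m∸n≡0⇒m≤n eq
  ... | suc d rewrite ℕ.0∸n≡0 d | ℕ.*-zeroʳ k | ℕ.*-zeroʳ k = ℕ.m^n>0 2 (free k)

  -- Exchanging the sums turns the total penalty into the sum of the counts of the sparse tests. A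
  -- total below the number of candidates leaves a candidate with penalty 0.
  ∑penalty : ∀ k V → ∑ (2 ^ free k) (penalty k V) ℕ.< 2 ^ free k
  ∑penalty k V = begin-strict
    ∑ P (λ v → ∑ m λ n → ∑ m λ j → sparse k V n j * bad k V n j v)
      ≡⟨ ∑-swap P m (λ v n → ∑ m λ j → sparse k V n j * bad k V n j v) ⟩
    ∑ m (λ n → ∑ P λ v → ∑ m λ j → sparse k V n j * bad k V n j v)
      ≡⟨ ∑-cong m (λ n _ → trans (∑-swap P m (λ v j → sparse k V n j * bad k V n j v))
           (∑-cong m λ j _ → ∑-* P (sparse k V n j) (bad k V n j))) ⟩
    ∑ m (λ n → ∑ m λ j → sparse k V n j * count k V n j)
      <⟨ ∑-average k (λ n _ → subst (ℕ._< P) (∑-* m m (λ j → sparse k V n j * count k V n j))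
           (∑-average k λ j _ → sparse-count k V n j)) ⟩
    P ∎
    where
    open ℕ.≤-Reasoning
    P m : ℕ
    P = 2 ^ free k
    m = suc k

  choice-< : ∀ k V → choice k V ℕ.< 2 ^ free k
  choice-< k V =
    let (v , v< , v≡0) = ∑<⇒∃≡0 (2 ^ free k) (∑penalty k V)
    in ℕ.≤-<-trans (ℕ.≮⇒≥ λ v<c → search-least (2 ^ free k) (penalty k V) v<c v≡0) v<

  choice-penalty : ∀ k V → penalty k V (choice k V) ≡ 0
  choice-penalty k V =
    let (v , v< , v≡0) = ∑<⇒∃≡0 (2 ^ free k) (∑penalty k V)
    in search-zero (2 ^ free k) (penalty k V) (ℕ.<⇒≤ v<) v≡0

  choice-avoids : ∀ k V n j → n ℕ.≤ k → j ℕ.≤ k → suc k * (suc k * count k V n j) ℕ.< 2 ^ free k →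
                  bad k V n j (choice k V) ≡ 0
  choice-avoids k V n j n≤k j≤k few = trans (sym (ℕ.*-identityˡ (bad k V n j (choice k V))))
    (subst (λ s → s * bad k V n j (choice k V) ≡ 0) sparse≡1
      (∑≡0⇒≡0 (suc k) (∑≡0⇒≡0 (suc k) (choice-penalty k V) (s≤s n≤k)) (s≤s j≤k)))
    where
    sparse≡1 : sparse k V n j ≡ 1
    sparse≡1 = cong (1 ∸_) (ℕ.m≤n⇒m∸n≡0 few)

  module _ (free≤ : ∀ k → free k ℕ.≤ suc k) where

    prefix-< : ∀ k → prefix k ℕ.< 2 ^ triangle k
    prefix-< zero    = s≤s z≤n
    prefix-< (suc k) = extend-< k (prefix-< k)
      (ℕ.<-≤-trans (choice-< k (prefix k)) (ℕ.^-monoʳ-≤ 2 (free≤ k)))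

    prefix-stable : ∀ {k l i} → k ℕ.≤ l → i ℕ.< triangle k →
                    parity (shift (prefix l) i) ≡ parity (shift (prefix k) i)
    prefix-stable k≤l i< = go (ℕ.≤⇒≤′ k≤l) i<
      where
      go : ∀ {k l i} → k ℕ.≤′ l → i ℕ.< triangle k →
           parity (shift (prefix l) i) ≡ parity (shift (prefix k) i)
      go ℕ.≤′-refl       i< = refl
      go (ℕ.≤′-step {l} k≤l) i< = trans
        (shift-prefix (prefix l) (choice l (prefix l))
          (ℕ.<-≤-trans i< (triangle-mono (ℕ.≤′⇒≤ k≤l)))) (go k≤l i<)

    sequence-shift : ∀ k {i} → i ℕ.< triangle k → sequence i ≡ toBool (parity (shift (prefix k) i))
    sequence-shift k {i} i< with ℕ.≤-total (suc i) k
    ... | inj₁ 1+i≤k = cong toBool (sym (prefix-stable 1+i≤k (n≤triangle (suc i))))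
    ... | inj₂ k≤1+i = cong toBool (prefix-stable k≤1+i i<)

    sequence-prefix : ∀ k → applyUpTo sequence (triangle k) ≡ bits (triangle k) (prefix k)
    sequence-prefix k = trans (applyUpTo-cong (triangle k) λ i i< → sequence-shift k i<)
                              (applyUpTo-shift (triangle k) (prefix k))

    -- Low digits come first, and `choice` is below 2^(`free k`), so its digits from position
    -- `free k` on vanish.
    sequence-zero : ∀ k {j} → j ℕ.≤ k → free k ℕ.≤ j → sequence (triangle k + j) ≡ false
    sequence-zero k {j} j≤k free≤j = begin
      sequence (triangle k + j)
        ≡⟨ sequence-shift (suc k) (subst (triangle k + j ℕ.<_) (ℕ.+-comm (triangle k) (suc k))
             (ℕ.+-monoʳ-< (triangle k) (s≤s j≤k))) ⟩
      toBool (parity (shift (prefix (suc k)) (triangle k + j)))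
        ≡⟨ cong (λ x → toBool (parity x)) (shift-+ (triangle k) c j (prefix-< k)) ⟩
      toBool (parity (shift c j))
        ≡⟨ cong (λ x → toBool (parity x)) (shift-zero j
             (ℕ.<-≤-trans (choice-< k (prefix k)) (ℕ.^-monoʳ-≤ 2 free≤j))) ⟩
      false ∎
      where
      open ≡-Reasoning
      c : ℕ
      c = choice k (prefix k)

  module _ {A : Pred ℕ 0ℓ}
    (freeᶜ : Computable A {1} λ xs → free (lookup xs 0F))
    (badᶜ : Computable A {5} λ xs →
      bad (lookup xs 0F) (lookup xs 1F) (lookup xs 2F) (lookup xs 3F) (lookup xs 4F))
    where

    private
      module _ {n} {k : Vec ℕ n → ℕ} (K : Computable A k) where
        2^freeᶜ : Computable A (λ xs → 2 ^ free (k xs))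
        2^freeᶜ = constᶜ 2 ^ᶜ freeᶜ ∘ᶜ (K ∷ᶜ []ᶜ)

      countᶜ : Computable A {4} λ xs → count (lookup xs 0F) (lookup xs 1F) (lookup xs 2F) (lookup xs 3F)
      countᶜ = ∑ᶜ (badᶜ ∘ᶜ (projᶜ 1F ∷ᶜ projᶜ 2F ∷ᶜ projᶜ 3F ∷ᶜ projᶜ 4F ∷ᶜ projᶜ 0F ∷ᶜ []ᶜ))
                  (2^freeᶜ (projᶜ 0F))

      sparseᶜ : Computable A {4} λ xs →
                sparse (lookup xs 0F) (lookup xs 1F) (lookup xs 2F) (lookup xs 3F)
      sparseᶜ = constᶜ 1 ∸ᶜ (sucᶜ (sucᶜ (projᶜ 0F) *ᶜ (sucᶜ (projᶜ 0F) *ᶜ countᶜ))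
                            ∸ᶜ 2^freeᶜ (projᶜ 0F))

      penaltyᶜ : Computable A {3} λ xs → penalty (lookup xs 0F) (lookup xs 1F) (lookup xs 2F)
      penaltyᶜ = ∑ᶜ (∑ᶜ
        (sparseᶜ ∘ᶜ (projᶜ 2F ∷ᶜ projᶜ 3F ∷ᶜ projᶜ 1F ∷ᶜ projᶜ 0F ∷ᶜ []ᶜ) *ᶜ
         badᶜ ∘ᶜ (projᶜ 2F ∷ᶜ projᶜ 3F ∷ᶜ projᶜ 1F ∷ᶜ projᶜ 0F ∷ᶜ projᶜ 4F ∷ᶜ []ᶜ))
        (sucᶜ (projᶜ 1F))) (sucᶜ (projᶜ 0F))

      choiceᶜ : Computable A {2} λ xs → choice (lookup xs 0F) (lookup xs 1F)
      choiceᶜ = searchᶜ (penaltyᶜ ∘ᶜ (projᶜ 1F ∷ᶜ projᶜ 2F ∷ᶜ projᶜ 0F ∷ᶜ []ᶜ)) (2^freeᶜ (projᶜ 0F))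

      prefixᶜ : ∀ {n} {k : Vec ℕ n → ℕ} → Computable A k → Computable A (λ xs → prefix (k xs))
      prefixᶜ = recᶜ (λ k _ → prefix k) (λ _ → refl) (λ _ _ → refl) (constᶜ 0)
        (projᶜ 1F +ᶜ constᶜ 2 ^ᶜ triangleᶜ (projᶜ 0F) *ᶜ
          choiceᶜ ∘ᶜ (projᶜ 0F ∷ᶜ projᶜ 1F ∷ᶜ []ᶜ))

    sequenceᶜ : Computable A {1} λ xs → encodeBool (sequence (lookup xs 0F))
    sequenceᶜ = extᶜ (λ xs → sym (encodeBool-parity (shift (prefix (suc (lookup xs 0F)))
        (lookup xs 0F))))
      (parityᶜ (shiftᶜ (prefixᶜ (sucᶜ (projᶜ 0F))) (projᶜ 0F)))

-- Rational arithmetic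

ℚ-ring : AlmostCommutativeRing 0ℓ 0ℓ
ℚ-ring = fromCommutativeRing ℚ.+-*-commutativeRing λ x → dec⇒maybe (0ℚ ℚ.≟ x)

ι : ℕ → ℚ
ι n = ℚ.mkℚ (ℤ.+ n) 0 (coprime-sym (1-coprimeTo n))

ι-/ : ∀ n → (ℤ.+ n) ℚ./ 1 ≡ ι n
ι-/ n = ℚ.↥p/↧p≡p (ι n)

ι-* : ∀ m n → ι (m * n) ≡ ι m ℚ.* ι n
ι-* m n = trans (sym (ι-/ (m * n))) (cong (ℚ._/ 1) (ℤ.pos-* m n))

ι-+ : ∀ m n → ι (m + n) ≡ ι m ℚ.+ ι n
ι-+ m n = trans (sym (ι-/ (m + n))) (cong (ℚ._/ 1)
  (trans (ℤ.pos-+ m n) (sym (cong₂ ℤ._+_ (ℤ.*-identityʳ (ℤ.+ m)) (ℤ.*-identityʳ (ℤ.+ n))))))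

ι-^ : ∀ m n → ι (m ^ n) ≡ ι m ^ℚ n
ι-^ m zero    = refl
ι-^ m (suc n) = trans (ι-* m (m ^ n)) (cong (ι m ℚ.*_) (ι-^ m n))

ι-mono-≤ : ∀ {m n} → m ℕ.≤ n → ι m ℚ.≤ ι n
ι-mono-≤ m≤n = ℚ.*≤* (subst₂ ℤ._≤_ (sym (ℤ.*-identityʳ _)) (sym (ℤ.*-identityʳ _)) (ℤ.+≤+ m≤n))

ι-mono-< : ∀ {m n} → m ℕ.< n → ι m ℚ.< ι n
ι-mono-< m<n = ℚ.*<* (subst₂ ℤ._<_ (sym (ℤ.*-identityʳ _)) (sym (ℤ.*-identityʳ _)) (ℤ.+<+ m<n))

ι-cancel-≤ : ∀ {m n} → ι m ℚ.≤ ι n → m ℕ.≤ n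
ι-cancel-≤ {m} {n} le = ℕ.≮⇒≥ λ n<m → <⇒≱ (ι-mono-< n<m) le

ι-cancel-< : ∀ {m n} → ι m ℚ.< ι n → m ℕ.< n
ι-cancel-< {m} {n} lt = ℕ.≰⇒> λ n≤m → <⇒≱ lt (ι-mono-≤ n≤m)

0≤ι : ∀ n → 0ℚ ℚ.≤ ι n
0≤ι n = ι-mono-≤ z≤n

0<ι : ∀ {n} → 0 ℕ.< n → 0ℚ ℚ.< ι n
0<ι = ι-mono-<

0<* : ∀ {a b} → 0ℚ ℚ.< a → 0ℚ ℚ.< b → 0ℚ ℚ.< a ℚ.* b
0<* {a} {b} 0<a 0<b = subst (ℚ._< a ℚ.* b) (ℚ.*-zeroʳ a)
  (ℚ.*-monoʳ-<-pos a {{ℚ.positive 0<a}} 0<b)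

0<^ : ∀ {a} n → 0ℚ ℚ.< a → 0ℚ ℚ.< a ^ℚ n
0<^ zero    0<a = ι-mono-< {0} {1} (s≤s z≤n)
0<^ (suc n) 0<a = 0<* 0<a (0<^ n 0<a)

-- Abstract, so that no quotient is ever normalised.

infixl 7 _/1+_

abstract
  _/1+_ : ℕ → ℕ → ℚ
  a /1+ b = ι a ℚ.* ℚ.1/ ι (suc b)

  /1+-* : ∀ a b → (a /1+ b) ℚ.* ι (suc b) ≡ ι a
  /1+-* a b = trans (ℚ.*-assoc (ι a) (ℚ.1/ ι (suc b)) (ι (suc b)))
    (trans (cong (ι a ℚ.*_) (ℚ.*-inverseˡ (ι (suc b)))) (ℚ.*-identityʳ (ι a)))

*-cancel-1/ : ∀ p q .{{_ : ℚ.NonZero p}} → p ℚ.* (q ℚ.* ℚ.1/ p) ≡ q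
*-cancel-1/ p q = trans (trans (sym (ℚ.*-assoc p q (ℚ.1/ p))) (cong (ℚ._* ℚ.1/ p) (ℚ.*-comm p q)))
  (trans (ℚ.*-assoc q p (ℚ.1/ p)) (trans (cong (q ℚ.*_) (ℚ.*-inverseʳ p)) (ℚ.*-identityʳ q)))

*-cancelʳ-≤ι : ∀ {p q} b → p ℚ.* ι (suc b) ℚ.≤ q ℚ.* ι (suc b) → p ℚ.≤ q
*-cancelʳ-≤ι b = ℚ.*-cancelʳ-≤-pos (ι (suc b))

*-cancelʳ-<ι : ∀ {p q} b → p ℚ.* ι (suc b) ℚ.< q ℚ.* ι (suc b) → p ℚ.< q
*-cancelʳ-<ι b = ℚ.*-cancelʳ-<-nonNeg (ι (suc b))

0≤/1+ : ∀ a b → 0ℚ ℚ.≤ a /1+ b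
0≤/1+ a b = *-cancelʳ-≤ι b (subst₂ ℚ._≤_ (sym (ℚ.*-zeroˡ (ι (suc b)))) (sym (/1+-* a b)) (0≤ι a))

swapʳ : ∀ p q r → p ℚ.* q ℚ.* r ≡ p ℚ.* r ℚ.* q
swapʳ = ring-solve-∀ ℚ-ring

/1+-mono : ∀ a b c d → a * suc d ℕ.≤ c * suc b → a /1+ b ℚ.≤ c /1+ d
/1+-mono a b c d le = *-cancelʳ-≤ι b (*-cancelʳ-≤ι d (subst₂ ℚ._≤_
  (trans (ι-* a (suc d)) (cong (ℚ._* ι (suc d)) (sym (/1+-* a b))))
  (trans (ι-* c (suc b)) (trans (cong (ℚ._* ι (suc b)) (sym (/1+-* c d)))
                                (swapʳ (c /1+ d) (ι (suc d)) (ι (suc b)))))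
  (ι-mono-≤ le)))

*-↧ : ∀ q → q ℚ.* ι (↧ₙ q) ≡ (↥ q) ℚ./ 1
*-↧ q@(ℚ.mkℚ i d-1 _) =
  ℚ.fromℚᵘ-cong {ℚᵘ.mkℚᵘ (i ℤ.* ↧ q) (d-1 * 1)} {ℚᵘ.mkℚᵘ i 0} (ℚᵘ.*≡* (begin
  i ℤ.* ↧ q ℤ.* ℤ.+ 1                  ≡⟨ ℤ.*-identityʳ _ ⟩
  i ℤ.* ↧ q                            ≡⟨ cong (λ d → i ℤ.* ℤ.+ d) (sym (ℕ.*-identityʳ (↧ₙ q))) ⟩
  i ℤ.* ℤ.+ (↧ₙ q * 1)                 ∎))
  where open ≡-Reasoning

nonNeg-↥ : ∀ {q} → 0ℚ ℚ.≤ q → ↥ q ≡ ℤ.+ ℤ.∣ ↥ q ∣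
nonNeg-↥ {ℚ.mkℚ (ℤ.+ n)  _ _} _ = refl
nonNeg-↥ {ℚ.mkℚ -[1+ n ] _ _} (ℚ.*≤* ())

nonNeg-*-↧ : ∀ {q} → 0ℚ ℚ.≤ q → q ℚ.* ι (↧ₙ q) ≡ ι ℤ.∣ ↥ q ∣
nonNeg-*-↧ {q} 0≤q = trans (*-↧ q) (trans (cong (ℚ._/ 1) (nonNeg-↥ 0≤q)) (ι-/ _))

nonNeg-quotient : ∀ {q} → 0ℚ ℚ.≤ q → ∃[ a ] ∃[ b ] q ≡ a /1+ b
nonNeg-quotient {q} 0≤q = ℤ.∣ ↥ q ∣ , ℚ.denominator-1 q , ℚ.≤-antisym
  (*-cancelʳ-≤ι (ℚ.denominator-1 q) (ℚ.≤-reflexive eq))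
  (*-cancelʳ-≤ι (ℚ.denominator-1 q) (ℚ.≤-reflexive (sym eq)))
  where
  eq : q ℚ.* ι (↧ₙ q) ≡ (ℤ.∣ ↥ q ∣ /1+ ℚ.denominator-1 q) ℚ.* ι (↧ₙ q)
  eq = trans (nonNeg-*-↧ 0≤q) (sym (/1+-* _ _))

archimedean : ∀ q → ∃[ n ] q ℚ.≤ ι n
archimedean q@(ℚ.mkℚ (ℤ.+ n) d-1 _) = n , *-cancelʳ-≤ι d-1 (subst₂ ℚ._≤_
  (sym (trans (*-↧ q) (ι-/ n))) (ι-* n (suc d-1)) (ι-mono-≤ (ℕ.m≤m*n n (suc d-1))))
archimedean (ℚ.mkℚ -[1+ n ] d-1 _) = 0 , ℚ.*≤* ℤ.-≤+

parity-2* : ∀ n → parity (2 * n) ≡ 0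
parity-2* = parity-+2* 0

half-2* : ∀ n → half (2 * n) ≡ n
half-2* = half-+2* 0

numerator⁺-+ : ∀ q n → ↥ q ≡ ℤ.+ n → numerator⁺ (encodeℚ q) ≡ n
numerator⁺-+ q n eq rewrite π₁-pair (encodeℤ (↥ q)) (↧ₙ q) | eq | parity-2* n = half-2* n

numerator⁺-neg : ∀ q n → ↥ q ≡ -[1+ n ] → numerator⁺ (encodeℚ q) ≡ 0
numerator⁺-neg q n eq rewrite π₁-pair (encodeℤ (↥ q)) (↧ₙ q) | eq | parity-2* n = refl

*-monoʳ-≤ι : ∀ {p q} n → p ℚ.≤ q → p ℚ.* ι n ℚ.≤ q ℚ.* ι n
*-monoʳ-≤ι n = ℚ.*-monoʳ-≤-nonNeg (ι n) {{ℚ.nonNegative (0≤ι n)}}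

*-monoʳ-<ι : ∀ {p q} {n} → 0 ℕ.< n → p ℚ.< q → p ℚ.* ι n ℚ.< q ℚ.* ι n
*-monoʳ-<ι {n = n} 0<n = ℚ.*-monoˡ-<-pos (ι n) {{ℚ.positive (0<ι 0<n)}}

module _ (q : ℚ) (a b : ℕ) where

  private
    d : ℕ
    d = ↧ₙ q
    scaled : ∀ n → ↥ q ≡ ℤ.+ n → q ℚ.* ι b ℚ.* ι d ≡ ι (n * b)
    scaled n eq = trans (swapʳ q (ι b) (ι d))
      (trans (cong (ℚ._* ι b) (trans (*-↧ q) (trans (cong (ℚ._/ 1) eq) (ι-/ n)))) (sym (ι-* n b)))

    exceeds-≡ : ∀ {n} → numerator⁺ (encodeℚ q) ≡ n → exceeds (encodeℚ q) a b ≡ n * b ∸ a * d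
    exceeds-≡ num≡n = cong₂ (λ m e → m * b ∸ a * e) num≡n (π₂-pair (encodeℤ (↥ q)) d)

    forward : ∀ i → ↥ q ≡ i → exceeds (encodeℚ q) a b ≢ 0 → ι a ℚ.< q ℚ.* ι b
    forward -[1+ n ] eq exc =
      contradiction (trans (exceeds-≡ (numerator⁺-neg q n eq)) (ℕ.0∸n≡0 (a * d))) exc
    forward (ℤ.+ n) eq exc = *-cancelʳ-<ι (ℚ.denominator-1 q)
        (subst₂ ℚ._<_ (ι-* a d) (sym (scaled n eq))
      (ι-mono-< (ℕ.≰⇒> λ nb≤ad → exc (trans (exceeds-≡ (numerator⁺-+ q n eq)) (ℕ.m≤n⇒m∸n≡0 nb≤ad)))))

    backward : ∀ i → ↥ q ≡ i → ι a ℚ.< q ℚ.* ι b → exceeds (encodeℚ q) a b ≢ 0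
    backward -[1+ n ] eq a<qb exc = <⇒≱ a<qb (ℚ.≤-trans (*-monoʳ-≤ι b q≤0)
      (ℚ.≤-trans (ℚ.≤-reflexive (ℚ.*-zeroˡ (ι b))) (0≤ι a)))
      where
      q≤0 : q ℚ.≤ 0ℚ
      q≤0 = ℚ.*≤* (subst (λ i → i ℤ.* ℤ.+ 1 ℤ.≤ ℤ.+ 0 ℤ.* ↧ q) (sym eq) ℤ.-≤+)
    backward (ℤ.+ n) eq a<qb exc =
      ℕ.<⇒≱ (ι-cancel-< (subst₂ ℚ._<_ (sym (ι-* a d)) (scaled n eq) (*-monoʳ-<ι (s≤s z≤n) a<qb)))
        (ℕ.m∸n≡0⇒m≤n (trans (sym (exceeds-≡ (numerator⁺-+ q n eq))) exc))

  exceeds⁻ : exceeds (encodeℚ q) a b ≢ 0 → ι a ℚ.< q ℚ.* ι b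
  exceeds⁻ = forward (↥ q) refl

  exceeds⁺ : ι a ℚ.< q ℚ.* ι b → exceeds (encodeℚ q) a b ≢ 0
  exceeds⁺ = backward (↥ q) refl

-- Real numbers

p+q-q : ∀ p q → p ℚ.+ q ℚ.- q ≡ p
p+q-q = ring-solve-∀ ℚ-ring

p-q+q : ∀ p q → p ℚ.- q ℚ.+ q ≡ p
p-q+q = ring-solve-∀ ℚ-ring

q+[p-q] : ∀ p q → q ℚ.+ (p ℚ.- q) ≡ p
q+[p-q] = ring-solve-∀ ℚ-ring

neg-involutive : ∀ p → ℚ.- (ℚ.- p) ≡ p
neg-involutive = ring-solve-∀ ℚ-ring

<-+⇒-< : ∀ {p q r} → p ℚ.< q ℚ.+ r → p ℚ.- r ℚ.< q
<-+⇒-< {p} {q} {r} lt = subst (p ℚ.- r ℚ.<_) (p+q-q q r) (ℚ.+-monoˡ-< (ℚ.- r) lt)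

+-<⇒<- : ∀ {p q r} → p ℚ.+ q ℚ.< r → p ℚ.< r ℚ.- q
+-<⇒<- {p} {q} {r} lt = subst (ℚ._< r ℚ.- q) (p+q-q p q) (ℚ.+-monoˡ-< (ℚ.- q) lt)

-<⇒<-+ : ∀ {p q r} → p ℚ.- q ℚ.< r → p ℚ.< r ℚ.+ q
-<⇒<-+ {p} {q} {r} lt = subst (ℚ._< r ℚ.+ q) (p-q+q p q) (ℚ.+-monoˡ-< q lt)

<-⇒+-< : ∀ {p q r} → p ℚ.< r ℚ.- q → p ℚ.+ q ℚ.< r
<-⇒+-< {p} {q} {r} lt = subst (p ℚ.+ q ℚ.<_) (p-q+q r q) (ℚ.+-monoˡ-< q lt)

module _ (u : ℚ) (x : ℝ) where

  private
    u-x : ℝ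
    u-x = fromℚ u Defs.- x

  difference⁺ : ∀ {b y} → b ∉ cut x → y ℚ.< u ℚ.- b → y ∈ cut u-x
  difference⁺ {b} {y} b∉x y<u-b =
    let (a , y+b<a , a<u) = ℚ.<-dense (<-⇒+-< {y} {b} y<u-b)
    in a , y ℚ.- a , a<u , (b , b∉x , <-+⇒-< {y} {ℚ.- b} {a} (subst (y ℚ.<_) (ℚ.+-comm a (ℚ.- b))
        (+-<⇒<- {y} {b} y+b<a))) , sym (q+[p-q] y a)

  difference⁻ : ∀ {y} → y ∈ cut u-x → ∃[ b ] b ∉ cut x × y ℚ.< u ℚ.- b
  difference⁻ (a , c , a<u , (b , b∉x , c<-b) , refl) = b , b∉x , ℚ.+-mono-< a<u c<-b

  -- Lying outside the cut of the distance is the usable form of |u - x| ≤ q; this and the next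
  -- lemma extract its two halves.
  distance-upper : ∀ {q c} → q ∉ cut Defs.∣ u-x ∣ → c ∉ cut x → u ℚ.≤ c ℚ.+ q
  distance-upper {q} {c} q∉ c∉x = ℚ.≮⇒≥ λ c+q<u →
    q∉ (inj₁ (difference⁺ c∉x (+-<⇒<- {q} {c} (subst (ℚ._< u) (ℚ.+-comm c q) c+q<u))))

  distance-lower : ∀ {q c} → q ∉ cut Defs.∣ u-x ∣ → c ∈ cut x → c ℚ.≤ u ℚ.+ q
  distance-lower {q} {c} q∉ c∈x = ℚ.≮⇒≥ λ u+q<c → q∉ (inj₂
    (u ℚ.- c , (λ u-c∈ → let (b , b∉x , lt) = difference⁻ u-c∈ in
                  ℚ.<-asym lt (ℚ.+-monoʳ-< u (ℚ.neg-antimono-< (below x c∈x b∉x))))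
             , q<c-u u+q<c))
    where
    q<c-u : u ℚ.+ q ℚ.< c → q ℚ.< ℚ.- (u ℚ.- c)
    q<c-u lt = subst (q ℚ.<_) (negate u c) (+-<⇒<- {q} {u} (subst (ℚ._< c) (ℚ.+-comm u q) lt))
      where
      negate : ∀ u c → c ℚ.- u ≡ ℚ.- (u ℚ.- c)
      negate = ring-solve-∀ ℚ-ring

distance-fromℚ : ∀ {u x} → u ℚ.≤ x → x ℚ.- u ∉ cut Defs.∣ fromℚ u Defs.- fromℚ x ∣
distance-fromℚ {u} {x} u≤x (inj₁ ∈u-x) =
  let (b , b≮x , lt) = difference⁻ u (fromℚ x) ∈u-x
  in b≮x (ℚ.<-≤-trans (b<u b lt) u≤x)
  where
  b<u : ∀ b → x ℚ.- u ℚ.< u ℚ.- b → b ℚ.< u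
  b<u b lt = ℚ.≰⇒> λ u≤b → ℚ.<-irrefl refl (ℚ.<-≤-trans lt (ℚ.≤-trans
    (ℚ.+-monoʳ-≤ u (ℚ.neg-antimono-≤ u≤b)) (ℚ.+-monoˡ-≤ (ℚ.- u) u≤x)))
distance-fromℚ {u} {x} u≤x (inj₂ (b , b∉ , lt)) =
  b∉ (difference⁺ u (fromℚ x) {x} (ℚ.<-irrefl refl)
    (subst₂ ℚ._<_ (neg-involutive b) (negate x u) (ℚ.neg-antimono-< lt)))
  where
  negate : ∀ x u → ℚ.- (x ℚ.- u) ≡ u ℚ.- x
  negate = ring-solve-∀ ℚ-ring

∈-resp-≤ : ∀ (x : ℝ) {p q} → p ℚ.≤ q → q ∈ cut x → p ∈ cut x
∈-resp-≤ x {p} {q} p≤q q∈x with ℚ.<-cmp p q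
... | tri< p<q _ _  = downward x p<q q∈x
... | tri≈ _ refl _ = q∈x
... | tri> _ _ q<p  = contradiction p≤q (<⇒≱ q<p)

module _ {f : ℝ} {f̂ : ℕ → ℚ} (rising : ∀ t → f̂ t ℚ.≤ f̂ (suc t) × fromℚ (f̂ (suc t)) < f)
    (f̂⟶f : f̂ ⟶ f) where

  approximation-∈ : ∀ t → f̂ t ∈ cut f
  approximation-∈ t =
    let (f̂t≤ , q , q≮ , q∈f) = rising t
    in ∈-resp-≤ f (ℚ.≤-trans f̂t≤ (ℚ.≮⇒≥ q≮)) q∈f

  <approximation⇒∈ : ∀ {θ t} → θ ℚ.< f̂ t → θ ∈ cut f
  <approximation⇒∈ {t = t} θ< = downward f θ< (approximation-∈ t)

  ∈⇒<approximation : ∀ {θ} → θ ∈ cut f → ∃[ t ] θ ℚ.< f̂ t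
  ∈⇒<approximation {θ} θ∈f =
    let (θ′ , θ<θ′ , θ′∈f) = noMaximum f θ∈f
        (N , close) = f̂⟶f (θ′ ℚ.- θ) (+-<⇒<- {0ℚ} {θ} (subst (ℚ._< θ′) (sym (ℚ.+-identityˡ θ)) θ<θ′))
        (q , q∉ , q<) = close N ℕ.≤-refl
    in N , ℚ.≰⇒> λ f̂≤θ → ℚ.<-irrefl refl (ℚ.≤-<-trans (distance-lower (f̂ N) f q∉ θ′∈f)
         (subst (f̂ N ℚ.+ q ℚ.<_) (q+[p-q] θ′ θ) (ℚ.+-mono-≤-< f̂≤θ q<)))

-- Comparing quotients of naturals with real powers of two

*-^ : ∀ p q n → (p ℚ.* q) ^ℚ n ≡ p ^ℚ n ℚ.* q ^ℚ n
*-^ p q zero    = refl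
*-^ p q (suc n) = trans (cong (p ℚ.* q ℚ.*_) (*-^ p q n)) (interchange p q (p ^ℚ n) (q ^ℚ n))
  where
  interchange : ∀ p q r s → p ℚ.* q ℚ.* (r ℚ.* s) ≡ p ℚ.* r ℚ.* (q ℚ.* s)
  interchange = ring-solve-∀ ℚ-ring

1^ : ∀ n → 1ℚ ^ℚ n ≡ 1ℚ
1^ zero    = refl
1^ (suc n) = trans (ℚ.*-identityˡ (1ℚ ^ℚ n)) (1^ n)

½^*2^ : ∀ n → ½ ^ℚ n ℚ.* ι (2 ^ n) ≡ 1ℚ
½^*2^ n = trans (cong (½ ^ℚ n ℚ.*_) (ι-^ 2 n)) (trans (sym (*-^ ½ (ι 2) n)) (1^ n))

quotient-^ : ∀ {p a b} n → p ℚ.* ι b ≡ ι a → p ^ℚ n ℚ.* ι (b ^ n) ≡ ι (a ^ n)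
quotient-^ {p} {a} {b} n eq = trans (cong (p ^ℚ n ℚ.*_) (ι-^ b n))
  (trans (sym (*-^ p (ι b) n)) (trans (cong (_^ℚ n) eq) (sym (ι-^ a n))))

2^ℤ-neg : ∀ m → 2^ℤ (ℤ.- (ℤ.+ m)) ≡ ½ ^ℚ m
2^ℤ-neg zero    = refl
2^ℤ-neg (suc m) = refl

module _ {e : ℚ} (0≤e : 0ℚ ℚ.≤ e) where

  2^ℤ-↥-neg : 2^ℤ (↥ (ℚ.- e)) ≡ ½ ^ℚ ℤ.∣ ↥ e ∣
  2^ℤ-↥-neg = trans (cong 2^ℤ_ (trans (ℚ.↥-neg e) (cong ℤ.-_ (nonNeg-↥ 0≤e)))) (2^ℤ-neg ℤ.∣ ↥ e ∣)

↧ₙ-neg : ∀ e → ↧ₙ (ℚ.- e) ≡ ↧ₙ e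
↧ₙ-neg e = ℤ.+-injective (ℚ.↧-neg e)

^-cancelˡ-≤ : ∀ b {x y} → x ^ suc b ℕ.≤ y ^ suc b → x ℕ.≤ y
^-cancelˡ-≤ b le = ℕ.≮⇒≥ λ y<x → ℕ.<⇒≱ (ℕ.^-monoˡ-< (suc b) y<x) le

^-swap : ∀ x m n → (x ^ m) ^ n ≡ (x ^ n) ^ m
^-swap x m n = trans (ℕ.^-*-assoc x m n) (trans (cong (x ^_) (ℕ.*-comm m n)) (sym (ℕ.^-*-assoc x n m)))

^-distrib-* : ∀ x y n → (x * y) ^ n ≡ x ^ n * y ^ n
^-distrib-* x y zero    = refl
^-distrib-* x y (suc n) = trans (cong (x * y *_) (^-distrib-* x y n)) (interchange x y (x ^ n) (y ^ n))
  where
  interchange : ∀ a b c d → a * b * (c * d) ≡ a * c * (b * d)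
  interchange = solve-∀

module _ (s : ℝ) {q : ℚ} {a b N M : ℕ} (q∉s : q ∉ cut s) (q<a/b : q ℚ.< a /1+ b)
         (N/M≤ : N ^ suc b * 2 ^ a ℕ.≤ suc M ^ suc b) where

  private
    e : ℚ
    e = a /1+ b
    m n : ℕ
    m = ℤ.∣ ↥ e ∣
    n = ↧ₙ e
    ν : ℚ
    ν = N /1+ M

    mb≡an : m * suc b ≡ a * n
    mb≡an = ℕ.≤-antisym (ι-cancel-≤ (ℚ.≤-reflexive eq)) (ι-cancel-≤ (ℚ.≤-reflexive (sym eq)))
      where
      eq : ι (m * suc b) ≡ ι (a * n)
      eq = trans (ι-* m (suc b)) (trans (cong (ℚ._* ι (suc b)) (sym (nonNeg-*-↧ (0≤/1+ a b))))
        (trans (swapʳ e (ι n) (ι (suc b))) (trans (cong (ℚ._* ι n) (/1+-* a b)) (sym (ι-* a n)))))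

    N^n*2^m≤M^n : N ^ n * 2 ^ m ℕ.≤ suc M ^ n
    N^n*2^m≤M^n = ^-cancelˡ-≤ b (begin
      (N ^ n * 2 ^ m) ^ suc b         ≡⟨ ^-distrib-* (N ^ n) (2 ^ m) (suc b) ⟩
      (N ^ n) ^ suc b * (2 ^ m) ^ suc b
        ≡⟨ cong₂ _*_ (^-swap N n (suc b)) (trans (ℕ.^-*-assoc 2 m (suc b))
                                             (trans (cong (2 ^_) mb≡an) (sym (ℕ.^-*-assoc 2 a n)))) ⟩
      (N ^ suc b) ^ n * (2 ^ a) ^ n   ≡⟨ ^-distrib-* (N ^ suc b) (2 ^ a) n ⟨
      (N ^ suc b * 2 ^ a) ^ n         ≤⟨ ℕ.^-monoˡ-≤ n N/M≤ ⟩
      (suc M ^ suc b) ^ n             ≡⟨ ^-swap (suc M) (suc b) n ⟩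
      (suc M ^ n) ^ suc b             ∎)
      where open ℕ.≤-Reasoning

    ν^n≤½^m : ν ^ℚ n ℚ.≤ ½ ^ℚ m
    ν^n≤½^m = ℚ.*-cancelʳ-≤-pos (ι (suc M ^ n)) {{ℚ.positive (0<ι (ℕ.m^n>0 (suc M) n))}}
      (ℚ.*-cancelʳ-≤-pos (ι (2 ^ m)) {{ℚ.positive (0<ι (ℕ.m^n>0 2 m))}} (begin
        ν ^ℚ n ℚ.* ι (suc M ^ n) ℚ.* ι (2 ^ m)
          ≡⟨ cong (ℚ._* ι (2 ^ m)) (quotient-^ {ν} {N} {suc M} n (/1+-* N M)) ⟩
        ι (N ^ n) ℚ.* ι (2 ^ m)                ≡⟨ ι-* (N ^ n) (2 ^ m) ⟨
        ι (N ^ n * 2 ^ m)                      ≤⟨ ι-mono-≤ N^n*2^m≤M^n ⟩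
        ι (suc M ^ n)                          ≡⟨ ℚ.*-identityˡ (ι (suc M ^ n)) ⟨
        1ℚ ℚ.* ι (suc M ^ n)                   ≡⟨ cong (ℚ._* ι (suc M ^ n)) (½^*2^ m) ⟨
        ½ ^ℚ m ℚ.* ι (2 ^ m) ℚ.* ι (suc M ^ n) ≡⟨ swapʳ (½ ^ℚ m) (ι (2 ^ m)) (ι (suc M ^ n)) ⟩
        ½ ^ℚ m ℚ.* ι (suc M ^ n) ℚ.* ι (2 ^ m) ∎))
      where open ℚ.≤-Reasoning

  -- `2^_` takes its exponents in lowest terms, so the hypothesis on a/(1+b) is transferred to m/n:
  -- as m (1+b) = a n, it is raised to the n-th power and the (1+b)-th root is taken. The exponent
  -- -a/(1+b) is admissible because q lies strictly between it and s in absolute value, or equals s.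
  quotient≤2^- : fromℚ ν ≤ proj₁ (2^ (Defs.- s))
  quotient≤2^- x<ν = ν , ℚ.- e , x<ν , 0≤/1+ N M , (q , q∉s , ℚ.neg-antimono-< q<a/b) ,
    subst₂ (λ k r → ν ^ℚ k ℚ.≤ r) (sym (↧ₙ-neg e)) (sym (2^ℤ-↥-neg (0≤/1+ a b))) ν^n≤½^m

module _ {s : ℚ} {a b N M : ℕ} (a/b≤s : a /1+ b ℚ.≤ s)
    (M/N≤ : M ^ suc b ℕ.≤ 2 ^ a * suc N ^ suc b) where

  2^-≤quotient : ∀ {y} → y ∈ cut (proj₁ (2^ (Defs.- fromℚ s))) → y ℚ.* ι M ℚ.≤ ι (suc N)
  2^-≤quotient {y} (r , p , y<r , 0≤r , (q , q≮s , p<-q) , r^n≤2^p) =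
    ℚ.≤-trans (*-monoʳ-≤ι M (ℚ.<⇒≤ y<r))
        -- `suc (b + d * suc b)` is `n * suc b`: powers with this exponent clear the denominators of
        -- both e and a/(1+b).
        (^-cancel-≤ {r ℚ.* ι M} (b + d * suc b) (ι-mono-≤ (s≤s z≤n)) bound)
    where
    e : ℚ
    e = ℚ.- p
    s<e : s ℚ.< e
    s<e = ℚ.≤-<-trans (ℚ.≮⇒≥ q≮s) (subst (ℚ._< e) (neg-involutive q) (ℚ.neg-antimono-< p<-q))
    a/b<e : a /1+ b ℚ.< e
    a/b<e = ℚ.≤-<-trans a/b≤s s<e
    0≤e : 0ℚ ℚ.≤ e
    0≤e = ℚ.≤-trans (0≤/1+ a b) (ℚ.<⇒≤ a/b<e)
    m n d : ℕ
    m = ℤ.∣ ↥ e ∣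
    n = ↧ₙ e
    d = ℚ.denominator-1 e
    an≤mb : a * n ℕ.≤ m * suc b
    an≤mb = ι-cancel-≤ (begin
      ι (a * n)                       ≡⟨ ι-* a n ⟩
      ι a ℚ.* ι n                     ≡⟨ cong (ℚ._* ι n) (/1+-* a b) ⟨
      (a /1+ b) ℚ.* ι (suc b) ℚ.* ι n ≤⟨ *-monoʳ-≤ι n (*-monoʳ-≤ι (suc b) (ℚ.<⇒≤ a/b<e)) ⟩
      e ℚ.* ι (suc b) ℚ.* ι n         ≡⟨ swapʳ e (ι (suc b)) (ι n) ⟩
      e ℚ.* ι n ℚ.* ι (suc b)         ≡⟨ cong (ℚ._* ι (suc b)) (nonNeg-*-↧ 0≤e) ⟩
      ι m ℚ.* ι (suc b)               ≡⟨ ι-* m (suc b) ⟨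
      ι (m * suc b)                   ∎)
      where open ℚ.≤-Reasoning
    r^n≤½^m : r ^ℚ n ℚ.≤ ½ ^ℚ m
    r^n≤½^m = subst₂ (λ k z → r ^ℚ k ℚ.≤ z) (↧ₙ-e)
        (trans (cong (λ z → 2^ℤ (↥ z)) (sym (neg-involutive p))) (2^ℤ-↥-neg 0≤e)) r^n≤2^p
      where
      ↧ₙ-e : ↧ₙ p ≡ n
      ↧ₙ-e = sym (↧ₙ-neg p)
    bound : (r ℚ.* ι M) ^ℚ (n * suc b) ℚ.≤ ι (suc N) ^ℚ (n * suc b)
    bound = begin
      (r ℚ.* ι M) ^ℚ (n * suc b)               ≡⟨ cong ((r ℚ.* ι M) ^ℚ_) (ℕ.*-comm n (suc b)) ⟩
      (r ℚ.* ι M) ^ℚ (suc b * n)               ≡⟨ *-^ r (ι M) (suc b * n) ⟩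
      r ^ℚ (suc b * n) ℚ.* ι M ^ℚ (suc b * n)
        ≤⟨ *-mono-nonNeg (0≤^ (suc b * n) 0≤r) (0≤^ (suc b * n) (0≤ι M)) r-part ℚ.≤-refl ⟩
      ½ ^ℚ (suc b * m) ℚ.* ι M ^ℚ (suc b * n)  ≡⟨ cong (½ ^ℚ (suc b * m) ℚ.*_) (ι-^ M (suc b * n)) ⟨
      ½ ^ℚ (suc b * m) ℚ.* ι (M ^ (suc b * n))
        ≤⟨ *-mono-nonNeg (0≤^ (suc b * m) 0≤½) (0≤ι _) ℚ.≤-refl (ι-mono-≤ M-part) ⟩
      ½ ^ℚ (suc b * m) ℚ.* ι (2 ^ (suc b * m) * suc N ^ (n * suc b))
        ≡⟨ cong (½ ^ℚ (suc b * m) ℚ.*_) (ι-* (2 ^ (suc b * m)) _) ⟩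
      ½ ^ℚ (suc b * m) ℚ.* (ι (2 ^ (suc b * m)) ℚ.* ι (suc N ^ (n * suc b)))
        ≡⟨ ℚ.*-assoc (½ ^ℚ (suc b * m)) (ι (2 ^ (suc b * m))) (ι (suc N ^ (n * suc b))) ⟨
      ½ ^ℚ (suc b * m) ℚ.* ι (2 ^ (suc b * m)) ℚ.* ι (suc N ^ (n * suc b))
        ≡⟨ cong (ℚ._* ι (suc N ^ (n * suc b))) (½^*2^ (suc b * m)) ⟩
      1ℚ ℚ.* ι (suc N ^ (n * suc b))           ≡⟨ ℚ.*-identityˡ _ ⟩
      ι (suc N ^ (n * suc b))                  ≡⟨ ι-^ (suc N) (n * suc b) ⟩
      ι (suc N) ^ℚ (n * suc b)                 ∎
      where
      open ℚ.≤-Reasoning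
      r-part : r ^ℚ (suc b * n) ℚ.≤ ½ ^ℚ (suc b * m)
      r-part = subst₂ ℚ._≤_ (sym (^-assoc r n (suc b))) (sym (^-assoc ½ m (suc b)))
        (^-mono (suc b) (0≤^ n 0≤r) r^n≤½^m)
      M-part : M ^ (suc b * n) ℕ.≤ 2 ^ (suc b * m) * suc N ^ (n * suc b)
      M-part = ℕ.≤-trans (ℕ.≤-reflexive (sym (ℕ.^-*-assoc M (suc b) n))) (ℕ.≤-trans (ℕ.^-monoˡ-≤ n M/N≤)
        (ℕ.≤-trans (ℕ.≤-reflexive (^-distrib-* (2 ^ a) (suc N ^ suc b) n))
          (ℕ.*-mono-≤ (ℕ.≤-trans (ℕ.≤-reflexive (ℕ.^-*-assoc 2 a n))
                        (ℕ.^-monoʳ-≤ 2 (ℕ.≤-trans an≤mb (ℕ.≤-reflexive (ℕ.*-comm m (suc b))))))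
                      (ℕ.≤-reflexive (trans (ℕ.^-*-assoc (suc N) (suc b) n)
                          (cong (suc N ^_) (ℕ.*-comm (suc b) n)))))))

-- Supergales

-- A product of reals asks for nonnegative factors strictly inside both cuts. Two applications move
-- first a + b and then ν down to such factors.
shrink : ∀ {x u v} → 0ℚ ℚ.≤ x → 0ℚ ℚ.< u → x ℚ.< u ℚ.* v → ∃[ w ] 0ℚ ℚ.≤ w × w ℚ.< v × x ℚ.< u ℚ.* w
shrink {x} {u} {v} 0≤x 0<u x<uv =
  let (w , z<w , w<v) = ℚ.<-dense z<v
  in w , ℚ.≤-trans 0≤z (ℚ.<⇒≤ z<w) , w<v ,
     subst (ℚ._< u ℚ.* w) (trans (ℚ.*-comm u z) zu≡x) (ℚ.*-monoʳ-<-pos u z<w)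
  where
  instance
    u-positive : ℚ.Positive u
    u-positive = ℚ.positive 0<u
    u-nonZero : ℚ.NonZero u
    u-nonZero = ℚ.>-nonZero 0<u
  z : ℚ
  z = x ℚ.* ℚ.1/ u
  zu≡x : z ℚ.* u ≡ x
  zu≡x = trans (ℚ.*-assoc x (ℚ.1/ u) u) (trans (cong (x ℚ.*_) (ℚ.*-inverseˡ u)) (ℚ.*-identityʳ x))
  z<v : z ℚ.< v
  z<v = ℚ.*-cancelʳ-<-nonNeg u {{ℚ.nonNegative (ℚ.<⇒≤ 0<u)}}
      (subst₂ ℚ._<_ (sym zu≡x) (ℚ.*-comm u v) x<uv)
  0≤z : 0ℚ ℚ.≤ z
  0≤z = ℚ.*-cancelʳ-≤-pos u (subst₂ ℚ._≤_ (sym (ℚ.*-zeroˡ u)) (sym zu≡x) 0≤x)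

positive-factor : ∀ {x u v} → 0ℚ ℚ.≤ x → 0ℚ ℚ.≤ u → x ℚ.< u ℚ.* v → 0ℚ ℚ.< v
positive-factor {x} {u} {v} 0≤x 0≤u x<uv = ℚ.≰⇒> λ v≤0 → <⇒≱ x<uv (ℚ.≤-trans
  (subst (u ℚ.* v ℚ.≤_) (ℚ.*-zeroʳ u) (ℚ.*-monoˡ-≤-nonNeg u {{ℚ.nonNegative 0≤u}} v≤0)) 0≤x)

module _ {s : ℝ} {d : Str → ℝ≥0} (supergale : IsSupergale s d)
         {ν : ℚ} (0<ν : 0ℚ ℚ.< ν) (ν≤2^-s : fromℚ ν ≤ proj₁ (2^ (Defs.- s))) where

  -- The supergale inequality for rational lower bounds; the real 2^(-s) enters only through its
  -- rational lower bound ν.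
  supergale-step : ∀ w {a b} → fromℚ a ≤ proj₁ (d (w ∷ʳ false)) → fromℚ b ≤ proj₁ (d (w ∷ʳ true)) →
                   fromℚ (ν ℚ.* (a ℚ.+ b)) ≤ proj₁ (d w)
  supergale-step w {a} {b} a≤ b≤ {x} x< with x ℚ.<? 0ℚ
  ... | yes x<0 = proj₂ (d w) x<0
  ... | no  x≮0 =
    let 0≤x = ℚ.≮⇒≥ x≮0
        (y , 0≤y , y<a+b , x<νy) = shrink 0≤x 0<ν x<
        (ν′ , 0≤ν′ , ν′<ν , x<yν′) = shrink {u = y} 0≤x (positive-factor 0≤x (ℚ.<⇒≤ 0<ν) x<νy)
                                            (subst (x ℚ.<_) (ℚ.*-comm ν y) x<νy)
        -- This splits y into a part a′ below a and a part y - a′ below b.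
        (a′ , y-b<a′ , a′<a) = ℚ.<-dense (<-+⇒-< {y} {a} y<a+b)
    in supergale w (inj₂ (ν′ , y , 0≤ν′ , 0≤y , ν≤2^-s ν′<ν
         , (a′ , y ℚ.- a′ , a≤ a′<a , b≤
             (<-+⇒-< {y} {b} (subst (y ℚ.<_) (ℚ.+-comm a′ b) (-<⇒<-+ {y} {b} y-b<a′)))
           , sym (q+[p-q] y a′))
         , subst (x ℚ.<_) (ℚ.*-comm y ν′) x<yν′))

-- Rational approximation of powers of two and elementary growth estimates

-- (1 + 1/x)^i ≤ x/(x ∸ i), without division or subtraction

suc-^-upper : ∀ x i j → i + j ≡ x → suc x ^ i * j ℕ.≤ x ^ i * x
suc-^-upper x zero    j refl = ℕ.≤-refl
suc-^-upper x (suc i) j eq   = begin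
  suc x * suc x ^ i * j        ≡⟨ rearrange₁ x (suc x ^ i) j ⟩
  suc x ^ i * (x * j + j)      ≤⟨ ℕ.*-monoʳ-≤ (suc x ^ i) (ℕ.+-monoʳ-≤ (x * j) j≤x) ⟩
  suc x ^ i * (x * j + x)      ≡⟨ rearrange₂ x (suc x ^ i) j ⟩
  x * (suc x ^ i * suc j)      ≤⟨ ℕ.*-monoʳ-≤ x (suc-^-upper x i (suc j) (trans (ℕ.+-suc i j) eq)) ⟩
  x * (x ^ i * x)              ≡⟨ ℕ.*-assoc x (x ^ i) x ⟨
  x * x ^ i * x                ∎
  where
  open ℕ.≤-Reasoning
  j≤x : j ℕ.≤ x
  j≤x = subst (j ℕ.≤_) eq (ℕ.m≤n+m j (suc i))
  rearrange₁ : ∀ x y j → suc x * y * j ≡ y * (x * j + j)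
  rearrange₁ = solve-∀
  rearrange₂ : ∀ x y j → y * (x * j + x) ≡ x * (y * suc j)
  rearrange₂ = solve-∀

-- Bernoulli's inequality (1 + 1/x)^i ≥ 1 + i/x, cleared of denominators.
suc-^-lower : ∀ x i → x ^ i * (x + i) ℕ.≤ suc x ^ i * x
suc-^-lower x zero    = ℕ.≤-reflexive (cong (1 *_) (ℕ.+-identityʳ x))
suc-^-lower x (suc i) = begin
  x * x ^ i * (x + suc i)          ≤⟨ ℕ.m≤m+n _ (x ^ i * i) ⟩
  x * x ^ i * (x + suc i) + x ^ i * i ≡⟨ rearrange x (x ^ i) i ⟩
  suc x * (x ^ i * (x + i))        ≤⟨ ℕ.*-monoʳ-≤ (suc x) (suc-^-lower x i) ⟩
  suc x * (suc x ^ i * x)          ≡⟨ ℕ.*-assoc (suc x) (suc x ^ i) x ⟨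
  suc x * suc x ^ i * x            ∎
  where
  open ℕ.≤-Reasoning
  rearrange : ∀ x y i → x * y * (x + suc i) + y * i ≡ suc x * (y * (x + i))
  rearrange = solve-∀

first-crossing : ∀ {P : ℕ → Set} → (∀ e → Dec (P e)) → ∀ n → P n → P 0 ⊎ ∃[ e ] ¬ P e × P (suc e)
first-crossing P? zero    Pn = inj₁ Pn
first-crossing P? (suc n) Pn with P? n
... | yes Pn′ = first-crossing P? n Pn′
... | no ¬Pn  = inj₂ (n , ¬Pn , Pn)

-- The powers of 1 + 1/2b have ratio less than 2^(1/b), so that one of them lies in
-- the interval.

root : ∀ a b → ∃[ M ] ∃[ N ] (suc N ^ suc b * 2 ^ a ℕ.≤ suc M ^ suc b)
                           × (suc M ^ suc b ℕ.≤ 2 ^ suc a * suc N ^ suc b)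
root a b with first-crossing {P} (λ e → _ ℕ.≤? _) (x * a) enough
  where
  x : ℕ
  x = 2 * suc b
  P : ℕ → Set
  P e = (x ^ e) ^ suc b * 2 ^ a ℕ.≤ (suc x ^ e) ^ suc b
  -- Bernoulli with i = x gives (1 + 1/x)^x ≥ 2, so the power x a certainly passes the lower end of
  -- the interval.
  double : x ^ x * 2 ℕ.≤ suc x ^ x
  double = ℕ.*-cancelʳ-≤ (x ^ x * 2) (suc x ^ x) x
      (ℕ.≤-trans (ℕ.≤-reflexive (rearrange (x ^ x) x)) (suc-^-lower x x))
    where
    rearrange : ∀ y x → y * 2 * x ≡ y * (x + x)
    rearrange = solve-∀
  enough : P (x * a)
  enough = begin
    (x ^ (x * a)) ^ suc b * 2 ^ a
      ≤⟨ ℕ.*-monoʳ-≤ ((x ^ (x * a)) ^ suc b)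
          (ℕ.m≤m*n (2 ^ a) ((2 ^ a) ^ b) {{ℕ.>-nonZero
              (ℕ.m^n>0 (2 ^ a) {{ℕ.>-nonZero (ℕ.m^n>0 2 a)}} b)}}) ⟩
    (x ^ (x * a)) ^ suc b * (2 ^ a) ^ suc b ≡⟨ ^-distrib-* (x ^ (x * a)) (2 ^ a) (suc b) ⟨
    (x ^ (x * a) * 2 ^ a) ^ suc b
      ≡⟨ cong (λ y → (y * 2 ^ a) ^ suc b) (sym (ℕ.^-*-assoc x x a)) ⟩
    ((x ^ x) ^ a * 2 ^ a) ^ suc b         ≡⟨ cong (_^ suc b) (sym (^-distrib-* (x ^ x) 2 a)) ⟩
    ((x ^ x * 2) ^ a) ^ suc b             ≤⟨ ℕ.^-monoˡ-≤ (suc b) (ℕ.^-monoˡ-≤ a double) ⟩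
    ((suc x ^ x) ^ a) ^ suc b             ≡⟨ cong (_^ suc b) (ℕ.^-*-assoc (suc x) x a) ⟩
    (suc x ^ (x * a)) ^ suc b             ∎
    where open ℕ.≤-Reasoning
-- Here 2^a ≤ 1, and the ratio 1 already lies in the interval.
... | inj₁ P0 = 0 , 0 , P0 , ℕ.≤-trans (ℕ.≤-reflexive (ℕ.^-zeroˡ (suc b)))
      (ℕ.*-mono-≤ (ℕ.m^n>0 2 (suc a)) (ℕ.m^n>0 1 (suc b)))
... | inj₂ (e , ¬Pe , Pe) = ℕ.pred M , ℕ.pred N ,
      subst₂ (λ N M → N ^ suc b * 2 ^ a ℕ.≤ M ^ suc b) (sym N≡) (sym M≡) Pe ,
      subst₂ (λ N M → M ^ suc b ℕ.≤ 2 ^ suc a * N ^ suc b) (sym N≡) (sym M≡) upper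
  where
  x M N : ℕ
  x = 2 * suc b
  M = suc x ^ suc e
  N = x ^ suc e
  M≡ : suc (ℕ.pred M) ≡ M
  M≡ = ℕ.suc-pred M {{ℕ.>-nonZero (ℕ.m^n>0 (suc x) (suc e))}}
  N≡ : suc (ℕ.pred N) ≡ N
  N≡ = ℕ.suc-pred N {{ℕ.>-nonZero (ℕ.m^n>0 x (suc e))}}
  -- With i = 1 + b and x = 2 i the bound x/(x ∸ i) is exactly 2; this is the reason for the choice
  -- of x.
  double : suc x ^ suc b ℕ.≤ 2 * x ^ suc b
  double = ℕ.*-cancelʳ-≤ (suc x ^ suc b) (2 * x ^ suc b) (suc b) (ℕ.≤-trans
    (suc-^-upper x (suc b) (suc b) (cong (suc b +_) (sym (ℕ.+-identityʳ (suc b)))))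
    (ℕ.≤-reflexive (rearrange (x ^ suc b) (suc b))))
    where
    rearrange : ∀ y b → y * (2 * b) ≡ 2 * y * b
    rearrange = solve-∀
  upper : M ^ suc b ℕ.≤ 2 ^ suc a * N ^ suc b
  upper = begin
    (suc x * suc x ^ e) ^ suc b             ≡⟨ ^-distrib-* (suc x) (suc x ^ e) (suc b) ⟩
    suc x ^ suc b * (suc x ^ e) ^ suc b     ≤⟨ ℕ.*-mono-≤ double (ℕ.<⇒≤ (ℕ.≰⇒> ¬Pe)) ⟩
    2 * x ^ suc b * ((x ^ e) ^ suc b * 2 ^ a) ≡⟨ rearrange (x ^ suc b) ((x ^ e) ^ suc b) (2 ^ a) ⟩
    2 * 2 ^ a * (x ^ suc b * (x ^ e) ^ suc b) ≡⟨ cong (2 * 2 ^ a *_) (^-distrib-* x (x ^ e) (suc b)) ⟨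
    2 * 2 ^ a * (x * x ^ e) ^ suc b         ∎
    where
    open ℕ.≤-Reasoning
    rearrange : ∀ u v w → 2 * u * (v * w) ≡ 2 * w * (u * v)
    rearrange = solve-∀

/1+-mono-< : ∀ a b c d → a * suc d ℕ.< c * suc b → a /1+ b ℚ.< c /1+ d
/1+-mono-< a b c d lt = ℚ.≰⇒> λ ge → ℕ.<⇒≱ lt (/1+-cancel c d a b ge)
  where
  /1+-cancel : ∀ a b c d → a /1+ b ℚ.≤ c /1+ d → a * suc d ℕ.≤ c * suc b
  /1+-cancel a b c d le = ι-cancel-≤ (subst₂ ℚ._≤_
    (trans (cong (ℚ._* ι (suc d)) (/1+-* a b)) (sym (ι-* a (suc d))))
    (trans (swapʳ (c /1+ d) (ι (suc b)) (ι (suc d)))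
        (trans (cong (ℚ._* ι (suc b)) (/1+-* c d)) (sym (ι-* c (suc b)))))
    (*-monoʳ-≤ι (suc d) (*-monoʳ-≤ι (suc b) le)))

/1+-cancel-< : ∀ a b c d → a /1+ b ℚ.< c /1+ d → a * suc d ℕ.< c * suc b
/1+-cancel-< a b c d lt = ℕ.≰⇒> λ ge → <⇒≱ lt (/1+-mono c d a b ge)

-- Over a common denominator the numerators of q and r differ by at least one, hence over three
-- times that denominator by at least three. This leaves room for one point strictly above q and two
-- further steps below r.
between : ∀ {q r} → 0ℚ ℚ.≤ q → q ℚ.< r → ∃[ a ] ∃[ b ] q ℚ.< a /1+ b × (2 + a) /1+ b ℚ.≤ r
between {q} {r} 0≤q q<r
  with q₁ , q₂ , refl ← nonNeg-quotient 0≤q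
  with r₁ , r₂ , refl ← nonNeg-quotient (ℚ.≤-trans 0≤q (ℚ.<⇒≤ q<r)) =
  a , b , /1+-mono-< q₁ q₂ a b lower-bound , /1+-mono (2 + a) b r₁ r₂ upper-bound
  where
  a b : ℕ
  a = 1 + 3 * (q₁ * suc r₂)
  b = ℕ.pred (3 * (suc q₂ * suc r₂))
  lower-bound : q₁ * suc b ℕ.< a * suc q₂
  lower-bound = ℕ.≤-trans (ℕ.m≤m+n _ q₂) (ℕ.≤-reflexive (rearrange q₁ q₂ r₂))
    where
    rearrange : ∀ q₁ q₂ r₂ → suc (q₁ * (3 * (suc q₂ * suc r₂))) + q₂ ≡ (1 + 3 * (q₁ * suc r₂)) * suc q₂
    rearrange = solve-∀
  upper-bound : (2 + a) * suc r₂ ℕ.≤ r₁ * suc b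
  upper-bound = begin
    (3 + 3 * (q₁ * suc r₂)) * suc r₂ ≡⟨ rearrange₁ (q₁ * suc r₂) (suc r₂) ⟩
    3 * suc r₂ * suc (q₁ * suc r₂)   ≤⟨ ℕ.*-monoʳ-≤ (3 * suc r₂) (/1+-cancel-< q₁ q₂ r₁ r₂ q<r) ⟩
    3 * suc r₂ * (r₁ * suc q₂)       ≡⟨ rearrange₂ r₁ (suc q₂) (suc r₂) ⟩
    r₁ * (3 * (suc q₂ * suc r₂))     ∎
    where
    open ℕ.≤-Reasoning
    rearrange₁ : ∀ x r → (3 + 3 * x) * r ≡ 3 * r * suc x
    rearrange₁ = solve-∀
    rearrange₂ : ∀ r q s → 3 * s * (r * q) ≡ r * (3 * (q * s))
    rearrange₂ = solve-∀

n<2^n : ∀ n → n ℕ.< 2 ^ n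
n<2^n zero    = s≤s z≤n
n<2^n (suc n) = begin-strict
  suc n           ≤⟨ n<2^n n ⟩
  2 ^ n           <⟨ ℕ.m<m+n (2 ^ n) (ℕ.m^n>0 2 n) ⟩
  2 ^ n + 2 ^ n   ≡⟨ cong (2 ^ n +_) (ℕ.+-identityʳ (2 ^ n)) ⟨
  2 ^ suc n       ∎
  where open ℕ.≤-Reasoning

-- Write β for 1 + b and r for the integer part of m/(3β). Then 2m² < 18β²(r+1)² ≤ r(r+1)² ≤ 2^(3r)
-- as soon as r ≥ 18β², which is the origin of 54β³; finally 3rβ ≤ m.
exponential-beats-square : ∀ b m → 54 * (suc b * (suc b * suc b)) ℕ.≤ m →
                           (2 * (m * m)) ^ suc b ℕ.< 2 ^ m
exponential-beats-square b m large = begin-strict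
  (2 * (m * m)) ^ suc b   <⟨ ℕ.^-monoˡ-< (suc b) 2mm< ⟩
  (2 ^ (3 * r)) ^ suc b   ≡⟨ ℕ.^-*-assoc 2 (3 * r) (suc b) ⟩
  2 ^ (3 * r * suc b)
    ≤⟨ ℕ.^-monoʳ-≤ 2 (ℕ.≤-trans (ℕ.≤-reflexive (rearrange r (suc b))) (m/n*n≤m m B)) ⟩
  2 ^ m                   ∎
  where
  open ℕ.≤-Reasoning
  B r : ℕ
  B = 3 * suc b
  r = m / B
  rearrange : ∀ r b → 3 * r * b ≡ r * (3 * b)
  rearrange = solve-∀
  m<B+rB : m ℕ.< suc r * B
  m<B+rB = subst (ℕ._< suc r * B) (sym (m≡m%n+[m/n]*n m B)) (ℕ.+-monoˡ-< (r * B) (m%n<n m B))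
  18bb≤r : 18 * (suc b * suc b) ℕ.≤ r
  18bb≤r = ℕ.≤-trans (ℕ.≤-reflexive (sym (m*n/n≡m (18 * (suc b * suc b)) B)))
    (/-monoˡ-≤ B (ℕ.≤-trans (ℕ.≤-reflexive (rearrange′ (suc b))) large))
    where
    rearrange′ : ∀ b → 18 * (b * b) * (3 * b) ≡ 54 * (b * (b * b))
    rearrange′ = solve-∀
  2mm< : 2 * (m * m) ℕ.< 2 ^ (3 * r)
  2mm< = begin-strict
    2 * (m * m)                             <⟨ ℕ.*-monoʳ-< 2 (ℕ.*-mono-< m<B+rB m<B+rB) ⟩
    2 * (suc r * B * (suc r * B))           ≡⟨ rearrange₁ (suc r) (suc b) ⟩
    suc r * suc r * (18 * (suc b * suc b))  ≤⟨ ℕ.*-monoʳ-≤ (suc r * suc r) 18bb≤r ⟩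
    suc r * suc r * r
      ≤⟨ ℕ.*-mono-≤ (ℕ.*-mono-≤ (n<2^n r) (n<2^n r)) (ℕ.<⇒≤ (n<2^n r)) ⟩
    2 ^ r * 2 ^ r * 2 ^ r                   ≡⟨ rearrange₂ (2 ^ r) ⟩
    (2 ^ r) ^ 3                             ≡⟨ ℕ.^-*-assoc 2 r 3 ⟩
    2 ^ (r * 3)                             ≡⟨ cong (2 ^_) (ℕ.*-comm r 3) ⟩
    2 ^ (3 * r)                             ∎
    where
    rearrange₁ : ∀ r b → 2 * (r * (3 * b) * (r * (3 * b))) ≡ r * r * (18 * (b * b))
    rearrange₁ = solve-∀
    rearrange₂ : ∀ x → x * x * x ≡ x * (x * (x * 1))
    rearrange₂ = solve-∀

½^-antimono : ∀ {m n} → m ℕ.≤ n → ½ ^ℚ n ℚ.≤ ½ ^ℚ m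
½^-antimono {n = n} z≤n = ½^≤1 n
½^-antimono (s≤s {m} {n} m≤n) = *-mono-nonNeg 0≤½ (0≤^ m 0≤½) ℚ.≤-refl (½^-antimono m≤n)

½^-small : ∀ {ε} → 0ℚ ℚ.< ε → ∃[ k ] ∀ n → k ℕ.≤ n → ½ ^ℚ n ℚ.≤ ε
½^-small {ε} 0<ε = k , λ n k≤n → ℚ.≤-trans (½^-antimono k≤n)
  (ℚ.*-cancelʳ-≤-pos (ι (2 ^ k)) {{ℚ.positive (0<ι (ℕ.m^n>0 2 k))}} (begin
    ½ ^ℚ k ℚ.* ι (2 ^ k)    ≡⟨ ½^*2^ k ⟩
    1ℚ                      ≡⟨ ℚ.*-inverseʳ ε ⟨
    ε ℚ.* ℚ.1/ ε
      ≤⟨ ℚ.*-monoˡ-≤-nonNeg ε {{ℚ.nonNegative (ℚ.<⇒≤ 0<ε)}} (proj₂ (archimedean (ℚ.1/ ε))) ⟩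
    ε ℚ.* ι k
      ≤⟨ ℚ.*-monoˡ-≤-nonNeg ε {{ℚ.nonNegative (ℚ.<⇒≤ 0<ε)}} (ι-mono-≤ (ℕ.<⇒≤ (n<2^n k))) ⟩
    ε ℚ.* ι (2 ^ k)         ∎))
  where
  open ℚ.≤-Reasoning
  instance
    ε-nonZero : ℚ.NonZero ε
    ε-nonZero = ℚ.>-nonZero 0<ε
  k : ℕ
  k = proj₁ (archimedean (ℚ.1/ ε))

∈⇒fromℚ≤ : ∀ (x : ℝ) {q} → q ∈ cut x → fromℚ q ≤ x
∈⇒fromℚ≤ x q∈x p<q = downward x p<q q∈x

fromℚ≤-∉ : ∀ (x : ℝ) {p q} → fromℚ p ≤ x → q ∉ cut x → p ℚ.≤ q
fromℚ≤-∉ x p≤x q∉x = ℚ.≮⇒≥ λ q<p → q∉x (p≤x q<p)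

-- Kraft's inequality and the growth of capital

∑-2* : ∀ n f → ∑ (2 * n) f ≡ ∑ n (λ i → f (2 * i)) + ∑ n (λ i → f (1 + 2 * i))
∑-2* zero    f = refl
∑-2* (suc n) f = begin
  ∑ (2 * suc n) f                           ≡⟨ cong (λ m → ∑ m f) (ℕ.*-suc 2 n) ⟩
  ∑ (2 * n) f + f (2 * n) + f (1 + 2 * n)   ≡⟨ cong (λ s → s + f (2 * n) + f (1 + 2 * n)) (∑-2* n f) ⟩
  e + o + f (2 * n) + f (1 + 2 * n)         ≡⟨ rearrange e o (f (2 * n)) (f (1 + 2 * n)) ⟩
  e + f (2 * n) + (o + f (1 + 2 * n))       ∎
  where
  open ≡-Reasoning
  e o : ℕ
  e = ∑ n λ i → f (2 * i)
  o = ∑ n λ i → f (1 + 2 * i)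
  rearrange : ∀ e o x y → e + o + x + y ≡ e + x + (o + y)
  rearrange = solve-∀

∑-mono-length : ∀ {m n} f → m ℕ.≤ n → ∑ m f ℕ.≤ ∑ n f
∑-mono-length {m} f m≤n = go (ℕ.≤⇒≤′ m≤n)
  where
  go : ∀ {n} → m ℕ.≤′ n → ∑ m f ℕ.≤ ∑ n f
  go ℕ.≤′-refl           = ℕ.≤-refl
  go (ℕ.≤′-step {n} m≤n) = ℕ.≤-trans (go m≤n) (ℕ.m≤m+n (∑ n f) (f n))

module _ {s : ℝ} {d : Str → ℝ≥0} (supergale : IsSupergale s d)
         {ν : ℚ} (0<ν : 0ℚ ℚ.< ν) (ν≤2^-s : fromℚ ν ≤ proj₁ (2^ (Defs.- s))) where

  private
    D : Str → ℝ
    D w = proj₁ (d w)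

  -- The first bit is the lowest digit, so the extensions by 0 and by 1 are the even and the odd v,
  -- and the induction splits the sum by parity. For an indicator f of strings with capital at least
  -- θ, it bounds their number.
  kraft : ∀ l w θ f → (∀ v → v ℕ.< 2 ^ l → fromℚ (θ ℚ.* ι (f v)) ≤ D (w ++ bits l v)) →
          fromℚ (ν ^ℚ l ℚ.* (θ ℚ.* ι (∑ (2 ^ l) f))) ≤ D w
  kraft zero w θ f bound =
    subst (λ u → fromℚ (1ℚ ℚ.* (θ ℚ.* ι (f 0))) ≤ D u) (++-identityʳ w)
      (subst (λ r → fromℚ r ≤ D (w ++ [])) (sym (ℚ.*-identityˡ (θ ℚ.* ι (f 0)))) (bound 0 (s≤s z≤n)))
  kraft (suc l) w θ f bound =
    subst (λ r → fromℚ r ≤ D w) (begin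
      ν ℚ.* (ν ^ℚ l ℚ.* (θ ℚ.* ι e) ℚ.+ ν ^ℚ l ℚ.* (θ ℚ.* ι o)) ≡⟨ rearrange ν (ν ^ℚ l) θ (ι e) (ι o) ⟩
      ν ℚ.* ν ^ℚ l ℚ.* (θ ℚ.* (ι e ℚ.+ ι o))  ≡⟨ cong (λ x → ν ℚ.* ν ^ℚ l ℚ.* (θ ℚ.* x)) (ι-+ e o) ⟨
      ν ℚ.* ν ^ℚ l ℚ.* (θ ℚ.* ι (e + o))
        ≡⟨ cong (λ x → ν ℚ.* ν ^ℚ l ℚ.* (θ ℚ.* ι x)) (∑-2* (2 ^ l) f) ⟨
      ν ℚ.* ν ^ℚ l ℚ.* (θ ℚ.* ι (∑ (2 ^ suc l) f)) ∎)
    (supergale-step {s} {d} supergale 0<ν ν≤2^-s w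
      (kraft l (w ∷ʳ false) θ (λ i → f (2 * i))
          (λ v v< → subst (λ u → fromℚ (θ ℚ.* ι (f (2 * v))) ≤ D u)
        (trans (cong (w ++_) (cong₂ (λ p h → toBool p ∷ bits l h) (parity-+2* 0 v) (half-+2* 0 v)))
               (sym (++-assoc w (false ∷ []) (bits l v))))
        (bound (2 * v) (ℕ.*-monoʳ-< 2 v<))))
      (kraft l (w ∷ʳ true) θ (λ i → f (1 + 2 * i))
          (λ v v< → subst (λ u → fromℚ (θ ℚ.* ι (f (1 + 2 * v))) ≤ D u)
        (trans (cong (w ++_) (cong₂ (λ p h → toBool p ∷ bits l h) (parity-+2* 1 v) (half-+2* 1 v)))
               (sym (++-assoc w (true ∷ []) (bits l v))))
        (bound (1 + 2 * v) (odd-< v<)))))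
    where
    open ≡-Reasoning
    e o : ℕ
    e = ∑ (2 ^ l) λ i → f (2 * i)
    o = ∑ (2 ^ l) λ i → f (1 + 2 * i)
    odd-< : ∀ {v n} → v ℕ.< n → 1 + 2 * v ℕ.< 2 * n
    odd-< {v} {n} v<n = ℕ.≤-trans (ℕ.≤-reflexive (sym (ℕ.*-suc 2 v))) (ℕ.*-monoʳ-≤ 2 v<n)
    rearrange : ∀ ν n θ e o →
                ν ℚ.* (n ℚ.* (θ ℚ.* e) ℚ.+ n ℚ.* (θ ℚ.* o)) ≡ ν ℚ.* n ℚ.* (θ ℚ.* (e ℚ.+ o))
    rearrange = ring-solve-∀ ℚ-ring

  -- Estimating the sibling of each successor by 0 bounds the growth along one string by the factor
  -- 1/ν for each bit.
  growth : ∀ u w {x} → fromℚ x ≤ D (w ++ u) → fromℚ (ν ^ℚ length u ℚ.* x) ≤ D w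
  growth []      w {x} x≤ = subst₂ (λ r v → fromℚ r ≤ D v) (sym (ℚ.*-identityˡ x)) (++-identityʳ w) x≤
  growth (b ∷ u) w {x} x≤ = step b
      (growth u (w ∷ʳ b) (subst (λ v → fromℚ x ≤ D v) (sym (++-assoc w (b ∷ []) u)) x≤))
    where
    y : ℚ
    y = ν ^ℚ length u ℚ.* x
    nonNeg : ∀ v → fromℚ 0ℚ ≤ D v
    nonNeg v = proj₂ (d v)
    rearrangeˡ : ∀ ν n x → ν ℚ.* (n ℚ.* x ℚ.+ 0ℚ) ≡ ν ℚ.* n ℚ.* x
    rearrangeˡ ν n x = trans (cong (ν ℚ.*_) (ℚ.+-identityʳ (n ℚ.* x))) (sym (ℚ.*-assoc ν n x))
    rearrangeʳ : ∀ ν n x → ν ℚ.* (0ℚ ℚ.+ n ℚ.* x) ≡ ν ℚ.* n ℚ.* x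
    rearrangeʳ ν n x = trans (cong (ν ℚ.*_) (ℚ.+-identityˡ (n ℚ.* x))) (sym (ℚ.*-assoc ν n x))
    step : ∀ b → fromℚ y ≤ D (w ∷ʳ b) → fromℚ (ν ℚ.* ν ^ℚ length u ℚ.* x) ≤ D w
    step false y≤ = subst (λ r → fromℚ r ≤ D w) (rearrangeˡ ν (ν ^ℚ length u) x)
      (supergale-step {s} {d} supergale 0<ν ν≤2^-s w y≤ (nonNeg (w ∷ʳ true)))
    step true  y≤ = subst (λ r → fromℚ r ≤ D w) (rearrangeʳ ν (ν ^ℚ length u) x)
      (supergale-step {s} {d} supergale 0<ν ν≤2^-s w (nonNeg (w ∷ʳ false)) y≤)

applyUpTo-+ : ∀ (f : ℕ → Bool) m n →
              applyUpTo f (m + n) ≡ applyUpTo f m ++ applyUpTo (λ i → f (m + i)) n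
applyUpTo-+ f zero    n = refl
applyUpTo-+ f (suc m) n = cong (f 0 ∷_) (applyUpTo-+ (λ i → f (suc i)) m n)

search-last : ∀ n (f : ℕ → ℕ) → f (search n f) ≡ 0 ⊎ search n f ≡ n
search-last zero    f = inj₂ refl
search-last (suc n) f with f (search n f) in eq
... | zero  = inj₁ eq
... | suc _ = inj₂ refl

-- The sequence

module Sequence (decide : ∀ n → Dec (n ∈ Halting)) (g : ℕ → ℚ) where

  indicator : ∀ {n} → Dec (n ∈ Halting) → ℕ
  indicator (yes _) = 1
  indicator (no _)  = 0

  χ : ℕ → ℕ
  χ n = indicator (decide n)

  χ⁺ : ∀ {n} → n ∈ Halting → χ n ≡ 1
  χ⁺ {n} n∈ with decide n
  ... | yes _  = refl
  ... | no n∉ = contradiction n∈ n∉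

  χ-cases : ∀ n → χ n ≡ 0 ⊎ (χ n ≡ 1 × n ∈ Halting)
  χ-cases n with decide n
  ... | yes n∈ = inj₂ (refl , n∈)
  ... | no _   = inj₁ refl

  χᶜ : ∀ {n} {f : Vec ℕ n → ℕ} → Computable Halting f → Computable Halting (λ xs → χ (f xs))
  χᶜ F = _∘ᶜ_ {f = λ xs → χ (lookup xs 0F)} (computable oracle λ { (x ∷ []) → run-oracle x }) (F ∷ᶜ []ᶜ)
    where
    run-oracle : ∀ x → Halting ⊢ oracle [ x ∷ [] ]⇓ χ x
    run-oracle x with decide x
    ... | yes x∈ = yes⇓ x∈
    ... | no x∉  = no⇓ x∉

  -- The ceiling of g k · (k + 1), cut down to the interval from 0 to k + 1; the truncation is
  -- needed because the approximation g k may leave the unit interval.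
  free : ℕ → ℕ
  free k = search (suc k) λ p → exceeds (encodeℚ (g k)) p (suc k)

  free≤ : ∀ k → free k ℕ.≤ suc k
  free≤ k = search-≤ (suc k) _

  free-lower : ∀ k {a b} → a ℕ.≤ b → ι a ℚ.≤ g k ℚ.* ι b → a * suc k ℕ.≤ free k * b
  free-lower k {a} {b} a≤b a≤gb with search-last (suc k) (λ p → exceeds (encodeℚ (g k)) p (suc k))
  -- The search hit its bound: the whole block is free, and a ≤ b suffices.
  ... | inj₂ free≡ = subst (λ p → a * suc k ℕ.≤ p * b) (sym free≡)
        (ℕ.≤-trans (ℕ.*-monoˡ-≤ (suc k) a≤b) (ℕ.≤-reflexive (ℕ.*-comm b (suc k))))
  ... | inj₁ exceeds≡0 = ι-cancel-≤ (begin
        ι (a * suc k)               ≡⟨ ι-* a (suc k) ⟩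
        ι a ℚ.* ι (suc k)           ≤⟨ *-monoʳ-≤ι (suc k) a≤gb ⟩
        g k ℚ.* ι b ℚ.* ι (suc k)   ≡⟨ swapʳ (g k) (ι b) (ι (suc k)) ⟩
        g k ℚ.* ι (suc k) ℚ.* ι b
          ≤⟨ *-monoʳ-≤ι b (ℚ.≮⇒≥ λ lt → exceeds⁺ (g k) (free k) (suc k) lt exceeds≡0) ⟩
        ι (free k) ℚ.* ι b          ≡⟨ ι-* (free k) b ⟨
        ι (free k * b)              ∎)
        where open ℚ.≤-Reasoning

  free-upper : ∀ k {j} → j ℕ.< free k → ι j ℚ.< g k ℚ.* ι (suc k)
  free-upper k {j} j< = exceeds⁻ (g k) j (suc k) (search-least (suc k) _ j<)

  -- The factor 2^(`triangle j`) allows for doubling at each bit before block j, one factor 2^j for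
  -- the initial capital, and the other for the j halvings made by then.
  threshold : ℕ → ℕ
  threshold j = 2 ^ (triangle j + 2 * j)

  -- The value of `encodeStr` on the prefix V followed by the block v: the digits below a leading
  -- one, minus 1.
  word : ℕ → ℕ → ℕ → ℕ
  word k V v = 2 ^ triangle (suc k) + (V + 2 ^ triangle k * v) ∸ 1

  bad : ℕ → ℕ → ℕ → ℕ → ℕ → ℕ
  bad k V n j v = χ (query n (word k V v) (threshold j) (2 ^ suc k))

  open Construction free bad public

  freeᶜ : Computable Halting {1} (λ xs → encodeℚ (g (lookup xs 0F))) →
          Computable Halting {1} (λ xs → free (lookup xs 0F))
  freeᶜ gᶜ = searchᶜ (exceedsᶜ (gᶜ ∘ᶜ (projᶜ 1F ∷ᶜ []ᶜ)) (projᶜ 0F) (sucᶜ (projᶜ 1F))) (sucᶜ (projᶜ 0F))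

  badᶜ : Computable Halting {5} λ xs →
         bad (lookup xs 0F) (lookup xs 1F) (lookup xs 2F) (lookup xs 3F) (lookup xs 4F)
  badᶜ = χᶜ (queryᶜ (projᶜ 2F)
    (constᶜ 2 ^ᶜ triangleᶜ (sucᶜ (projᶜ 0F)) +ᶜ
        (projᶜ 1F +ᶜ constᶜ 2 ^ᶜ triangleᶜ (projᶜ 0F) *ᶜ projᶜ 4F) ∸ᶜ constᶜ 1)
    (constᶜ 2 ^ᶜ (triangleᶜ (projᶜ 3F) +ᶜ constᶜ 2 *ᶜ projᶜ 3F))
    (constᶜ 2 ^ᶜ sucᶜ (projᶜ 0F)))

  sequence-Δ⁰₂ : (Σ (Code 1) λ c → ∀ r → Halting ⊢ c [ r ∷ [] ]⇓ encodeℚ (g r)) → Δ⁰₂-Sequence sequence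
  sequence-Δ⁰₂ (c , run-c) = code S , λ n → run S (n ∷ [])
    where
    S : Computable Halting {1} λ xs → encodeBool (sequence (lookup xs 0F))
    S = sequenceᶜ (freeᶜ (computable c λ { (r ∷ []) → run-c r })) badᶜ

  word-encodes : ∀ k {v} → v ℕ.< 2 ^ suc k →
                 encodeStr (bits (triangle k) (prefix k) ++ bits (suc k) v) ≡ word k (prefix k) v
  word-encodes k {v} v< = trans (cong encodeStr (sym split)) (cong ℕ.pred
    (suc-encodeStr-bits (triangle (suc k)) (extend-< k (prefix-< free≤ k) v<)))
    where
    split : bits (triangle (suc k)) (prefix k + 2 ^ triangle k * v) ≡
            bits (triangle k) (prefix k) ++ bits (suc k) v
    split = trans (cong (λ l → bits l (prefix k + 2 ^ triangle k * v)) (ℕ.+-comm (suc k) (triangle k)))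
                  (bits-++ (triangle k) (suc k) v (prefix-< free≤ k))

-- The lower bound

-- With ratio (1+M)/(1+N) at most 2^((1+a)/(1+b)), the count is at most 2 · 2^((1+a)m/(1+b)) for m =
-- k + 1, while 2^p is at least 2^((2+a)m/(1+b)). The surplus 2^(m/(1+b)) absorbs 2m²; the
-- comparison is made between (1+b)-th powers.
few-bad : ∀ a b M N k C p → suc M ^ suc b ℕ.≤ 2 ^ suc a * suc N ^ suc b →
          (2 + a) * suc k ℕ.≤ p * suc b → (2 * (suc k * suc k)) ^ suc b ℕ.< 2 ^ suc k →
          C * suc N ^ suc k ℕ.≤ 2 * suc M ^ suc k → suc k * (suc k * C) ℕ.< 2 ^ p
few-bad a b M N k C p M≤ free≥ large C≤ = ℕ.*-cancelʳ-< (N′ ^ m) (m * (m * C)) (2 ^ p) (begin-strict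
  m * (m * C) * N′ ^ m         ≡⟨ rearrange₁ m C (N′ ^ m) ⟩
  m * m * (C * N′ ^ m)         ≤⟨ ℕ.*-monoʳ-≤ (m * m) C≤ ⟩
  m * m * (2 * M′ ^ m)         ≡⟨ rearrange₂ (m * m) (M′ ^ m) ⟩
  2 * (m * m) * M′ ^ m         <⟨ ℕ.≰⇒> (λ le → ℕ.<⇒≱ powers (ℕ.^-monoˡ-≤ (suc b) le)) ⟩
  2 ^ p * N′ ^ m               ∎)
  where
  open ℕ.≤-Reasoning
  m M′ N′ : ℕ
  m = suc k
  M′ = suc M
  N′ = suc N
  rearrange₁ : ∀ m C x → m * (m * C) * x ≡ m * m * (C * x)
  rearrange₁ = solve-∀
  rearrange₂ : ∀ x y → x * (2 * y) ≡ 2 * x * y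
  rearrange₂ = solve-∀
  powers : (2 * (m * m) * M′ ^ m) ^ suc b ℕ.< (2 ^ p * N′ ^ m) ^ suc b
  powers = begin-strict
    (2 * (m * m) * M′ ^ m) ^ suc b              ≡⟨ ^-distrib-* (2 * (m * m)) (M′ ^ m) (suc b) ⟩
    (2 * (m * m)) ^ suc b * (M′ ^ m) ^ suc b    <⟨ ℕ.*-monoˡ-< ((M′ ^ m) ^ suc b)
              {{ℕ.>-nonZero (ℕ.m^n>0 (M′ ^ m) {{ℕ.>-nonZero (ℕ.m^n>0 M′ m)}} (suc b))}} large ⟩
    2 ^ m * (M′ ^ m) ^ suc b                    ≡⟨ cong (2 ^ m *_) (^-swap M′ m (suc b)) ⟩
    2 ^ m * (M′ ^ suc b) ^ m                    ≤⟨ ℕ.*-monoʳ-≤ (2 ^ m) (ℕ.^-monoˡ-≤ m M≤) ⟩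
    2 ^ m * (2 ^ suc a * N′ ^ suc b) ^ m        ≡⟨ ^-distrib-* 2 (2 ^ suc a * N′ ^ suc b) m ⟨
    (2 * (2 ^ suc a * N′ ^ suc b)) ^ m
      ≡⟨ cong (_^ m) (sym (ℕ.*-assoc 2 (2 ^ suc a) (N′ ^ suc b))) ⟩
    (2 ^ (2 + a) * N′ ^ suc b) ^ m              ≡⟨ ^-distrib-* (2 ^ (2 + a)) (N′ ^ suc b) m ⟩
    (2 ^ (2 + a)) ^ m * (N′ ^ suc b) ^ m
      ≡⟨ cong₂ _*_ (ℕ.^-*-assoc 2 (2 + a) m) (^-swap N′ (suc b) m) ⟩
    2 ^ ((2 + a) * m) * (N′ ^ m) ^ suc b
      ≤⟨ ℕ.*-monoˡ-≤ ((N′ ^ m) ^ suc b) (ℕ.^-monoʳ-≤ 2 free≥) ⟩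
    2 ^ (p * suc b) * (N′ ^ m) ^ suc b
      ≡⟨ cong (_* (N′ ^ m) ^ suc b) (ℕ.^-*-assoc 2 p (suc b)) ⟨
    (2 ^ p) ^ suc b * (N′ ^ m) ^ suc b          ≡⟨ ^-distrib-* (2 ^ p) (N′ ^ m) (suc b) ⟨
    (2 ^ p * N′ ^ m) ^ suc b                    ∎

module LowerBound (decide : ∀ n → Dec (n ∈ Halting)) (g : ℕ → ℚ) {s : ℝ} {d : Str → ℝ≥0}
  (supergale : IsSupergale s d) (f̂ : Str → ℕ → ℚ)
  (c : Code 2) (run-c : ∀ w t → ∅ ⊢ c [ encodeStr w ∷ t ∷ [] ]⇓ encodeℚ (f̂ w t))
  (rising : ∀ w t → f̂ w t ℚ.≤ f̂ w (suc t) × fromℚ (f̂ w (suc t)) < proj₁ (d w))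
  (converges : ∀ w → f̂ w ⟶ proj₁ (d w)) where

  open Sequence decide g

  private
    D : Str → ℝ
    D w = proj₁ (d w)

  -- The threshold at the start of block k; the tests inside block k compare with `θ j (suc k)`, the
  -- threshold at its end.
  θ : ℕ → ℕ → ℚ
  θ j k = ι (threshold j) ℚ.* ½ ^ℚ k

  0<½^ : ∀ k → 0ℚ ℚ.< ½ ^ℚ k
  0<½^ k = 0<^ k (ℚ.*<* (ℤ.+<+ (s≤s z≤n)))

  0<θ : ∀ j k → 0ℚ ℚ.< θ j k
  0<θ j k = 0<* (0<ι (ℕ.m^n>0 2 (triangle j + 2 * j))) (0<½^ k)

  θ-scaled : ∀ j k → θ j k ℚ.* ι (2 ^ k) ≡ ι (threshold j)
  θ-scaled j k = trans (ℚ.*-assoc (ι (threshold j)) (½ ^ℚ k) (ι (2 ^ k)))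
    (trans (cong (ι (threshold j) ℚ.*_) (½^*2^ k)) (ℚ.*-identityʳ (ι (threshold j))))

  θ-suc : ∀ j k → θ j k ≡ θ j (suc k) ℚ.* ι 2
  θ-suc j k = trans (sym (ℚ.*-identityʳ (θ j k))) (rearrange (ι (threshold j)) ½ (½ ^ℚ k) (ι 2))
    where
    rearrange : ∀ t h p w → t ℚ.* p ℚ.* (h ℚ.* w) ≡ t ℚ.* (h ℚ.* p) ℚ.* w
    rearrange = ring-solve-∀ ℚ-ring

  exceeds-θ⁺ : ∀ j k {q} → θ j k ℚ.< q → exceeds (encodeℚ q) (threshold j) (2 ^ k) ≢ 0
  exceeds-θ⁺ j k {q} θ<q = exceeds⁺ q (threshold j) (2 ^ k)
    (subst (ℚ._< q ℚ.* ι (2 ^ k)) (θ-scaled j k) (*-monoʳ-<ι (ℕ.m^n>0 2 k) θ<q))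

  exceeds-θ⁻ : ∀ j k {q} → exceeds (encodeℚ q) (threshold j) (2 ^ k) ≢ 0 → θ j k ℚ.< q
  exceeds-θ⁻ j k {q} exc = ℚ.*-cancelʳ-<-nonNeg (ι (2 ^ k)) {{ℚ.nonNegative (0≤ι (2 ^ k))}}
    (subst (ℚ._< q ℚ.* ι (2 ^ k)) (sym (θ-scaled j k)) (exceeds⁻ q (threshold j) (2 ^ k) exc))

  W : ℕ → Str
  W k = bits (triangle k) (prefix k)

  run-word : ∀ k {v} → v ℕ.< 2 ^ suc k → ∀ t →
             ∅ ⊢ c [ word k (prefix k) v ∷ t ∷ [] ]⇓ encodeℚ (f̂ (W k ++ bits (suc k) v) t)
  run-word k {v} v< t = subst (λ w → ∅ ⊢ c [ w ∷ t ∷ [] ]⇓ encodeℚ (f̂ (W k ++ bits (suc k) v) t))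
      (word-encodes k v<)
    (run-c (W k ++ bits (suc k) v) t)

  bad⁺ : ∀ k j {v} → v ℕ.< 2 ^ suc k → θ j (suc k) ∈ cut (D (W k ++ bits (suc k) v)) →
         bad k (prefix k) ⌜ c ⌝ j v ≡ 1
  bad⁺ k j {v} v< θ∈ =
    let (t , θ<f̂) = ∈⇒<approximation {D w} {f̂ w} (rising w) (converges w) θ∈
    in χ⁺ (halting-query⁺ c (word k (prefix k) v) (λ t → encodeℚ (f̂ w t)) (run-word k v<)
            (threshold j) (2 ^ suc k) t (exceeds-θ⁺ j (suc k) θ<f̂))
    where
    w : Str
    w = W k ++ bits (suc k) v

  -- One inequality covers both values of the indicator, which is the hypothesis of `kraft`.
  bad⁻ : ∀ k j {v} → v ℕ.< 2 ^ suc k →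
         fromℚ (θ j (suc k) ℚ.* ι (bad k (prefix k) ⌜ c ⌝ j v)) ≤ D (W k ++ bits (suc k) v)
  bad⁻ k j {v} v< {q} with χ-cases (query ⌜ c ⌝ (word k (prefix k) v) (threshold j) (2 ^ suc k))
  ... | inj₁ bad≡0 = λ q< → proj₂ (d w)
      (subst (q ℚ.<_) (trans (cong (λ n → θ j (suc k) ℚ.* ι n) bad≡0) (ℚ.*-zeroʳ (θ j (suc k)))) q<)
    where
    w : Str
    w = W k ++ bits (suc k) v
  ... | inj₂ (bad≡1 , halts) = λ q< → downward (D w)
          (subst (q ℚ.<_) (trans (cong (λ n → θ j (suc k) ℚ.* ι n) bad≡1)
              (ℚ.*-identityʳ (θ j (suc k)))) q<)
          (let (t , exc) = halting-query⁻ c (word k (prefix k) v) (λ t → encodeℚ (f̂ w t))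
                             (run-word k v<)
                             (threshold j) (2 ^ suc k) halts
           in <approximation⇒∈ {D w} {f̂ w} (rising w) (converges w) {t = t} (exceeds-θ⁻ j (suc k) exc))
    where
    w : Str
    w = W k ++ bits (suc k) v

  choice<2^ : ∀ k → choice k (prefix k) ℕ.< 2 ^ suc k
  choice<2^ k = ℕ.<-≤-trans (choice-< k (prefix k)) (ℕ.^-monoʳ-≤ 2 (free≤ k))

  W-suc : ∀ k → W (suc k) ≡ W k ++ bits (suc k) (choice k (prefix k))
  W-suc k = trans (cong (λ l → bits l (prefix (suc k))) (ℕ.+-comm (suc k) (triangle k)))
                  (bits-++ (triangle k) (suc k) (choice k (prefix k)) (prefix-< free≤ k))

  module _ {a b M N : ℕ} {q : ℚ} (q∉s : q ∉ cut s) (q<a/b : q ℚ.< a /1+ b) (a<b : suc a ℕ.≤ suc b)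
    (N≤M : suc N ^ suc b * 2 ^ a ℕ.≤ suc M ^ suc b)
    (M≤N : suc M ^ suc b ℕ.≤ 2 ^ suc a * suc N ^ suc b)
    (k₀ : ℕ) (⌜c⌝≤k₀ : ⌜ c ⌝ ℕ.≤ k₀) (initial : ι (2 ^ k₀) ∉ cut (D []))
    (large : ∀ k → k₀ ℕ.≤ k → 54 * (suc b * (suc b * suc b)) ℕ.≤ suc k)
    (dense : ∀ k → k₀ ℕ.≤ k → (2 + a) * suc k ℕ.≤ free k * suc b)
    where

    private
      ν : ℚ
      ν = suc N /1+ M

    -- Since 1 + a ≤ 1 + b, the ratio (1+M)/(1+N) is at most 2. Hence capital at most doubles with
    -- each bit, a rate crude enough for the start and for the inside of a block.
    ½≤ν : ½ ℚ.≤ ν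
    ½≤ν = *-cancelʳ-≤ι M (begin
      ½ ℚ.* ι (suc M)          ≤⟨ ℚ.*-monoˡ-≤-nonNeg ½ (ι-mono-≤ M≤2N) ⟩
      ½ ℚ.* ι (2 * suc N)      ≡⟨ cong (½ ℚ.*_) (ι-* 2 (suc N)) ⟩
      ½ ℚ.* (ι 2 ℚ.* ι (suc N)) ≡⟨ ℚ.*-assoc ½ (ι 2) (ι (suc N)) ⟨
      1ℚ ℚ.* ι (suc N)         ≡⟨ ℚ.*-identityˡ (ι (suc N)) ⟩
      ι (suc N)                ≡⟨ /1+-* (suc N) M ⟨
      ν ℚ.* ι (suc M)          ∎)
      where
      open ℚ.≤-Reasoning
      M≤2N : suc M ℕ.≤ 2 * suc N
      M≤2N = ^-cancelˡ-≤ b (ℕ.≤-trans M≤N (ℕ.≤-trans (ℕ.*-monoˡ-≤ (suc N ^ suc b) (ℕ.^-monoʳ-≤ 2 a<b))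
        (ℕ.≤-reflexive (sym (^-distrib-* 2 (suc N) (suc b))))))

    ν≤2^-s : fromℚ ν ≤ proj₁ (2^ (Defs.- s))
    ν≤2^-s {x} = quotient≤2^- s {q} {a} {b} {suc N} {M} q∉s q<a/b N≤M {x}

    0<½ : 0ℚ ℚ.< ½
    0<½ = ℚ.*<* (ℤ.+<+ (s≤s z≤n))

    0<ν : 0ℚ ℚ.< ν
    0<ν = ℚ.<-≤-trans 0<½ ½≤ν

    half-growth : ∀ u w {x} → fromℚ x ≤ D (w ++ u) → fromℚ (½ ^ℚ length u ℚ.* x) ≤ D w
    half-growth = growth {s} {d} supergale 0<½ λ {x} x<½ → ν≤2^-s {x} (ℚ.<-≤-trans x<½ ½≤ν)

    length-W : ∀ k → length (W k) ≡ triangle k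
    length-W k = trans (cong length (sym (sequence-prefix free≤ k)))
        (length-applyUpTo sequence (triangle k))

    -- The index of the threshold is k₀ itself: 2^k₀ bounds the initial capital, doubling over the
    -- bits before block k₀ gives 2^(`triangle k₀` + k₀), and this is θ k₀ k₀.
    bounded-start : θ k₀ k₀ ∉ cut (D (W k₀))
    bounded-start θ∈ =
      let (θ′ , θ<θ′ , θ′∈) = noMaximum (D (W k₀)) θ∈
      in initial (half-growth (W k₀) [] (∈⇒fromℚ≤ (D (W k₀)) θ′∈) (begin-strict
           ι (2 ^ k₀)                              ≡⟨ 2^k₀≡ ⟩
           ½ ^ℚ length (W k₀) ℚ.* θ k₀ k₀
             <⟨ ℚ.*-monoʳ-<-pos (½ ^ℚ length (W k₀)) {{ℚ.positive (0<½^ (length (W k₀)))}} θ<θ′ ⟩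
           ½ ^ℚ length (W k₀) ℚ.* θ′               ∎))
      where
      open ℚ.≤-Reasoning
      T : ℕ
      T = triangle k₀
      rearrange : ∀ a b c d e → a ℚ.* (b ℚ.* (c ℚ.* d) ℚ.* e) ≡ a ℚ.* b ℚ.* (e ℚ.* d) ℚ.* c
      rearrange = ring-solve-∀ ℚ-ring
      2^k₀≡ : ι (2 ^ k₀) ≡ ½ ^ℚ length (W k₀) ℚ.* θ k₀ k₀
      2^k₀≡ = sym (begin-equality
        ½ ^ℚ length (W k₀) ℚ.* (ι (2 ^ (T + 2 * k₀)) ℚ.* ½ ^ℚ k₀)
          ≡⟨ cong₂ (λ l x → ½ ^ℚ l ℚ.* (x ℚ.* ½ ^ℚ k₀)) (length-W k₀)
               (trans (cong ι (trans (ℕ.^-distribˡ-+-* 2 T (2 * k₀))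
                                (cong (λ e → 2 ^ T * e) (trans (cong (2 ^_) (cong (k₀ +_)
                                    (ℕ.+-identityʳ k₀))) (ℕ.^-distribˡ-+-* 2 k₀ k₀)))))
                      (trans (ι-* (2 ^ T) (2 ^ k₀ * 2 ^ k₀))
                          (cong (ι (2 ^ T) ℚ.*_) (ι-* (2 ^ k₀) (2 ^ k₀))))) ⟩
        ½ ^ℚ T ℚ.* (ι (2 ^ T) ℚ.* (ι (2 ^ k₀) ℚ.* ι (2 ^ k₀)) ℚ.* ½ ^ℚ k₀)
          ≡⟨ rearrange (½ ^ℚ T) (ι (2 ^ T)) (ι (2 ^ k₀)) (ι (2 ^ k₀)) (½ ^ℚ k₀) ⟩
        ½ ^ℚ T ℚ.* ι (2 ^ T) ℚ.* (½ ^ℚ k₀ ℚ.* ι (2 ^ k₀)) ℚ.* ι (2 ^ k₀)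
          ≡⟨ cong₂ (λ x y → x ℚ.* y ℚ.* ι (2 ^ k₀)) (½^*2^ T) (½^*2^ k₀) ⟩
        1ℚ ℚ.* 1ℚ ℚ.* ι (2 ^ k₀)
          ≡⟨ ℚ.*-identityˡ (ι (2 ^ k₀)) ⟩
        ι (2 ^ k₀) ∎)

    -- The factor 2 in the count is the quotient of consecutive thresholds. The count being small
    -- makes the test sparse, so the chosen block avoids it, whereas a capital above the new
    -- threshold would meet it.
    bounded-step : ∀ k → k₀ ℕ.≤ k → θ k₀ k ∉ cut (D (W k)) → θ k₀ (suc k) ∉ cut (D (W (suc k)))
    bounded-step k k₀≤k θ∉ θ∈ = ℕ.1+n≢0 (trans
      (sym (bad⁺ k k₀ (choice<2^ k) (subst (λ w → θ k₀ (suc k) ∈ cut (D w)) (W-suc k) θ∈)))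
      (choice-avoids k (prefix k) ⌜ c ⌝ k₀ (ℕ.≤-trans ⌜c⌝≤k₀ k₀≤k) k₀≤k
        (few-bad a b M N k C (free k) M≤N (dense k k₀≤k)
          (exponential-beats-square b (suc k) (large k k₀≤k)) (ι-cancel-≤ C≤))))
      where
      m C C′ : ℕ
      m = suc k
      C = count k (prefix k) ⌜ c ⌝ k₀
      C′ = ∑ (2 ^ m) (bad k (prefix k) ⌜ c ⌝ k₀)
      -- Kraft sums over all blocks of length k + 1; the candidates are those whose number is below
      -- 2^(`free k`).
      C≤C′ : C ℕ.≤ C′
      C≤C′ = ∑-mono-length _ (ℕ.^-monoʳ-≤ 2 (free≤ k))
      θ′ : ℚ
      θ′ = θ k₀ (suc k)
      weight≤ : ν ^ℚ m ℚ.* (θ′ ℚ.* ι C′) ℚ.≤ θ′ ℚ.* ι 2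
      weight≤ = subst (ν ^ℚ m ℚ.* (θ′ ℚ.* ι C′) ℚ.≤_) (θ-suc k₀ k)
        (fromℚ≤-∉ (D (W k)) (kraft {s} {d} supergale 0<ν (λ {x} → ν≤2^-s {x}) m (W k) θ′
            (bad k (prefix k) ⌜ c ⌝ k₀)
                     (λ v v< {x} → bad⁻ k k₀ v< {x})) θ∉)
      C≤ : ι (C * suc N ^ m) ℚ.≤ ι (2 * suc M ^ m)
      C≤ = ℚ.*-cancelʳ-≤-pos θ′ {{ℚ.positive (0<θ k₀ (suc k))}} (begin
        ι (C * suc N ^ m) ℚ.* θ′
          ≤⟨ ℚ.*-monoʳ-≤-nonNeg θ′ {{ℚ.nonNegative (ℚ.<⇒≤ (0<θ k₀ (suc k)))}}
              (ι-mono-≤ (ℕ.*-monoˡ-≤ (suc N ^ m) C≤C′)) ⟩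
        ι (C′ * suc N ^ m) ℚ.* θ′                    ≡⟨ cong (ℚ._* θ′) (trans (ι-* C′ (suc N ^ m))
              (cong (ι C′ ℚ.*_) (sym (quotient-^ {ν} {suc N} {suc M} m (/1+-* (suc N) M))))) ⟩
        ι C′ ℚ.* (ν ^ℚ m ℚ.* ι (suc M ^ m)) ℚ.* θ′   ≡⟨ rearrange₁ (ι C′) (ν ^ℚ m) (ι (suc M ^ m)) θ′ ⟩
        ν ^ℚ m ℚ.* (θ′ ℚ.* ι C′) ℚ.* ι (suc M ^ m)   ≤⟨ *-monoʳ-≤ι (suc M ^ m) weight≤ ⟩
        θ′ ℚ.* ι 2 ℚ.* ι (suc M ^ m)                 ≡⟨ rearrange₂ θ′ (ι 2) (ι (suc M ^ m)) ⟩
        ι 2 ℚ.* ι (suc M ^ m) ℚ.* θ′                 ≡⟨ cong (ℚ._* θ′) (ι-* 2 (suc M ^ m)) ⟨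
        ι (2 * suc M ^ m) ℚ.* θ′                     ∎)
        where
        open ℚ.≤-Reasoning
        rearrange₁ : ∀ c n m t → c ℚ.* (n ℚ.* m) ℚ.* t ≡ n ℚ.* (t ℚ.* c) ℚ.* m
        rearrange₁ = ring-solve-∀ ℚ-ring
        rearrange₂ : ∀ t w m → t ℚ.* w ℚ.* m ≡ w ℚ.* m ℚ.* t
        rearrange₂ = ring-solve-∀ ℚ-ring

    bounded-blocks : ∀ {k} → k₀ ℕ.≤ k → θ k₀ k ∉ cut (D (W k))
    bounded-blocks k₀≤k = go (ℕ.≤⇒≤′ k₀≤k)
      where
      go : ∀ {k} → k₀ ℕ.≤′ k → θ k₀ k ∉ cut (D (W k))
      go ℕ.≤′-refl           = bounded-start
      go (ℕ.≤′-step {k} k₀≤k) = bounded-step k (ℕ.≤′⇒≤ k₀≤k) (go k₀≤k)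

    fails : ¬ sequence ∈ S^∞[ d ]
    fails succeeds =
      -- Doubling at most k times inside block k turns the bound θ k₀ k into `threshold k₀`, which
      -- no longer depends on k.
      let (n , T≤n , x , x≮ , x∈) = succeeds (ι (threshold k₀)) (triangle k₀)
          (y , x<y , y∈) = noMaximum (D (applyUpTo sequence n)) x∈
      in overshoot n T≤n (ℚ.≤-<-trans (ℚ.≮⇒≥ x≮) x<y) y∈
      where
      overshoot : ∀ n → triangle k₀ ℕ.≤ n → ∀ {y} → ι (threshold k₀) ℚ.< y →
                  ¬ y ∈ cut (D (applyUpTo sequence n))
      overshoot n T≤n {y} T<y y∈ = bounded-blocks k₀≤k
        (half-growth u (W k) (∈⇒fromℚ≤ (D (W k ++ u)) (subst (λ w → y ∈ cut (D w)) split y∈))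
            (begin-strict
          ι (threshold k₀) ℚ.* ½ ^ℚ k           ≡⟨ ℚ.*-comm (ι (threshold k₀)) (½ ^ℚ k) ⟩
          ½ ^ℚ k ℚ.* ι (threshold k₀)
            ≤⟨ ℚ.*-monoʳ-≤-nonNeg (ι (threshold k₀)) {{ℚ.nonNegative (0≤ι (threshold k₀))}}
                (½^-antimono r≤k) ⟩
          ½ ^ℚ length u ℚ.* ι (threshold k₀)
            <⟨ ℚ.*-monoʳ-<-pos (½ ^ℚ length u) {{ℚ.positive (0<½^ (length u))}} T<y ⟩
          ½ ^ℚ length u ℚ.* y                   ∎))
        where
        open ℚ.≤-Reasoning
        k r : ℕ
        k = diagonal n
        r = π₂ n
        u : Str
        u = applyUpTo (λ i → sequence (triangle k + i)) r
        n≡ : triangle k + r ≡ n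
        n≡ = ℕ.m+[n∸m]≡n (diagonal-lower n)
        k₀≤k : k₀ ℕ.≤ k
        k₀≤k = triangle-< {k₀} T≤n (diagonal-upper n)
        r≤k : length u ℕ.≤ k
        r≤k = subst (ℕ._≤ k) (sym (length-applyUpTo _ r)) (π₂≤diagonal n)
        split : applyUpTo sequence n ≡ W k ++ u
        split = trans (cong (applyUpTo sequence) (sym n≡))
          (trans (applyUpTo-+ sequence (triangle k) r) (cong (_++ u) (sequence-prefix free≤ k)))

  lower-bound : ∀ {α} → (∀ r → Defs.∣ fromℚ (g r) Defs.- α ∣ ≤ fromℚ (½ ^ℚ r)) → 0ℝ ≤ s → α ≤ 1ℝ →
                sequence ∈ S^∞[ d ] → ∀ {q} → q ∉ cut s → ¬ q ∈ cut α
  lower-bound {α} close 0≤s α≤1 succeeds {q} q∉s q∈α =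
    -- The gap from q to q′ holds the three exponents a, 1 + a, 2 + a over 1 + b; the gap from q′ to
    -- q″ is the error allowed to g, so that q′ ≤ g k for late k.
    let (q′ , q<q′ , q′∈α) = noMaximum α q∈α
        (q″ , q′<q″ , q″∈α) = noMaximum α q′∈α
        (a , b , q<a/b , a/b≤q′) = between (ℚ.≮⇒≥ λ q<0 → q∉s (0≤s q<0)) q<q′
        (M , N , N≤M , M≤N) = root a b
        (k₁ , ½^≤) = ½^-small (+-<⇒<- {0ℚ} {q′} (subst (ℚ._< q″) (sym (ℚ.+-identityˡ q′)) q′<q″))
        (x , x∉) = bounded (D [])
        (A , x≤A) = archimedean x
        k₀ = k₁ + (A + (⌜ c ⌝ + 54 * (suc b * (suc b * suc b))))
        q′≤g = λ k k₁≤k → +-cancel≤ {q′} {q″} {g k}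
            (distance-lower (g k) α (λ ½^∈ → ℚ.<-irrefl refl (close k ½^∈)) q″∈α) (½^≤ k k₁≤k)
        -- This is where α ≤ 1 enters: (2+a)/(1+b) ≤ q′ < 1.
        2+a<1+b = ι-cancel-< (subst₂ ℚ._<_ (/1+-* (2 + a) b) (ℚ.*-identityˡ (ι (suc b)))
                    (*-monoʳ-<ι (s≤s z≤n) (ℚ.≤-<-trans a/b≤q′ (α≤1 q′∈α))))
    in fails {a} {b} {M} {N} {q} q∉s q<a/b (ℕ.<⇒≤ (ℕ.<-trans (ℕ.n<1+n (suc a)) 2+a<1+b)) N≤M M≤N k₀
         (ℕ.≤-trans (ℕ.m≤m+n ⌜ c ⌝ _) (ℕ.≤-trans (ℕ.m≤n+m _ A) (ℕ.m≤n+m _ k₁)))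
         (λ 2^k₀∈ → x∉ (∈-resp-≤ (D []) (ℚ.≤-trans x≤A (ι-mono-≤ (ℕ.<⇒≤ (ℕ.≤-<-trans
           (ℕ.≤-trans (ℕ.m≤m+n A _) (ℕ.m≤n+m _ k₁)) (n<2^n k₀))))) 2^k₀∈))
         (λ k k₀≤k → ℕ.m≤n⇒m≤1+n (ℕ.≤-trans (ℕ.≤-trans (ℕ.≤-trans (ℕ.m≤n+m _ ⌜ c ⌝) (ℕ.m≤n+m _ A))
             (ℕ.m≤n+m _ k₁)) k₀≤k))
         (λ k k₀≤k → free-lower k (ℕ.<⇒≤ 2+a<1+b) (subst (ℚ._≤ g k ℚ.* ι (suc b)) (/1+-* (2 + a) b)
           (*-monoʳ-≤ι (suc b) (ℚ.≤-trans a/b≤q′ (q′≤g k (ℕ.≤-trans (ℕ.m≤m+n k₁ _) k₀≤k))))))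
         succeeds
    where
    +-cancel≤ : ∀ {p r g e} → r ℚ.≤ g ℚ.+ e → e ℚ.≤ r ℚ.- p → p ℚ.≤ g
    +-cancel≤ {p} {r} {g} {e} r≤ e≤ = ℚ.≮⇒≥ λ g<p → ℚ.<-irrefl refl (ℚ.≤-<-trans r≤
      (subst (g ℚ.+ e ℚ.<_) (q+[p-q] r p) (ℚ.+-mono-<-≤ g<p e≤)))

-- Codes of rationals: the reduced denominator of a/b is the least d > 0 with b ∣ a d.

ceiling : ℕ → ℕ → ℕ
ceiling u b = search u λ x → u ∸ x * b

remainder : ℕ → ℕ → ℕ → ℕ
remainder a b y = ceiling (a * suc y) b * b ∸ a * suc y

reduced : ℕ → ℕ → ℕ
reduced a b = pair (2 * ceiling (a * suc y) b) (suc y)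
  where
  y : ℕ
  y = search b (remainder a b)

ceiling-spec : ∀ u b → u ℕ.≤ ceiling u (suc b) * suc b
ceiling-spec u b = ℕ.m∸n≡0⇒m≤n (search-zero u (λ x → u ∸ x * suc b) ℕ.≤-refl
  (ℕ.m≤n⇒m∸n≡0 (ℕ.m≤m*n u (suc b))))

ceiling-exact : ∀ n b → ceiling (n * suc b) (suc b) ≡ n
ceiling-exact n b = ℕ.≤-antisym
  (ℕ.≮⇒≥ λ n< → search-least (n * suc b) (λ x → n * suc b ∸ x * suc b) n< (ℕ.n∸n≡0 (n * suc b)))
  (ℕ.*-cancelʳ-≤ n _ (suc b) (ceiling-spec (n * suc b) b))

-- For q = n/d in lowest terms, n (1+b) = a d. Coprimality gives d ∣ 1 + b, so d is within reach of
-- the search; and if 1 + b divides a (1+y), then n (1+y) is a multiple of d, hence so is 1 + y.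
reduced-encodeℚ : ∀ q a b → 0ℚ ℚ.≤ q → q ℚ.* ι (suc b) ≡ ι a → reduced a (suc b) ≡ encodeℚ q
reduced-encodeℚ (ℚ.mkℚ -[1+ n ] d-1 _) a b (ℚ.*≤* ()) _
reduced-encodeℚ q@(ℚ.mkℚ (ℤ.+ n) d-1 c) a b 0≤q eq = cong₂ pair (cong (2 *_) num≡) (cong suc y≡)
  where
  d B y : ℕ
  d = suc d-1
  B = suc b
  y = search B (remainder a B)
  nB≡ad : n * B ≡ a * d
  nB≡ad = ℕ.≤-antisym (ι-cancel-≤ (ℚ.≤-reflexive eq′)) (ι-cancel-≤ (ℚ.≤-reflexive (sym eq′)))
    where
    eq′ : ι (n * B) ≡ ι (a * d)
    eq′ = trans (ι-* n B) (trans (cong (ℚ._* ι B) (sym (nonNeg-*-↧ 0≤q)))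
      (trans (swapʳ q (ι d) (ι B)) (trans (cong (ℚ._* ι d) eq) (sym (ι-* a d)))))
  coprime-dn : _
  coprime-dn = coprime-sym (recompute c)
  d∣B : d ∣ B
  d∣B = coprime-divisor coprime-dn (divides a nB≡ad)
  test-d : remainder a B d-1 ≡ 0
  test-d = trans (cong (λ u → ceiling u B * B ∸ u) (sym nB≡ad))
    (trans (cong (λ x → x * B ∸ n * B) (ceiling-exact n b)) (ℕ.n∸n≡0 (n * B)))
  y≤ : y ℕ.≤ d-1
  y≤ = ℕ.≮⇒≥ λ d-1<y → search-least B (remainder a B) d-1<y test-d
  test-y : remainder a B y ≡ 0
  test-y = search-zero B (remainder a B) (ℕ.≤-trans (ℕ.n≤1+n d-1) (∣⇒≤ d∣B)) test-d
  x : ℕ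
  x = ceiling (a * suc y) B
  xB≡ : x * B ≡ a * suc y
  xB≡ = ℕ.≤-antisym (ℕ.m∸n≡0⇒m≤n test-y) (ceiling-spec (a * suc y) b)
  xd≡ : n * suc y ≡ x * d
  xd≡ = ℕ.*-cancelʳ-≡ (n * suc y) (x * d) B (begin
    n * suc y * B     ≡⟨ rearrange n (suc y) B ⟩
    n * B * suc y     ≡⟨ cong (_* suc y) nB≡ad ⟩
    a * d * suc y     ≡⟨ rearrange a d (suc y) ⟩
    a * suc y * d     ≡⟨ cong (_* d) (sym xB≡) ⟩
    x * B * d         ≡⟨ rearrange x B d ⟩
    x * d * B         ∎)
    where
    open ≡-Reasoning
    rearrange : ∀ u v w → u * v * w ≡ u * w * v
    rearrange = solve-∀
  y≡ : y ≡ d-1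
  y≡ = ℕ.≤-antisym y≤ (ℕ.≤-pred (∣⇒≤ (coprime-divisor coprime-dn (divides x xd≡))))
  num≡ : x ≡ n
  num≡ = trans (cong (λ z → ceiling (a * suc z) B) y≡)
    (trans (cong (λ u → ceiling u B) (sym nB≡ad)) (ceiling-exact n b))

module _ {A : Pred ℕ 0ℓ} where

  ceilingᶜ : ∀ {n} {f g : Vec ℕ n → ℕ} → Computable A f → Computable A g →
             Computable A (λ xs → ceiling (f xs) (g xs))
  ceilingᶜ F G = searchᶜ {n = 2} (projᶜ 1F ∸ᶜ projᶜ 0F *ᶜ projᶜ 2F) (projᶜ 0F) ∘ᶜ (F ∷ᶜ G ∷ᶜ []ᶜ)

  reducedᶜ : ∀ {n} {f g : Vec ℕ n → ℕ} → Computable A f → Computable A g →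
             Computable A (λ xs → reduced (f xs) (g xs))
  reducedᶜ F G = pairᶜ (constᶜ 2 *ᶜ ceilingᶜ (F *ᶜ sucᶜ Y) G) (sucᶜ Y)
    where
    Y : Computable A _
    Y = searchᶜ {n = 2}
          (ceilingᶜ (projᶜ 1F *ᶜ sucᶜ (projᶜ 0F)) (projᶜ 2F) *ᶜ projᶜ 2F ∸ᶜ projᶜ 1F *ᶜ sucᶜ (projᶜ 0F))
          (projᶜ 1F) ∘ᶜ (F ∷ᶜ G ∷ᶜ []ᶜ)

-- Products along a string, computed from its code

along : (ℕ → ℕ → ℕ) → ℕ → Str → ℕ
along c i []      = 1
along c i (b ∷ w) = c i (encodeBool b) * along c (suc i) w

along-++ : ∀ c i u v → along c i (u ++ v) ≡ along c i u * along c (i + length u) v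
along-++ c i []      v = trans (cong (λ j → along c j v) (sym (ℕ.+-identityʳ i)))
    (sym (ℕ.*-identityˡ _))
along-++ c i (b ∷ u) v = trans (cong (c i (encodeBool b) *_) (along-++ c (suc i) u v))
  (trans (sym (ℕ.*-assoc (c i (encodeBool b)) (along c (suc i) u) _))
         (cong (λ j → c i (encodeBool b) * along c (suc i) u * along c j v)
             (sym (ℕ.+-suc i (length u)))))

along-const : ∀ m i w → along (λ _ _ → m) i w ≡ m ^ length w
along-const m i []      = refl
along-const m i (b ∷ w) = cong (m *_) (along-const m (suc i) w)

-- On codes of strings, n ↦ half (n ∸ 1) drops the first bit and fixes 0, the code of the empty
-- string.
tails : ℕ → ℕ → ℕ
tails n zero    = n
tails n (suc i) = half (tails n i ∸ 1)

-- The code of a string is at least its length, so n factors suffice; those past the end of the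
-- string are 1.
along-code : (ℕ → ℕ → ℕ) → ℕ → ℕ
along-code c n = ∏ n λ i → if0 (tails n i) 1 (c i (parity (tails n i ∸ 1)))

tails-suc : ∀ n i → tails n (suc i) ≡ tails (half (n ∸ 1)) i
tails-suc n zero    = refl
tails-suc n (suc i) = cong (λ m → half (m ∸ 1)) (tails-suc n i)

tails-zero : ∀ i → tails 0 i ≡ 0
tails-zero zero    = refl
tails-zero (suc i) = cong (λ m → half (m ∸ 1)) (tails-zero i)

∏-suc : ∀ n f → ∏ (suc n) f ≡ f 0 * ∏ n (λ i → f (suc i))
∏-suc zero    f = ℕ.*-comm 1 (f 0)
∏-suc (suc n) f = trans (cong (_* f (suc n)) (∏-suc n f)) (ℕ.*-assoc (f 0) _ (f (suc n)))

∏-cong : ∀ {f g : ℕ → ℕ} n → (∀ i → f i ≡ g i) → ∏ n f ≡ ∏ n g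
∏-cong zero    f≗g = refl
∏-cong (suc n) f≗g = cong₂ _*_ (∏-cong n f≗g) (f≗g n)

∏-one : ∀ n → ∏ n (λ _ → 1) ≡ 1
∏-one zero    = refl
∏-one (suc n) = trans (ℕ.*-identityʳ _) (∏-one n)

length≤encodeStr : ∀ w → length w ℕ.≤ encodeStr w
length≤encodeStr []      = z≤n
length≤encodeStr (b ∷ w) = s≤s (ℕ.≤-trans (length≤encodeStr w)
  (ℕ.≤-trans (ℕ.m≤n*m (encodeStr w) 2) (ℕ.m≤n+m _ (encodeBool b))))

half-encodeStr : ∀ b w → half (encodeBool b + 2 * encodeStr w) ≡ encodeStr w
half-encodeStr false w = half-+2* 0 (encodeStr w)
half-encodeStr true  w = half-+2* 1 (encodeStr w)

parity-encodeStr : ∀ b w → parity (encodeBool b + 2 * encodeStr w) ≡ encodeBool b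
parity-encodeStr false w = parity-+2* 0 (encodeStr w)
parity-encodeStr true  w = parity-+2* 1 (encodeStr w)

along-encodeStr : ∀ c w → along-code c (encodeStr w) ≡ along c 0 w
along-encodeStr c w = go 0 w (length≤encodeStr w)
  where
  go : ∀ i w {m} → length w ℕ.≤ m →
       ∏ m (λ j → if0 (tails (encodeStr w) j) 1
           (c (i + j) (parity (tails (encodeStr w) j ∸ 1)))) ≡ along c i w
  go i [] {m} _ = trans (∏-cong m λ j → cong (λ t → if0 t 1 (c (i + j) (parity (t ∸ 1))))
      (tails-zero j)) (∏-one m)
  go i (b ∷ w) {suc m} (s≤s w≤m) = trans (∏-suc m _) (cong₂ _*_
    (cong₂ c (ℕ.+-identityʳ i) (parity-encodeStr b w))
    (trans (∏-cong m λ j → cong₂ (λ t k → if0 t 1 (c k (parity (t ∸ 1))))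
             (trans (tails-suc (encodeStr (b ∷ w)) j) (cong (λ n → tails n j) (half-encodeStr b w)))
                 (ℕ.+-suc i j))
           (go (suc i) w w≤m)))

along-codeᶜ : ∀ {A n} {c : ℕ → ℕ → ℕ} {f : Vec ℕ n → ℕ} →
              Computable A {2} (λ xs → c (lookup xs 0F) (lookup xs 1F)) → Computable A f →
              Computable A (λ xs → along-code c (f xs))
along-codeᶜ {A} C F = ∏ᶜ {n = 1} (if0ᶜ T (constᶜ 1) (C ∘ᶜ (projᶜ 0F ∷ᶜ parityᶜ (T ∸ᶜ constᶜ 1) ∷ᶜ []ᶜ)))
                        (projᶜ 0F) ∘ᶜ (F ∷ᶜ []ᶜ)
  where
  T : Computable A {2} (λ xs → tails (lookup xs 1F) (lookup xs 0F))
  T = recᶜ {n = 2} {k = λ xs → lookup xs 0F} (λ k xs → tails (lookup xs 1F) k) (λ _ → refl)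
      (λ _ _ → refl)
        (projᶜ 1F) (halfᶜ (projᶜ 1F ∸ᶜ constᶜ 1)) (projᶜ 0F)

-- The upper bound

-- In block k ≥ k₁ the gale bets everything on 0 at the positions j with
-- j (1 + b) ≥ a (1 + k), where idle vanishes; elsewhere it bets evenly.
-- The 1 added in wealth keeps the capital positive, as its approximations must lie
-- strictly below it.

module Gale (k₁ a b M N : ℕ) where

  idle : ℕ → ℕ
  idle i = (k₁ ∸ diagonal i) + (a * suc (diagonal i) ∸ π₂ i * suc b)

  bet : ℕ → ℕ → ℕ
  bet i c = if0 (idle i) (if0 c 2 0) 1

  bet-fair : ∀ i → bet i 0 + bet i 1 ≡ 2
  bet-fair i with idle i
  ... | zero  = refl
  ... | suc _ = refl

  B : ℕ
  B = ℕ.pred (2 * suc N)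

  sucB : suc B ≡ 2 * suc N
  sucB = ℕ.suc-pred (2 * suc N)

  -- Half the ratio (1+M)/(1+N), which will be at most 2^s: a martingale multiplied by 2^(s-1) at
  -- each bit is an s-gale.
  rate : ℚ
  rate = suc M /1+ B

  wealth : Str → ℕ
  wealth w = suc (along bet 0 w)

  capital : Str → ℚ
  capital w = rate ^ℚ length w ℚ.* ι (wealth w)

  0<rate : 0ℚ ℚ.< rate
  0<rate = ℚ.≰⇒> λ rate≤0 → ℕ.<⇒≱ {0} {suc M} (s≤s z≤n) (ι-cancel-≤ (begin
    ι (suc M)           ≡⟨ /1+-* (suc M) B ⟨
    rate ℚ.* ι (suc B)  ≤⟨ *-monoʳ-≤ι (suc B) rate≤0 ⟩
    0ℚ ℚ.* ι (suc B)    ≡⟨ ℚ.*-zeroˡ (ι (suc B)) ⟩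
    0ℚ                  ∎))
    where open ℚ.≤-Reasoning

  0<capital : ∀ w → 0ℚ ℚ.< capital w
  0<capital w = 0<* (0<^ (length w) 0<rate) (0<ι (s≤s z≤n))

  gale : Str → ℝ≥0
  gale w = fromℚ (capital w) , λ q<0 → ℚ.<-trans q<0 (0<capital w)

  capital-∷ʳ : ∀ w → capital (w ∷ʳ false) ℚ.+ capital (w ∷ʳ true) ≡ capital w ℚ.* (rate ℚ.* ι 2)
  capital-∷ʳ w = begin
    rate ^ℚ length (w ∷ʳ false) ℚ.* ι (wealth (w ∷ʳ false)) ℚ.+
    rate ^ℚ length (w ∷ʳ true) ℚ.* ι (wealth (w ∷ʳ true))
      ≡⟨ cong₂ (λ m n → rate ^ℚ m ℚ.* ι (wealth (w ∷ʳ false)) ℚ.+ rate ^ℚ n ℚ.* ι (wealth (w ∷ʳ true)))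
               (length-∷ʳ false) (length-∷ʳ true) ⟩
    rate ℚ.* r ℚ.* ι (wealth (w ∷ʳ false)) ℚ.+ rate ℚ.* r ℚ.* ι (wealth (w ∷ʳ true))
      ≡⟨ sym (ℚ.*-distribˡ-+ (rate ℚ.* r) _ _) ⟩
    rate ℚ.* r ℚ.* (ι (wealth (w ∷ʳ false)) ℚ.+ ι (wealth (w ∷ʳ true)))
      ≡⟨ cong (rate ℚ.* r ℚ.*_) (trans (sym (ι-+ (wealth (w ∷ʳ false)) (wealth (w ∷ʳ true)))) (trans
          (cong ι total) (ι-* (wealth w) 2))) ⟩
    rate ℚ.* r ℚ.* (ι (wealth w) ℚ.* ι 2)
      ≡⟨ rearrange rate r (ι (wealth w)) (ι 2) ⟩
    r ℚ.* ι (wealth w) ℚ.* (rate ℚ.* ι 2) ∎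
    where
    open ≡-Reasoning
    r : ℚ
    r = rate ^ℚ length w
    length-∷ʳ : ∀ c → length (w ∷ʳ c) ≡ suc (length w)
    length-∷ʳ c = trans (length-++ w) (ℕ.+-comm (length w) 1)
    total : wealth (w ∷ʳ false) + wealth (w ∷ʳ true) ≡ wealth w * 2
    total = trans (cong₂ (λ x y → suc x + suc y) (along-++ bet 0 w (false ∷ []))
        (along-++ bet 0 w (true ∷ [])))
      (trans (collect (along bet 0 w) (bet (length w) 0) (bet (length w) 1))
        (trans (cong (λ s → 2 + along bet 0 w * s) (bet-fair (length w))) (double (along bet 0 w))))
      where
      collect : ∀ x y z → suc (x * (y * 1)) + suc (x * (z * 1)) ≡ 2 + x * (y + z)
      collect = solve-∀
      double : ∀ x → 2 + x * 2 ≡ suc x * 2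
      double = solve-∀
    rearrange : ∀ c r x t → c ℚ.* r ℚ.* (x ℚ.* t) ≡ r ℚ.* x ℚ.* (c ℚ.* t)
    rearrange = ring-solve-∀ ℚ-ring

  module _ {s : ℚ} {e : ℕ} (e/b≤s : e /1+ b ℚ.≤ s)
      (M/N≤ : suc M ^ suc b ℕ.≤ 2 ^ e * suc N ^ suc b) where

    gale-supergale : IsSupergale (fromℚ s) gale
    gale-supergale w (inj₁ q<0) = ℚ.<-trans q<0 (0<capital w)
    gale-supergale w {q} (inj₂ (y , z , 0≤y , 0≤z , y∈ , (u , v , u< , v< , z≡u+v) , q<yz)) =
      ℚ.<-≤-trans q<yz (begin
        y ℚ.* z                                      ≤⟨ ℚ.*-monoˡ-≤-nonNeg y {{ℚ.nonNegative 0≤y}} z≤ ⟩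
        y ℚ.* (capital w ℚ.* (rate ℚ.* ι 2))         ≡⟨ rearrange y (capital w) rate (ι 2) ⟩
        capital w ℚ.* (y ℚ.* rate ℚ.* ι 2)
          ≤⟨ ℚ.*-monoˡ-≤-nonNeg (capital w) {{ℚ.nonNegative (ℚ.<⇒≤ (0<capital w))}} y-rate≤1 ⟩
        capital w ℚ.* 1ℚ                             ≡⟨ ℚ.*-identityʳ (capital w) ⟩
        capital w                                    ∎)
      where
      open ℚ.≤-Reasoning
      rearrange : ∀ y c r t → y ℚ.* (c ℚ.* (r ℚ.* t)) ≡ c ℚ.* (y ℚ.* r ℚ.* t)
      rearrange = ring-solve-∀ ℚ-ring
      z≤ : z ℚ.≤ capital w ℚ.* (rate ℚ.* ι 2)
      z≤ = subst₂ ℚ._≤_ (sym z≡u+v) (capital-∷ʳ w) (ℚ.<⇒≤ (ℚ.+-mono-< u< v<))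
      yM≤N : y ℚ.* ι (suc M) ℚ.≤ ι (suc N)
      yM≤N = 2^-≤quotient {s} {e} {b} {N} {suc M} e/b≤s M/N≤ {y} y∈
      y-rate≤1 : y ℚ.* rate ℚ.* ι 2 ℚ.≤ 1ℚ
      y-rate≤1 = *-cancelʳ-≤ι B (begin
        y ℚ.* rate ℚ.* ι 2 ℚ.* ι (suc B)    ≡⟨ rearrange′ y rate (ι 2) (ι (suc B)) ⟩
        y ℚ.* (rate ℚ.* ι (suc B)) ℚ.* ι 2  ≡⟨ cong (λ x → y ℚ.* x ℚ.* ι 2) (/1+-* (suc M) B) ⟩
        y ℚ.* ι (suc M) ℚ.* ι 2             ≤⟨ *-monoʳ-≤ι 2 yM≤N ⟩
        ι (suc N) ℚ.* ι 2                   ≡⟨ ι-* (suc N) 2 ⟨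
        ι (suc N * 2)                       ≡⟨ cong ι (trans (ℕ.*-comm (suc N) 2) (sym sucB)) ⟩
        ι (suc B)                           ≡⟨ ℚ.*-identityˡ (ι (suc B)) ⟨
        1ℚ ℚ.* ι (suc B)                    ∎)
        where
        rearrange′ : ∀ y r t u → y ℚ.* r ℚ.* t ℚ.* u ≡ y ℚ.* (r ℚ.* u) ℚ.* t
        rearrange′ = ring-solve-∀ ℚ-ring

  -- The capital is itself a computable rational; the factor t/(1+t) makes the approach strict.
  ĝ : Str → ℕ → ℚ
  ĝ w t = capital w ℚ.* (t /1+ t)

  numerator denominator : Str → ℕ → ℕ
  numerator w t = suc M ^ length w * wealth w * t
  denominator w t = suc B ^ length w * suc t

  ĝ-quotient : ∀ w t → ĝ w t ℚ.* ι (denominator w t) ≡ ι (numerator w t)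
  ĝ-quotient w t = begin
    r ℚ.* x ℚ.* (t /1+ t) ℚ.* ι (suc B ^ length w * suc t)
      ≡⟨ cong (ĝ w t ℚ.*_) (ι-* (suc B ^ length w) (suc t)) ⟩
    r ℚ.* x ℚ.* (t /1+ t) ℚ.* (ι (suc B ^ length w) ℚ.* ι (suc t))
      ≡⟨ rearrange r x (t /1+ t) (ι (suc B ^ length w)) (ι (suc t)) ⟩
    r ℚ.* ι (suc B ^ length w) ℚ.* x ℚ.* ((t /1+ t) ℚ.* ι (suc t))  ≡⟨ cong₂ (λ u v → u ℚ.* x ℚ.* v)
              (quotient-^ {rate} {suc M} {suc B} (length w) (/1+-* (suc M) B)) (/1+-* t t) ⟩
    ι (suc M ^ length w) ℚ.* x ℚ.* ι t
      ≡⟨ cong (ℚ._* ι t) (ι-* (suc M ^ length w) (wealth w)) ⟨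
    ι (suc M ^ length w * wealth w) ℚ.* ι t
      ≡⟨ ι-* (suc M ^ length w * wealth w) t ⟨
    ι (numerator w t)                                               ∎
    where
    open ≡-Reasoning
    r x : ℚ
    r = rate ^ℚ length w
    x = ι (wealth w)
    rearrange : ∀ r x t b u → r ℚ.* x ℚ.* t ℚ.* (b ℚ.* u) ≡ r ℚ.* b ℚ.* x ℚ.* (t ℚ.* u)
    rearrange = ring-solve-∀ ℚ-ring

  0≤ĝ : ∀ w t → 0ℚ ℚ.≤ ĝ w t
  0≤ĝ w t = 0≤* (ℚ.<⇒≤ (0<capital w)) (0≤/1+ t t)

  ĝ<capital : ∀ w t → ĝ w t ℚ.< capital w
  ĝ<capital w t = subst (ĝ w t ℚ.<_) (ℚ.*-identityʳ (capital w))
    (ℚ.*-monoʳ-<-pos (capital w) {{ℚ.positive (0<capital w)}} (*-cancelʳ-<ι t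
      (subst₂ ℚ._<_ (sym (/1+-* t t)) (sym (ℚ.*-identityˡ (ι (suc t)))) (ι-mono-< (ℕ.n<1+n t)))))

  ĝ-rising : ∀ w t → ĝ w t ℚ.≤ ĝ w (suc t) × fromℚ (ĝ w (suc t)) < fromℚ (capital w)
  ĝ-rising w t =
    ℚ.*-monoˡ-≤-nonNeg (capital w) {{ℚ.nonNegative (ℚ.<⇒≤ (0<capital w))}}
      (/1+-mono t t (suc t) (suc t) (ℕ.≤-trans (ℕ.n≤1+n _) (ℕ.≤-reflexive (square t)))) ,
    ĝ w (suc t) , ℚ.<-irrefl refl , ĝ<capital w (suc t)
    where
    square : ∀ t → suc (t * suc (suc t)) ≡ suc t * suc t
    square = solve-∀

  ĝ-converges : ∀ w → ĝ w ⟶ fromℚ (capital w)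
  ĝ-converges w ε 0<ε = n , λ t n≤t → capital w ℚ.- ĝ w t , distance-fromℚ (ℚ.<⇒≤ (ĝ<capital w t)) ,
    *-cancelʳ-<ι t (begin-strict
      (capital w ℚ.- ĝ w t) ℚ.* ι (suc t)
        ≡⟨ distribute (capital w) (t /1+ t) (ι (suc t)) ⟩
      capital w ℚ.* ι (suc t) ℚ.- capital w ℚ.* ((t /1+ t) ℚ.* ι (suc t))
        ≡⟨ cong₂ (λ x y → capital w ℚ.* x ℚ.- capital w ℚ.* y) (ι-+ 1 t) (/1+-* t t) ⟩
      capital w ℚ.* (1ℚ ℚ.+ ι t) ℚ.- capital w ℚ.* ι t                   ≡⟨ collapse (capital w) (ι t) ⟩
      capital w                                                          ≡⟨ *-cancel-1/ ε (capital w) ⟨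
      ε ℚ.* (capital w ℚ.* ℚ.1/ ε)
        ≤⟨ ℚ.*-monoˡ-≤-nonNeg ε {{ℚ.nonNegative (ℚ.<⇒≤ 0<ε)}}
            (proj₂ (archimedean (capital w ℚ.* ℚ.1/ ε))) ⟩
      ε ℚ.* ι n
        <⟨ ℚ.*-monoʳ-<-pos ε {{ℚ.positive 0<ε}} (ι-mono-< (s≤s n≤t)) ⟩
      ε ℚ.* ι (suc t)                                                    ∎)
    where
    open ℚ.≤-Reasoning
    instance
      ε-nonZero : ℚ.NonZero ε
      ε-nonZero = ℚ.>-nonZero 0<ε
    n : ℕ
    n = proj₁ (archimedean (capital w ℚ.* ℚ.1/ ε))
    distribute : ∀ c r t → (c ℚ.- c ℚ.* r) ℚ.* t ≡ c ℚ.* t ℚ.- c ℚ.* (r ℚ.* t)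
    distribute = ring-solve-∀ ℚ-ring
    collapse : ∀ c t → c ℚ.* (1ℚ ℚ.+ t) ℚ.- c ℚ.* t ≡ c
    collapse = ring-solve-∀ ℚ-ring

  betᶜ : Computable ∅ {2} (λ xs → bet (lookup xs 0F) (lookup xs 1F))
  betᶜ = if0ᶜ (constᶜ k₁ ∸ᶜ diagonalᶜ (projᶜ 0F) +ᶜ
      (constᶜ a *ᶜ sucᶜ (diagonalᶜ (projᶜ 0F)) ∸ᶜ π₂ᶜ (projᶜ 0F) *ᶜ constᶜ (suc b)))
              (if0ᶜ (projᶜ 1F) (constᶜ 2) (constᶜ 0)) (constᶜ 1)

  ĝ-code : ℕ → ℕ → ℕ
  ĝ-code n t = reduced (along-code (λ _ _ → suc M) n * suc (along-code bet n) * t)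
                       (along-code (λ _ _ → suc B) n * suc t)

  ĝ-codeᶜ : Computable ∅ {2} (λ xs → ĝ-code (lookup xs 0F) (lookup xs 1F))
  ĝ-codeᶜ = reducedᶜ
    (along-codeᶜ {c = λ _ _ → suc M} (constᶜ (suc M)) (projᶜ 0F) *ᶜ sucᶜ
        (along-codeᶜ {c = bet} betᶜ (projᶜ 0F)) *ᶜ projᶜ 1F)
    (along-codeᶜ {c = λ _ _ → suc B} (constᶜ (suc B)) (projᶜ 0F) *ᶜ sucᶜ (projᶜ 1F))

  ĝ-code-correct : ∀ w t → ĝ-code (encodeStr w) t ≡ encodeℚ (ĝ w t)
  ĝ-code-correct w t = trans (cong₂ reduced
      (cong₂ (λ x y → x * suc y * t) (power (suc M)) (along-encodeStr bet w))
      (trans (cong (_* suc t) (power (suc B))) (sym suc-pred-D)))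
    (reduced-encodeℚ (ĝ w t) (numerator w t) (ℕ.pred D) (0≤ĝ w t)
      (trans (cong (λ n → ĝ w t ℚ.* ι n) suc-pred-D) (ĝ-quotient w t)))
    where
    D : ℕ
    D = denominator w t
    power : ∀ m → along-code (λ _ _ → m) (encodeStr w) ≡ m ^ length w
    power m = trans (along-encodeStr (λ _ _ → m) w) (along-const m 0 w)
    suc-pred-D : suc (ℕ.pred D) ≡ D
    suc-pred-D = ℕ.suc-pred D {{ℕ.m*n≢0 (suc B ^ length w) (suc t) {{ℕ.>-nonZero
        (ℕ.m^n>0 (suc B) (length w))}}}}

  gale-constructive : IsConstructive gale
  gale-constructive = ĝ ,
    (code ĝ-codeᶜ , λ w t → ⇓-resp-≡ (ĝ-code-correct w t) (run ĝ-codeᶜ (encodeStr w ∷ t ∷ []))) ,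
    ĝ-rising , ĝ-converges

module UpperBound (decide : ∀ n → Dec (n ∈ Halting)) (g : ℕ → ℚ) (k₁ a b M N : ℕ)
  (g≤ : ∀ k → k₁ ℕ.≤ k → g k ℚ.≤ a /1+ b) (N≤M : suc N ^ suc b * 2 ^ suc a ℕ.≤ suc M ^ suc b) where

  open Sequence decide g
  open Gale k₁ a b M N

  idle⇒false : ∀ i → idle i ≡ 0 → sequence i ≡ false
  idle⇒false i idle≡0 = subst (λ i → sequence i ≡ false) i≡
      (sequence-zero free≤ k (π₂≤diagonal i) (ℕ.≮⇒≥ contra))
    where
    k j : ℕ
    k = diagonal i
    j = π₂ i
    i≡ : triangle k + j ≡ i
    i≡ = ℕ.m+[n∸m]≡n (diagonal-lower i)
    k₁≤k : k₁ ℕ.≤ k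
    k₁≤k = ℕ.m∸n≡0⇒m≤n (ℕ.m+n≡0⇒m≡0 (k₁ ∸ k) idle≡0)
    ak≤jb : a * suc k ℕ.≤ j * suc b
    ak≤jb = ℕ.m∸n≡0⇒m≤n (ℕ.m+n≡0⇒n≡0 (k₁ ∸ k) idle≡0)
    contra : ¬ j ℕ.< free k
    contra j<free = ℕ.<⇒≱ (ι-cancel-< (begin-strict
      ι (j * suc b)                      ≡⟨ ι-* j (suc b) ⟩
      ι j ℚ.* ι (suc b)                  <⟨ *-monoʳ-<ι (s≤s z≤n) (free-upper k j<free) ⟩
      g k ℚ.* ι (suc k) ℚ.* ι (suc b)    ≡⟨ swapʳ (g k) (ι (suc k)) (ι (suc b)) ⟩
      g k ℚ.* ι (suc b) ℚ.* ι (suc k)    ≤⟨ *-monoʳ-≤ι (suc k) (*-monoʳ-≤ι (suc b) (g≤ k k₁≤k)) ⟩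
      (a /1+ b) ℚ.* ι (suc b) ℚ.* ι (suc k) ≡⟨ cong (ℚ._* ι (suc k)) (/1+-* a b) ⟩
      ι a ℚ.* ι (suc k)                  ≡⟨ ι-* a (suc k) ⟨
      ι (a * suc k)                      ∎)) ak≤jb
      where open ℚ.≤-Reasoning

  sequence-bet : ∀ i → bet i (encodeBool (sequence i)) ≡ if0 (idle i) 2 1
  sequence-bet i with idle i in eq
  ... | suc _ = refl
  ... | zero  = cong (λ c → if0 (encodeBool c) 2 0) (idle⇒false i eq)

  1≤bet : ∀ i → 1 ℕ.≤ bet i (encodeBool (sequence i))
  1≤bet i = subst (1 ℕ.≤_) (sym (sequence-bet i)) (positive (idle i))
    where
    positive : ∀ n → 1 ℕ.≤ if0 n 2 1
    positive zero    = s≤s z≤n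
    positive (suc _) = s≤s z≤n

  along-lower : ∀ m i f (T : ℕ → Bool) → (∀ j → j ℕ.< m → 1 ℕ.≤ bet (i + j) (encodeBool (T j))) →
                (∀ j → j ℕ.< m → f ℕ.≤ j → 2 ℕ.≤ bet (i + j) (encodeBool (T j))) →
                2 ^ (m ∸ f) ℕ.≤ along bet i (applyUpTo T m)
  along-lower zero    i f T one two rewrite ℕ.0∸n≡0 f = ℕ.≤-refl
  along-lower (suc m) i f T one two = step f two
    where
    shifted : ∀ j → i + suc j ≡ suc i + j
    shifted = ℕ.+-suc i
    one′ : ∀ j → j ℕ.< m → 1 ℕ.≤ bet (suc i + j) (encodeBool (T (suc j)))
    one′ j j<m = subst (λ k → 1 ℕ.≤ bet k (encodeBool (T (suc j)))) (shifted j) (one (suc j) (s≤s j<m))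
    step : ∀ f → (∀ j → j ℕ.< suc m → f ℕ.≤ j → 2 ℕ.≤ bet (i + j) (encodeBool (T j))) →
           2 ^ (suc m ∸ f) ℕ.≤ bet i (encodeBool (T 0)) * along bet (suc i)
               (applyUpTo (λ j → T (suc j)) m)
    step zero    two = ℕ.*-mono-≤ (subst (λ k → 2 ℕ.≤ bet k (encodeBool (T 0))) (ℕ.+-identityʳ i) (two 0
        (s≤s z≤n) z≤n))
      (along-lower m (suc i) 0 (λ j → T (suc j)) one′
        λ j j<m _ → subst (λ k → 2 ℕ.≤ bet k (encodeBool (T (suc j)))) (shifted j)
            (two (suc j) (s≤s j<m) z≤n))
    step (suc f) two = ℕ.≤-trans (ℕ.≤-reflexive (sym (ℕ.*-identityˡ _)))
      (ℕ.*-mono-≤ (subst (λ k → 1 ℕ.≤ bet k (encodeBool (T 0))) (ℕ.+-identityʳ i) (one 0 (s≤s z≤n)))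
      (along-lower m (suc i) f (λ j → T (suc j)) one′
        λ j j<m f≤j → subst (λ k → 2 ℕ.≤ bet k (encodeBool (T (suc j)))) (shifted j)
            (two (suc j) (s≤s j<m) (s≤s f≤j))))

  won : ℕ → ℕ
  won k = along bet 0 (applyUpTo sequence (triangle k))

  blockGain : ℕ → ℕ
  blockGain k = along bet (triangle k) (applyUpTo (λ j → sequence (triangle k + j)) (suc k))

  won-suc : ∀ k → won (suc k) ≡ won k * blockGain k
  won-suc k = trans (cong (along bet 0)
      (trans (cong (applyUpTo sequence) (ℕ.+-comm (suc k) (triangle k)))
                                               (applyUpTo-+ sequence (triangle k) (suc k))))
    (trans (along-++ bet 0 (applyUpTo sequence (triangle k)) _)
           (cong (λ i → won k * along bet i (applyUpTo (λ j → sequence (triangle k + j)) (suc k)))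
                 (length-applyUpTo sequence (triangle k))))

  1≤won : ∀ k → 1 ℕ.≤ won k
  1≤won k = subst (λ e → 2 ^ e ℕ.≤ won k) (ℕ.n∸n≡0 (triangle k))
    (along-lower (triangle k) 0 (triangle k) sequence (λ j _ → 1≤bet j)
        (λ j j< ≤j → contradiction ≤j (ℕ.<⇒≱ j<)))

  module _ (k : ℕ) (k₁≤k : k₁ ℕ.≤ k) (2b≤k : 2 * suc b ℕ.≤ suc k) where

    private
      m f : ℕ
      m = suc k
      -- An integer offset not below a m/(1+b), from which every position of the block is bet on.
      -- The rounding costs at most one factor 2.
      f = suc (a * m / suc b)

    f-upper : f * suc b ℕ.≤ suc b + a * m
    f-upper = ℕ.+-monoʳ-≤ (suc b) (m/n*n≤m (a * m) (suc b))

    f-lower : a * m ℕ.≤ f * suc b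
    f-lower = ℕ.≤-trans (ℕ.≤-reflexive (m≡m%n+[m/n]*n (a * m) (suc b)))
      (ℕ.+-monoˡ-≤ (a * m / suc b * suc b) (ℕ.<⇒≤ (m%n<n (a * m) (suc b))))

    blockGain≥ : 2 ^ (m ∸ f) ℕ.≤ blockGain k
    blockGain≥ = along-lower m (triangle k) f (λ j → sequence (triangle k + j))
        (λ j _ → 1≤bet (triangle k + j))
      λ j j<m f≤j → ℕ.≤-reflexive (sym (trans (sequence-bet (triangle k + j)) (cong (λ n → if0 n 2 1)
          (idle≡0 j (ℕ.≤-pred j<m) f≤j))))
      where
      idle≡0 : ∀ j → j ℕ.≤ k → f ℕ.≤ j → idle (triangle k + j) ≡ 0
      idle≡0 j j≤k f≤j = trans (cong₂ (λ d p → (k₁ ∸ d) + (a * suc d ∸ p * suc b)) (diagonal-+ k j≤k)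
          (π₂-+ k j≤k))
        (cong₂ _+_ (ℕ.m≤n⇒m∸n≡0 k₁≤k) (ℕ.m≤n⇒m∸n≡0 (ℕ.≤-trans f-lower (ℕ.*-monoˡ-≤ (suc b) f≤j))))

    -- In exponents over 1 + b, the ratio contributes (1+a) m where the unbet offsets cost only a m
    -- plus 1 + b for rounding. The surplus m ≥ 2 (1+b) pays for that rounding and for the doubling.
    block-doubles : 2 * suc B ^ m ℕ.≤ suc M ^ m * 2 ^ (m ∸ f)
    block-doubles = ^-cancelˡ-≤ b (begin
      (2 * suc B ^ m) ^ suc b                           ≡⟨ cong (λ x → (2 * x ^ m) ^ suc b) sucB ⟩
      (2 * (2 * suc N) ^ m) ^ suc b
        ≡⟨ cong (λ x → (2 * x) ^ suc b) (^-distrib-* 2 (suc N) m) ⟩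
      (2 * (2 ^ m * suc N ^ m)) ^ suc b
        ≡⟨ cong (_^ suc b) (sym (ℕ.*-assoc 2 (2 ^ m) (suc N ^ m))) ⟩
      (2 ^ suc m * suc N ^ m) ^ suc b                   ≡⟨ ^-distrib-* (2 ^ suc m) (suc N ^ m) (suc b) ⟩
      (2 ^ suc m) ^ suc b * (suc N ^ m) ^ suc b
        ≡⟨ cong₂ _*_ (ℕ.^-*-assoc 2 (suc m) (suc b)) (^-swap (suc N) m (suc b)) ⟩
      2 ^ (suc m * suc b) * (suc N ^ suc b) ^ m
        ≤⟨ ℕ.*-monoˡ-≤ ((suc N ^ suc b) ^ m) (ℕ.^-monoʳ-≤ 2 exponents) ⟩
      2 ^ (suc a * m + (m ∸ f) * suc b) * (suc N ^ suc b) ^ m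
        ≡⟨ cong (_* (suc N ^ suc b) ^ m) (ℕ.^-distribˡ-+-* 2 (suc a * m) ((m ∸ f) * suc b)) ⟩
      2 ^ (suc a * m) * 2 ^ ((m ∸ f) * suc b) * (suc N ^ suc b) ^ m
        ≡⟨ rearrange (2 ^ (suc a * m)) (2 ^ ((m ∸ f) * suc b)) ((suc N ^ suc b) ^ m) ⟩
      (suc N ^ suc b) ^ m * 2 ^ (suc a * m) * 2 ^ ((m ∸ f) * suc b)
        ≡⟨ cong₂ (λ x y → (suc N ^ suc b) ^ m * x * y) (sym (ℕ.^-*-assoc 2 (suc a) m))
            (sym (ℕ.^-*-assoc 2 (m ∸ f) (suc b))) ⟩
      (suc N ^ suc b) ^ m * (2 ^ suc a) ^ m * (2 ^ (m ∸ f)) ^ suc b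
        ≡⟨ cong (_* (2 ^ (m ∸ f)) ^ suc b) (sym (^-distrib-* (suc N ^ suc b) (2 ^ suc a) m)) ⟩
      (suc N ^ suc b * 2 ^ suc a) ^ m * (2 ^ (m ∸ f)) ^ suc b
        ≤⟨ ℕ.*-monoˡ-≤ ((2 ^ (m ∸ f)) ^ suc b) (ℕ.^-monoˡ-≤ m N≤M) ⟩
      (suc M ^ suc b) ^ m * (2 ^ (m ∸ f)) ^ suc b
        ≡⟨ cong (_* (2 ^ (m ∸ f)) ^ suc b) (^-swap (suc M) (suc b) m) ⟩
      (suc M ^ m) ^ suc b * (2 ^ (m ∸ f)) ^ suc b
        ≡⟨ ^-distrib-* (suc M ^ m) (2 ^ (m ∸ f)) (suc b) ⟨
      (suc M ^ m * 2 ^ (m ∸ f)) ^ suc b                 ∎)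
      where
      open ℕ.≤-Reasoning
      rearrange : ∀ x y z → x * y * z ≡ z * x * y
      rearrange = solve-∀
      exponents : suc m * suc b ℕ.≤ suc a * m + (m ∸ f) * suc b
      exponents = begin
        suc b + m * suc b
          ≤⟨ ℕ.+-monoʳ-≤ (suc b) (ℕ.*-monoˡ-≤ (suc b) (ℕ.m≤n+m∸n m f)) ⟩
        suc b + (f + (m ∸ f)) * suc b
          ≡⟨ cong (suc b +_) (ℕ.*-distribʳ-+ (suc b) f (m ∸ f)) ⟩
        suc b + (f * suc b + (m ∸ f) * suc b)
          ≤⟨ ℕ.+-monoʳ-≤ (suc b) (ℕ.+-monoˡ-≤ ((m ∸ f) * suc b) f-upper) ⟩
        suc b + (suc b + a * m + (m ∸ f) * suc b)      ≡⟨ collect (suc b) (a * m) ((m ∸ f) * suc b) ⟩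
        2 * suc b + (a * m + (m ∸ f) * suc b)          ≤⟨ ℕ.+-monoˡ-≤ (a * m + (m ∸ f) * suc b) 2b≤k ⟩
        m + (a * m + (m ∸ f) * suc b)                  ≡⟨ ℕ.+-assoc m (a * m) ((m ∸ f) * suc b) ⟨
        suc a * m + (m ∸ f) * suc b                    ∎
        where
        collect : ∀ b x y → b + (b + x + y) ≡ 2 * b + (x + y)
        collect = solve-∀

    rate-block : ι 2 ℚ.≤ rate ^ℚ m ℚ.* ι (blockGain k)
    rate-block = ℚ.*-cancelʳ-≤-pos (ι (suc B ^ m)) {{ℚ.positive (0<ι (ℕ.m^n>0 (suc B) m))}} (begin
      ι 2 ℚ.* ι (suc B ^ m)                            ≡⟨ ι-* 2 (suc B ^ m) ⟨
      ι (2 * suc B ^ m)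
        ≤⟨ ι-mono-≤ (ℕ.≤-trans block-doubles (ℕ.*-monoʳ-≤ (suc M ^ m) blockGain≥)) ⟩
      ι (suc M ^ m * blockGain k)                      ≡⟨ ι-* (suc M ^ m) (blockGain k) ⟩
      ι (suc M ^ m) ℚ.* ι (blockGain k)
        ≡⟨ cong (ℚ._* ι (blockGain k)) (quotient-^ {rate} {suc M} {suc B} m (/1+-* (suc M) B)) ⟨
      rate ^ℚ m ℚ.* ι (suc B ^ m) ℚ.* ι (blockGain k)
        ≡⟨ swapʳ (rate ^ℚ m) (ι (suc B ^ m)) (ι (blockGain k)) ⟩
      rate ^ℚ m ℚ.* ι (blockGain k) ℚ.* ι (suc B ^ m)  ∎)
      where open ℚ.≤-Reasoning

  -- The capital without the 1 added in `wealth`: this part is multiplicative over blocks.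
  stake : ℕ → ℚ
  stake k = rate ^ℚ triangle k ℚ.* ι (won k)

  0<stake : ∀ k → 0ℚ ℚ.< stake k
  0<stake k = 0<* (0<^ (triangle k) 0<rate) (0<ι (1≤won k))

  stake≤capital : ∀ k → stake k ℚ.≤ capital (applyUpTo sequence (triangle k))
  stake≤capital k = subst (λ l → stake k ℚ.≤ rate ^ℚ l ℚ.* ι (suc (won k)))
      (sym (length-applyUpTo sequence (triangle k)))
    (ℚ.*-monoˡ-≤-nonNeg (rate ^ℚ triangle k) {{ℚ.nonNegative (0≤^ (triangle k) (ℚ.<⇒≤ 0<rate))}}
        (ι-mono-≤ (ℕ.n≤1+n (won k))))

  stake-doubles : ∀ k → k₁ ℕ.≤ k → 2 * suc b ℕ.≤ suc k → stake k ℚ.* ι 2 ℚ.≤ stake (suc k)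
  stake-doubles k k₁≤k 2b≤k = begin
    stake k ℚ.* ι 2
      ≤⟨ ℚ.*-monoˡ-≤-nonNeg (stake k) {{ℚ.nonNegative (ℚ.<⇒≤ (0<stake k))}} (rate-block k k₁≤k 2b≤k) ⟩
    stake k ℚ.* (rate ^ℚ suc k ℚ.* ι (blockGain k))
      ≡⟨ rearrange (rate ^ℚ triangle k) (ι (won k)) (rate ^ℚ suc k) (ι (blockGain k)) ⟩
    rate ^ℚ suc k ℚ.* rate ^ℚ triangle k ℚ.* (ι (won k) ℚ.* ι (blockGain k))
      ≡⟨ cong₂ ℚ._*_ (sym (^-distrib-+ rate (suc k) (triangle k)))
           (trans (sym (ι-* (won k) (blockGain k))) (cong ι (sym (won-suc k)))) ⟩
    stake (suc k)                                               ∎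
    where
    open ℚ.≤-Reasoning
    rearrange : ∀ r w q g → r ℚ.* w ℚ.* (q ℚ.* g) ≡ q ℚ.* r ℚ.* (w ℚ.* g)
    rearrange = ring-solve-∀ ℚ-ring

  stake-grows : ∀ k → k₁ ℕ.≤ k → 2 * suc b ℕ.≤ suc k → ∀ i → stake k ℚ.* ι (2 ^ i) ℚ.≤ stake (i + k)
  stake-grows k k₁≤k 2b≤k zero    = ℚ.≤-reflexive (ℚ.*-identityʳ (stake k))
  stake-grows k k₁≤k 2b≤k (suc i) = begin
    stake k ℚ.* ι (2 ^ suc i)
      ≡⟨ cong (stake k ℚ.*_) (trans (cong ι (ℕ.*-comm 2 (2 ^ i))) (ι-* (2 ^ i) 2)) ⟩
    stake k ℚ.* (ι (2 ^ i) ℚ.* ι 2)       ≡⟨ ℚ.*-assoc (stake k) (ι (2 ^ i)) (ι 2) ⟨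
    stake k ℚ.* ι (2 ^ i) ℚ.* ι 2         ≤⟨ *-monoʳ-≤ι 2 (stake-grows k k₁≤k 2b≤k i) ⟩
    stake (i + k) ℚ.* ι 2
      ≤⟨ stake-doubles (i + k) (ℕ.≤-trans k₁≤k (ℕ.m≤n+m k i)) (ℕ.≤-trans 2b≤k (s≤s (ℕ.m≤n+m k i))) ⟩
    stake (suc i + k)                     ∎
    where open ℚ.≤-Reasoning

  gale-succeeds : ∀ {T} → sequence ≗ T → T ∈ S^∞[ gale ]
  gale-succeeds {T} S≗T C n = triangle K , ℕ.≤-trans (ℕ.≤-trans (ℕ.m≤n+m n c) (ℕ.m≤m+n (c + n) k))
      (n≤triangle K) ,
    C , ℚ.<-irrefl refl , subst (λ w → C ℚ.< capital w) (applyUpTo-cong (triangle K) λ i _ → S≗T i)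
        (begin-strict
      C                                ≡⟨ *-cancel-1/ (stake k) C ⟨
      stake k ℚ.* (C ℚ.* ℚ.1/ stake k)
        ≤⟨ ℚ.*-monoˡ-≤-nonNeg (stake k) {{nonNeg}} (proj₂ (archimedean (C ℚ.* ℚ.1/ stake k))) ⟩
      stake k ℚ.* ι c                  <⟨ ℚ.*-monoʳ-<-pos (stake k) {{ℚ.positive (0<stake k)}}
                                            (ι-mono-< (ℕ.<-≤-trans (n<2^n c)
                                                (ℕ.^-monoʳ-≤ 2 (ℕ.m≤m+n c n)))) ⟩
      stake k ℚ.* ι (2 ^ (c + n))
        ≤⟨ stake-grows k (ℕ.m≤m+n k₁ _) (ℕ.m≤n⇒m≤1+n (ℕ.m≤n+m (2 * suc b) k₁)) (c + n) ⟩
      stake K                          ≤⟨ stake≤capital K ⟩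
      capital (applyUpTo sequence (triangle K)) ∎)
    where
    open ℚ.≤-Reasoning
    k c K : ℕ
    k = k₁ + 2 * suc b
    instance
      stake-nonZero : ℚ.NonZero (stake k)
      stake-nonZero = ℚ.>-nonZero (0<stake k)
    c = proj₁ (archimedean (C ℚ.* ℚ.1/ stake k))
    -- From block k on each block doubles the stake: c doublings lift it above C, and n further
    -- blocks put the position beyond n.
    K = c + n + k
    nonNeg : ℚ.NonNegative (stake k)
    nonNeg = ℚ.nonNegative (ℚ.<⇒≤ (0<stake k))

-- The dimension as an infimum

module _ (decide : ∀ n → Dec (n ∈ Halting)) (g : ℕ → ℚ) {α : ℝ}
         (close : ∀ r → Defs.∣ fromℚ (g r) Defs.- α ∣ ≤ fromℚ (½ ^ℚ r)) where

  open Sequence decide g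

  upper-bound : ∀ {q r} → 0ℚ ℚ.≤ q → q ∉ cut α → q ℚ.< r →
                Σ (Str → ℝ≥0) λ d → IsSupergale (fromℚ r) d × IsConstructive d ×
                    (sequence ≗_) ⊆ S^∞[ d ]
  upper-bound {q} {r} 0≤q q∉α q<r =
    let (a , b , q<a/b , a/b≤r) = between 0≤q q<r
        -- With `suc a` the ratio is at least 2^((1+a)/(1+b)), one step above the density a/(1+b) of
        -- the positions not bet on, and at most 2^((2+a)/(1+b)) ≤ 2^r.
        (M , N , N≤M , M≤N) = root (suc a) b
        (k₁ , ½^≤) = ½^-small (+-<⇒<- {0ℚ} {q} (subst (ℚ._< a /1+ b) (sym (ℚ.+-identityˡ q)) q<a/b))
        g≤ = λ k k₁≤k → subst (g k ℚ.≤_) (q+[p-q] (a /1+ b) q) (ℚ.≤-trans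
               (distance-upper (g k) α (λ ½^∈ → ℚ.<-irrefl refl (close k ½^∈)) q∉α)
                   (ℚ.+-monoʳ-≤ q (½^≤ k k₁≤k)))
    in Gale.gale k₁ a b M N ,
       (λ w {x} → Gale.gale-supergale k₁ a b M N {r} {2 + a} a/b≤r M≤N w {x}) ,
       Gale.gale-constructive k₁ a b M N ,
       λ {T} → UpperBound.gale-succeeds decide g k₁ a b M N g≤ N≤M {T}

theorem4p5 : ExcludedMiddle (lsuc 0ℓ) →
    (α : ℝ) → 0ℝ ≤ α → α ≤ 1ℝ → Δ⁰₂-Computable α →
    Σ Cantor λ S → Δ⁰₂-Sequence S × IsDim S α
theorem4p5 em α 0≤α α≤1 (g , g-code , close) =
  sequence , sequence-Δ⁰₂ g-code , record { lowerBound = α-lowerBound ; greatest = α-greatest }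
  where
  -- Classical logic enters only here: it provides the characteristic function of the halting set,
  -- from which the sequence is defined, and decides membership in cuts.
  decide : (A : Set) → Dec A
  decide A with em {Lift (lsuc 0ℓ) A}
  ... | yes (lift a) = yes a
  ... | no ¬a        = no λ a → ¬a (lift a)

  open Sequence (λ n → decide (n ∈ Halting)) g

  Success : ℝ → Set₁
  Success s = 0ℝ ≤ s
    × Σ (Str → ℝ≥0) λ d → IsSupergale s d × IsConstructive d × (sequence ≗_) ⊆ S^∞[ d ]

  α-lowerBound : ∀ s → Success s → α ≤ s
  α-lowerBound s (0≤s , d , supergale ,
      (f̂ , (c , run-c) , rising , converges) , succeeds) {q} q∈α with decide (q ∈ cut s)
  ... | yes q∈s = q∈s
  ... | no  q∉s = contradiction q∈α
      (LowerBound.lower-bound (λ n → decide (n ∈ Halting)) g {s} {d} supergale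
                    f̂ c run-c rising converges {α} close 0≤s α≤1 (succeeds λ _ → refl) q∉s)

  α-greatest : ∀ l → (∀ s → Success s → l ≤ s) → l ≤ α
  α-greatest l l≤ {q} q∈l with decide (q ∈ cut α)
  ... | yes q∈α = q∈α
  ... | no  q∉α =
    -- Some rational r in the cut of l lies above q, hence above α, so a gale succeeds at r. Then l
    -- ≤ r puts r strictly below itself.
    let (r , q<r , r∈l) = noMaximum l q∈l
        0≤q = ℚ.≮⇒≥ λ q<0 → q∉α (0≤α q<0)
    in contradiction (l≤ (fromℚ r) ((λ x<0 → ℚ.<-trans x<0 (ℚ.≤-<-trans 0≤q q<r))
                       , upper-bound (λ n → decide (n ∈ Halting)) g {α} close 0≤q q∉α q<r) r∈l)
                     (ℚ.<-irrefl refl)
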